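{- The theory $\mathrm{RCA}_0^{\Omega}$ proves the equivalences $$(\exists^{2})\leftrightarrow \Pi^0_1\text{ -TRANS}\leftrightarrow \mathrm{IVT}^{*}\leftrightarrow \mathrm{UIVT}.$$
   Context: BASE THEORY. Finite types: $0$ (natural numbers), $\sigma\to\tau$, and $\sigma^{*}$ (finite sequences of objects of type $\sigma$); $1=0\to 0$, $2=1\to 0$, $3=2\to 0$. Superscripts indicate types; tuples are coded as single objects where convenient. Equality $=_0$ is primitive; for $\tau=\tau_1\to\dots\to\tau_k\to 0$, $x=_\tau y$ means $(\forall z_1\dots z_k)(xz_1\dots z_k=_0 yz_1\dots z_k)$. $\mathrm{RCA}_0^{\omega}$ is Kohlenbach's higher-order base theory: classical arithmetic in all finite types with combinators, zero, successor, the recursor $R_0$ (primitive recursion with type $0$ values), quantifier-free induction, extensionality $x=_\rho y\to\varphi(x)=_\tau\varphi(y)$ for all $\varphi^{\rho\to\tau}$, and $\mathrm{QF\text{ - }AC}^{1,0}$, where $\mathrm{QF\text{ - }AC}^{\sigma,\tau}$ is $(\forall x^\sigma)(\exists y^\tau)A_0(x,y)\to(\exists F^{\sigma\to\tau})(\forall x)A_0(x,F(x))$ for quantifier-free $A_0$. $\mathrm{RCA}_0^{\Omega}$ extends $\mathrm{RCA}_0^{\omega}$ (with the types $\sigma^*$) by a predicate $\mathrm{st}$ ("is standard") for each type. A formula is internal if it does not contain $\mathrm{st}$; $(\forall^{\mathrm{st}}x)A$ is $(\forall x)(\mathrm{st}(x)\to A)$, $(\exists^{\mathrm{st}}x)A$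 is $(\exists x)(\mathrm{st}(x)\wedge A)$; $N\in\Omega$ means $\neg\mathrm{st}(N^0)$; $A^{\mathrm{st}}$ is $A$ with all quantifiers (except bounded number quantifiers) relativised to $\mathrm{st}$. Axioms: (i) standardness respects equality, closed terms are standard, a standard functional applied to a standard object is standard, and numbers below a standard number are standard; (ii) Idealization: $(\forall^{\mathrm{st}}x^{\sigma^*})(\exists y^\tau)(\forall z\in x)\varphi(z,y)\to(\exists y)(\forall^{\mathrm{st}}z^{\sigma})\varphi(z,y)$ for internal $\varphi$; (iii) $\mathrm{HAC}_{\mathrm{int}}$: $(\forall^{\mathrm{st}}x^{\rho})(\exists^{\mathrm{st}}y^{\tau})\varphi(x,y)\to(\exists^{\mathrm{st}}\Phi^{\rho\to\tau^*})(\forall^{\mathrm{st}}x)(\exists y\in\Phi(x))\varphi(x,y)$ for internal $\varphi$; (iv) $\mathrm{PF\text{ - }TP}_\forall$: $(\forall^{\mathrm{st}}x^\tau)\varphi(x)\to(\forall x^\tau)\varphi(x)$ for internal $\varphi(x)$ with no parameters other than $x$; (v) for certain functionals uniquely specified by a parameter-free internal formula $D$ (e.g. the one in $(\exists^2)$), a constant $\Xi_0$ with the axiom $\mathrm{st}(\Xi_0)\wedge(\forall^{\mathrm{st}}\Xi)[D^{\mathrm{st}}(\Xi)\to \Xi_0$ and $\Xi$ agree on all standard inputs$]$; these constants do not count as parameters in (iv). NOTATION. A real is a fast-converging Cauchy sequence of rationals $q_{(\cdot)}^1$, i.e. $(\forall n,i)(|q_n-q_{n+i}|<2^{ -n})$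 (via a standard trick every $f^1$ can be viewed as a real); reals $q_{(\cdot)},r_{(\cdot)}$ are equal if $(\forall n)(|q_n-r_n|\leq 2^{ -n})$. Functions from reals to reals are given by functionals of type $1\to1$ mapping equal reals to equal reals. $f\in C[0,1]$ means $f$ is $\varepsilon$-$\delta$-continuous on $[0,1]$; $f\in\overline{C}[0,1]$ means $f\in C[0,1]$, $f(0)\geq0$ and $f(1)\leq 0$; $\overline{C}^{\mathrm{st}}[0,1]$ is defined by the same formula with all quantifiers relative to $\mathrm{st}$. PRINCIPLES. $(\exists^2)$: $(\exists\varphi^2)(\forall g^1)[(\exists x^0)g(x)=0\leftrightarrow\varphi(g)=0]$. $\Pi^0_1\text{ -TRANS}$: $(\forall^{\mathrm{st}}f^1)[(\forall^{\mathrm{st}}n^0)f(n)=0\to(\forall n^0)f(n)=0]$. $\mathrm{IVT}^*$: $(\forall^{\mathrm{st}}f^{1\to1}\in\overline{C}^{\mathrm{st}}[0,1])(\exists^{\mathrm{st}}x^1\in[0,1])(f(x)=0)$, where $f(x)=0$ is (full, internal) equality of reals. $\mathrm{UIVT}$: $(\exists\Phi^{(1\to1)\to1})(\forall f^{1\to1}\in\overline{C}[0,1])(f(\Phi(f))=0)$. -}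

module Defs where

open import Data.Nat using (ℕ; zero; suc)
open import Data.Empty using (⊥)
open import Data.Unit using (⊤)
open import Data.Product using (_×_)
open import Data.List using (List; []; _∷_; map)
open import Data.List.Membership.Propositional using (_∈_)
open import Data.List.Relation.Unary.Any using (here; there)
open import Data.Maybe using (Maybe; just; nothing)
open import Relation.Binary.PropositionalEquality using (refl)

infixr 30 _⟶_
infix  35 _⋆

data Ty : Set where
  𝟎   : Ty
  _⟶_ : Ty → Ty → Ty
  _⋆  : Ty → Ty

𝟏 𝟐 : Ty
𝟏 = 𝟎 ⟶ 𝟎
𝟐 = 𝟏 ⟶ 𝟎

Ctx : Set
Ctx = List Ty

-- The constants Ξ₀ that a language has besides those of RCA₀^ω.
record Signature : Set₁ where
  field
    Name : Set
    type : Name → Ty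

∅ : Signature
∅ = record { Name = ⊥ ; type = λ () }

-- Sequence types are given by length, entries and the map (f , n) ↦ ⟨f 0 , … , f (n ∸ 1)⟩;
-- this is the definitional extension in which σ⋆ is coded by pairs of a length
-- and a functional of type 𝟎 ⟶ σ.
data Const : Ty → Set where
  K    : ∀ {σ τ} → Const (σ ⟶ τ ⟶ σ)
  S    : ∀ {ρ σ τ} → Const ((ρ ⟶ σ ⟶ τ) ⟶ (ρ ⟶ σ) ⟶ ρ ⟶ τ)
  zer  : Const 𝟎
  suc  : Const (𝟎 ⟶ 𝟎)
  R₀   : Const (𝟎 ⟶ 𝟎 ⟶ (𝟎 ⟶ 𝟎 ⟶ 𝟎) ⟶ 𝟎)
  len  : ∀ {σ} → Const (σ ⋆ ⟶ 𝟎)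
  at   : ∀ {σ} → Const (σ ⋆ ⟶ 𝟎 ⟶ σ)
  init : ∀ {σ} → Const ((𝟎 ⟶ σ) ⟶ 𝟎 ⟶ σ ⋆)

infixl 20 _·_

data Tm (Sg : Signature) (Γ : Ctx) : Ty → Set where
  var : ∀ {σ} → σ ∈ Γ → Tm Sg Γ σ
  con : ∀ {σ} → Const σ → Tm Sg Γ σ
  ext : (c : Signature.Name Sg) → Tm Sg Γ (Signature.type Sg c)
  _·_ : ∀ {σ τ} → Tm Sg Γ (σ ⟶ τ) → Tm Sg Γ σ → Tm Sg Γ τ

infix  10 _≈_
infix  9 ¬′_
infix  25 _ˢᵗ
infixr 8 _∧_
infixr 7 _∨_
infixr 6 _⊃_
infix  5 _⇔_

data Formula (Sg : Signature) (Γ : Ctx) : Set where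
  _≈_ : Tm Sg Γ 𝟎 → Tm Sg Γ 𝟎 → Formula Sg Γ
  st  : ∀ {σ} → Tm Sg Γ σ → Formula Sg Γ
  ⊥′  : Formula Sg Γ
  _∧_ _∨_ _⊃_ : Formula Sg Γ → Formula Sg Γ → Formula Sg Γ
  ∀′ ∃′ : (σ : Ty) → Formula Sg (σ ∷ Γ) → Formula Sg Γ

private
  variable
    Sg : Signature
    Γ Γ′ : Ctx
    ρ σ τ : Ty

¬′_ : Formula Sg Γ → Formula Sg Γ
¬′ A = A ⊃ ⊥′

_⇔_ : Formula Sg Γ → Formula Sg Γ → Formula Sg Γ
A ⇔ B = (A ⊃ B) ∧ (B ⊃ A)

Ren : Ctx → Ctx → Set
Ren Γ Γ′ = ∀ {σ} → σ ∈ Γ → σ ∈ Γ′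

Sub : Signature → Ctx → Ctx → Set
Sub Sg Γ Γ′ = ∀ {σ} → σ ∈ Γ → Tm Sg Γ′ σ

liftR : Ren Γ Γ′ → Ren (τ ∷ Γ) (τ ∷ Γ′)
liftR r (here p)  = here p
liftR r (there x) = there (r x)

renT : Ren Γ Γ′ → Tm Sg Γ σ → Tm Sg Γ′ σ
renT r (var x) = var (r x)
renT r (con c) = con c
renT r (ext c) = ext c
renT r (s · t) = renT r s · renT r t

ren : Ren Γ Γ′ → Formula Sg Γ → Formula Sg Γ′
ren r (s ≈ t)  = renT r s ≈ renT r t
ren r (st t)   = st (renT r t)
ren r ⊥′       = ⊥′
ren r (A ∧ B)  = ren r A ∧ ren r B
ren r (A ∨ B)  = ren r A ∨ ren r B
ren r (A ⊃ B)  = ren r A ⊃ ren r B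
ren r (∀′ σ A) = ∀′ σ (ren (liftR r) A)
ren r (∃′ σ A) = ∃′ σ (ren (liftR r) A)

wk : Tm Sg Γ σ → Tm Sg (τ ∷ Γ) σ
wk = renT there

liftS : Sub Sg Γ Γ′ → Sub Sg (τ ∷ Γ) (τ ∷ Γ′)
liftS s (here p)  = var (here p)
liftS s (there x) = wk (s x)

subT : Sub Sg Γ Γ′ → Tm Sg Γ σ → Tm Sg Γ′ σ
subT s (var x) = s x
subT s (con c) = con c
subT s (ext c) = ext c
subT s (t · u) = subT s t · subT s u

sub : Sub Sg Γ Γ′ → Formula Sg Γ → Formula Sg Γ′
sub s (t ≈ u)  = subT s t ≈ subT s u
sub s (st t)   = st (subT s t)
sub s ⊥′       = ⊥′
sub s (A ∧ B)  = sub s A ∧ sub s B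
sub s (A ∨ B)  = sub s A ∨ sub s B
sub s (A ⊃ B)  = sub s A ⊃ sub s B
sub s (∀′ σ A) = ∀′ σ (sub (liftS s) A)
sub s (∃′ σ A) = ∃′ σ (sub (liftS s) A)

single : Tm Sg Γ σ → Sub Sg (σ ∷ Γ) Γ
single t (here refl) = t
single t (there x)   = var x

_[_] : Formula Sg (σ ∷ Γ) → Tm Sg Γ σ → Formula Sg Γ
A [ t ] = sub (single t) A

closed : Tm Sg [] σ → Tm Sg Γ σ
closed = renT (λ ())

_⟨_⟩ : Formula Sg (σ ∷ []) → Tm Sg Γ σ → Formula Sg Γ
A ⟨ t ⟩ = sub (λ { (here refl) → t }) A

embedT : Tm ∅ Γ σ → Tm Sg Γ σ
embedT (var x) = var x
embedT (con c) = con c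
embedT (s · t) = embedT s · embedT t

embed : Formula ∅ Γ → Formula Sg Γ
embed (s ≈ t)  = embedT s ≈ embedT t
embed (st t)   = st (embedT t)
embed ⊥′       = ⊥′
embed (A ∧ B)  = embed A ∧ embed B
embed (A ∨ B)  = embed A ∨ embed B
embed (A ⊃ B)  = embed A ⊃ embed B
embed (∀′ σ A) = ∀′ σ (embed A)
embed (∃′ σ A) = ∃′ σ (embed A)

v0 : Tm Sg (σ ∷ Γ) σ
v0 = var (here refl)

v1 : Tm Sg (τ ∷ σ ∷ Γ) σ
v1 = wk v0

v2 : Tm Sg (ρ ∷ τ ∷ σ ∷ Γ) σ
v2 = wk v1

-- The language has combinators only, so abstraction is defined.
ƛ : Tm Sg (σ ∷ Γ) τ → Tm Sg Γ (σ ⟶ τ)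
ƛ {σ = σ} (var (here refl)) = con S · con K · con (K {τ = σ})
ƛ (var (there x))           = con K · var x
ƛ (con c)                   = con K · con c
ƛ (ext c)                   = con K · ext c
ƛ (s · t)                   = con S · ƛ s · ƛ t

num : ℕ → Tm Sg Γ 𝟎
num zero    = con zer
num (suc n) = con suc · num n

pred : Tm Sg Γ (𝟎 ⟶ 𝟎)
pred = ƛ (con R₀ · v0 · num 0 · ƛ (ƛ v0))

plus times monus : Tm Sg Γ (𝟎 ⟶ 𝟎 ⟶ 𝟎)
plus  = ƛ (ƛ (con R₀ · v0 · v1 · ƛ (ƛ (con suc · v1))))
times = ƛ (ƛ (con R₀ · v0 · num 0 · ƛ (ƛ (plus · v1 · wk (wk v1)))))
monus = ƛ (ƛ (con R₀ · v0 · v1 · ƛ (ƛ (pred · v1))))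

infixl 14 _⊕_ _∸_
infixl 15 _⊗_

_⊕_ _⊗_ _∸_ : Tm Sg Γ 𝟎 → Tm Sg Γ 𝟎 → Tm Sg Γ 𝟎
s ⊕ t = plus · s · t
s ⊗ t = times · s · t
s ∸ t = monus · s · t

infix 10 _≤′_ _<′_

_≤′_ _<′_ : Tm Sg Γ 𝟎 → Tm Sg Γ 𝟎 → Formula Sg Γ
s ≤′ t = s ∸ t ≈ num 0
s <′ t = con suc · s ≤′ t

2^ : Tm Sg Γ (𝟎 ⟶ 𝟎)
2^ = ƛ (con R₀ · v0 · num 1 · ƛ (ƛ (v1 ⊕ v1)))

-- Cantor pairing: tri n = 0 + 1 + … + n, and root n is the largest m with tri m ≤ n.
tri root π₁ π₂ : Tm Sg Γ (𝟎 ⟶ 𝟎)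
tri  = ƛ (con R₀ · v0 · num 0 · ƛ (ƛ (v1 ⊕ con suc · v0)))
root = ƛ (con R₀ · v0 · num 0 · ƛ (ƛ (v1 ⊕ (num 1 ∸ (tri · (con suc · v1) ∸ con suc · v0)))))
π₁   = ƛ (v0 ∸ tri · (root · v0))
π₂   = ƛ (root · v0 ∸ π₁ · v0)

pair : Tm Sg Γ (𝟎 ⟶ 𝟎 ⟶ 𝟎)
pair = ƛ (ƛ (tri · (v1 ⊕ v0) ⊕ v1))

_≐_ : Tm Sg Γ σ → Tm Sg Γ σ → Formula Sg Γ
_≐_ {σ = 𝟎}     s t = s ≈ t
_≐_ {σ = σ ⟶ τ} s t = ∀′ σ (wk s · v0 ≐ wk t · v0)
_≐_ {σ = σ ⋆}   s t =
  con len · s ≈ con len · t ∧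
  ∀′ 𝟎 (v0 <′ con len · wk s ⊃ con at · wk s · v0 ≐ con at · wk t · v0)

infix 10 _≐_ _∈′_

_∈′_ : Tm Sg Γ σ → Tm Sg Γ (σ ⋆) → Formula Sg Γ
z ∈′ x = ∃′ 𝟎 (v0 <′ con len · wk x ∧ wk z ≐ con at · wk x · v0)

∀ˢᵗ ∃ˢᵗ : (σ : Ty) → Formula Sg (σ ∷ Γ) → Formula Sg Γ
∀ˢᵗ σ A = ∀′ σ (st v0 ⊃ A)
∃ˢᵗ σ A = ∃′ σ (st v0 ∧ A)

-- Bounded number quantifiers are relativised too.  That makes no difference:
-- in the scope of standard variables the bounds are standard, and so is every
-- number below them.
_ˢᵗ : Formula Sg Γ → Formula Sg Γ
(s ≈ t) ˢᵗ  = s ≈ t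
(st t) ˢᵗ   = st t
⊥′ ˢᵗ       = ⊥′
(A ∧ B) ˢᵗ  = A ˢᵗ ∧ B ˢᵗ
(A ∨ B) ˢᵗ  = A ˢᵗ ∨ B ˢᵗ
(A ⊃ B) ˢᵗ  = A ˢᵗ ⊃ B ˢᵗ
(∀′ σ A) ˢᵗ = ∀ˢᵗ σ (A ˢᵗ)
(∃′ σ A) ˢᵗ = ∃ˢᵗ σ (A ˢᵗ)

Internal : Formula Sg Γ → Set
Internal (s ≈ t)  = ⊤
Internal (st t)   = ⊥
Internal ⊥′       = ⊤
Internal (A ∧ B)  = Internal A × Internal B
Internal (A ∨ B)  = Internal A × Internal B
Internal (A ⊃ B)  = Internal A × Internal B
Internal (∀′ σ A) = Internal A
Internal (∃′ σ A) = Internal A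

QuantifierFree : Formula Sg Γ → Set
QuantifierFree (s ≈ t)  = ⊤
QuantifierFree (st t)   = ⊥
QuantifierFree ⊥′       = ⊤
QuantifierFree (A ∧ B)  = QuantifierFree A × QuantifierFree B
QuantifierFree (A ∨ B)  = QuantifierFree A × QuantifierFree B
QuantifierFree (A ⊃ B)  = QuantifierFree A × QuantifierFree B
QuantifierFree (∀′ σ A) = ⊥
QuantifierFree (∃′ σ A) = ⊥

Theory : Signature → Set₁
Theory Sg = (Γ : Ctx) → Formula Sg Γ → Set

-- The eigenvariable condition is the weakening of the hypotheses.
wkH : List (Formula Sg Γ) → List (Formula Sg (σ ∷ Γ))
wkH = map (ren there)

infix 3 _∣_⊢_ _⊢_

data _∣_⊢_ (T : Theory Sg) {Γ : Ctx} (H : List (Formula Sg Γ)) : Formula Sg Γ → Set where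
  ax  : ∀ {A} → T Γ A → T ∣ H ⊢ A
  hyp : ∀ {A} → A ∈ H → T ∣ H ⊢ A
  raa : ∀ {A} → T ∣ ¬′ A ∷ H ⊢ ⊥′ → T ∣ H ⊢ A
  ∧I  : ∀ {A B} → T ∣ H ⊢ A → T ∣ H ⊢ B → T ∣ H ⊢ A ∧ B
  ∧E₁ : ∀ {A B} → T ∣ H ⊢ A ∧ B → T ∣ H ⊢ A
  ∧E₂ : ∀ {A B} → T ∣ H ⊢ A ∧ B → T ∣ H ⊢ B
  ∨I₁ : ∀ {A B} → T ∣ H ⊢ A → T ∣ H ⊢ A ∨ B
  ∨I₂ : ∀ {A B} → T ∣ H ⊢ B → T ∣ H ⊢ A ∨ B
  ∨E  : ∀ {A B C} → T ∣ H ⊢ A ∨ B → T ∣ A ∷ H ⊢ C → T ∣ B ∷ H ⊢ C → T ∣ H ⊢ C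
  ⊃I  : ∀ {A B} → T ∣ A ∷ H ⊢ B → T ∣ H ⊢ A ⊃ B
  ⊃E  : ∀ {A B} → T ∣ H ⊢ A ⊃ B → T ∣ H ⊢ A → T ∣ H ⊢ B
  ∀I  : ∀ {σ A} → T ∣ wkH H ⊢ A → T ∣ H ⊢ ∀′ σ A
  ∀E  : ∀ {σ A} → T ∣ H ⊢ ∀′ σ A → (t : Tm Sg Γ σ) → T ∣ H ⊢ A [ t ]
  ∃I  : ∀ {σ A} (t : Tm Sg Γ σ) → T ∣ H ⊢ A [ t ] → T ∣ H ⊢ ∃′ σ A
  ∃E  : ∀ {σ A C} → T ∣ H ⊢ ∃′ σ A → T ∣ A ∷ wkH H ⊢ ren there C → T ∣ H ⊢ C

_⊢_ : Theory Sg → Formula Sg [] → Set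
T ⊢ A = T ∣ [] ⊢ A

data RCA₀ω {Sg : Signature} (Γ : Ctx) : Formula Sg Γ → Set where
  ≈-refl  : (s : Tm Sg Γ 𝟎) → RCA₀ω Γ (s ≈ s)
  ≈-sym   : (s t : Tm Sg Γ 𝟎) → RCA₀ω Γ (s ≈ t ⊃ t ≈ s)
  ≈-trans : (s t u : Tm Sg Γ 𝟎) → RCA₀ω Γ (s ≈ t ⊃ t ≈ u ⊃ s ≈ u)

  extensionality : (F : Tm Sg Γ (ρ ⟶ τ)) (s t : Tm Sg Γ ρ) → RCA₀ω Γ (s ≐ t ⊃ F · s ≐ F · t)

  K-ax : (s : Tm Sg Γ σ) (t : Tm Sg Γ τ) → RCA₀ω Γ (con K · s · t ≐ s)
  S-ax : (s : Tm Sg Γ (ρ ⟶ σ ⟶ τ)) (t : Tm Sg Γ (ρ ⟶ σ)) (u : Tm Sg Γ ρ) →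
         RCA₀ω Γ (con S · s · t · u ≐ s · u · (t · u))

  suc≢zer : (s : Tm Sg Γ 𝟎) → RCA₀ω Γ (¬′ con suc · s ≈ con zer)
  suc-inj : (s t : Tm Sg Γ 𝟎) → RCA₀ω Γ (con suc · s ≈ con suc · t ⊃ s ≈ t)

  R₀-zer : (y : Tm Sg Γ 𝟎) (z : Tm Sg Γ (𝟎 ⟶ 𝟎 ⟶ 𝟎)) →
           RCA₀ω Γ (con R₀ · con zer · y · z ≈ y)
  R₀-suc : (x y : Tm Sg Γ 𝟎) (z : Tm Sg Γ (𝟎 ⟶ 𝟎 ⟶ 𝟎)) →
           RCA₀ω Γ (con R₀ · (con suc · x) · y · z ≈ z · (con R₀ · x · y · z) · x)

  len-init : (f : Tm Sg Γ (𝟎 ⟶ σ)) (n : Tm Sg Γ 𝟎) →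
             RCA₀ω Γ (con len · (con init · f · n) ≈ n)
  at-init  : (f : Tm Sg Γ (𝟎 ⟶ σ)) (n i : Tm Sg Γ 𝟎) →
             RCA₀ω Γ (i <′ n ⊃ con at · (con init · f · n) · i ≐ f · i)

  QF-induction : (A : Formula Sg (𝟎 ∷ Γ)) → QuantifierFree A →
                 RCA₀ω Γ (A [ con zer ] ∧
                          ∀′ 𝟎 (A ⊃ ren (liftR there) A [ con suc · v0 ]) ⊃ ∀′ 𝟎 A)

  -- A(x , y) with y the innermost variable.
  QF-AC¹⁰ : (A : Formula Sg (𝟎 ∷ 𝟏 ∷ Γ)) → QuantifierFree A →
            RCA₀ω Γ (∀′ 𝟏 (∃′ 𝟎 A) ⊃
                     ∃′ (𝟏 ⟶ 𝟎) (∀′ 𝟏 (ren (liftR (liftR there)) A [ v1 · v0 ])))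

-- Uniqueness is provability in RCA₀^ω, in the language without the constants Ξ₀.
record Specification : Set where
  field
    type     : Ty
    formula  : Formula ∅ (type ∷ [])
    internal : Internal formula
    unique   : RCA₀ω ⊢ ∀′ type (∀′ type (formula ⟨ v1 ⟩ ⊃ formula ⟨ v0 ⟩ ⊃ v1 ≐ v0))

-- The specification of the functional in (∃²).  The bound by 1 is what makes
-- it unique: (∃²) by itself does not determine the non-zero values.
∃²-formula : Formula ∅ (𝟐 ∷ [])
∃²-formula = ∀′ 𝟏 ((∃′ 𝟎 (v1 · v0 ≈ num 0) ⇔ v1 · v0 ≈ num 0) ∧ v1 · v0 ≤′ num 1)

-- The functionals that have a constant: the one in (∃²), and an arbitrary
-- further family.
module _ {I : Set} (𝒟 : I → Specification) where

  specType : Maybe I → Ty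
  specType nothing  = 𝟐
  specType (just i) = Specification.type (𝒟 i)

  specFormula : (c : Maybe I) → Formula ∅ (specType c ∷ [])
  specFormula nothing  = ∃²-formula
  specFormula (just i) = Specification.formula (𝒟 i)

  sig : Signature
  sig = record { Name = Maybe I ; type = specType }

  data RCA₀Ω (Γ : Ctx) : Formula sig Γ → Set where
    base : ∀ {A} → RCA₀ω Γ A → RCA₀Ω Γ A

    st-≐      : (s t : Tm sig Γ σ) → RCA₀Ω Γ (st s ∧ s ≐ t ⊃ st t)
    st-closed : (t : Tm sig [] σ) → RCA₀Ω Γ (st (closed t))
    st-app    : (s : Tm sig Γ (σ ⟶ τ)) (t : Tm sig Γ σ) → RCA₀Ω Γ (st s ∧ st t ⊃ st (s · t))
    st-≤      : (s t : Tm sig Γ 𝟎) → RCA₀Ω Γ (st t ∧ s ≤′ t ⊃ st s)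

    -- φ(z , y) with z the innermost variable.
    idealization : (φ : Formula sig (σ ∷ τ ∷ Γ)) → Internal φ →
      RCA₀Ω Γ (∀ˢᵗ (σ ⋆) (∃′ τ (∀′ σ (v0 ∈′ v2 ⊃ ren (liftR (liftR there)) φ))) ⊃
               ∃′ τ (∀ˢᵗ σ φ))

    -- φ(x , y) with y the innermost variable.
    HAC-int : (φ : Formula sig (τ ∷ ρ ∷ Γ)) → Internal φ →
      RCA₀Ω Γ (∀ˢᵗ ρ (∃ˢᵗ τ φ) ⊃
               ∃ˢᵗ (ρ ⟶ τ ⋆) (∀ˢᵗ ρ (∃′ τ (v0 ∈′ v2 · v1 ∧ ren (liftR (liftR there)) φ))))

    PF-TP∀ : (φ : Formula sig (τ ∷ [])) → Internal φ →
      RCA₀Ω Γ (∀ˢᵗ τ (φ ⟨ v0 ⟩) ⊃ ∀′ τ (φ ⟨ v0 ⟩))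

    Ξ₀ : (c : Maybe I) →
      RCA₀Ω Γ (st (ext {sig} c) ∧
               ∀ˢᵗ (specType c) ((embed (specFormula c) ˢᵗ) ⟨ v0 ⟩ ⊃ (ext c ≐ v0) ˢᵗ))

-- Every number codes a rational: pair · (pair · a · b) · c  codes  (a − b) / (c + 1).

pos neg den : Tm Sg Γ 𝟎 → Tm Sg Γ 𝟎
pos q = π₁ · (π₁ · q)
neg q = π₂ · (π₁ · q)
den q = con suc · (π₂ · q)

mkℚ : (a b d : Tm Sg Γ 𝟎) → Tm Sg Γ 𝟎
mkℚ a b d = pair · (pair · a · b) · (pred · d)

infixl 14 _+ℚ_ _-ℚ_

_+ℚ_ _-ℚ_ : Tm Sg Γ 𝟎 → Tm Sg Γ 𝟎 → Tm Sg Γ 𝟎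
q +ℚ r = mkℚ (pos q ⊗ den r ⊕ pos r ⊗ den q) (neg q ⊗ den r ⊕ neg r ⊗ den q) (den q ⊗ den r)
q -ℚ r = mkℚ (pos q ⊗ den r ⊕ neg r ⊗ den q) (neg q ⊗ den r ⊕ pos r ⊗ den q) (den q ⊗ den r)

∣_∣ℚ : Tm Sg Γ 𝟎 → Tm Sg Γ 𝟎
∣ q ∣ℚ = mkℚ ((pos q ∸ neg q) ⊕ (neg q ∸ pos q)) (num 0) (den q)

2^- : Tm Sg Γ 𝟎 → Tm Sg Γ 𝟎
2^- n = mkℚ (num 1) (num 0) (2^ · n)

infix 10 _≤ℚ_ _<ℚ_

_≤ℚ_ _<ℚ_ : Tm Sg Γ 𝟎 → Tm Sg Γ 𝟎 → Formula Sg Γ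
q ≤ℚ r = pos q ⊗ den r ⊕ neg r ⊗ den q ≤′ pos r ⊗ den q ⊕ neg q ⊗ den r
q <ℚ r = pos q ⊗ den r ⊕ neg r ⊗ den q <′ pos r ⊗ den q ⊕ neg q ⊗ den r

infix 10 _∈ℝ _≈ℝ_ _≤ℝ_ _∈[0,1]

_∈ℝ : Tm Sg Γ 𝟏 → Formula Sg Γ
x ∈ℝ = ∀′ 𝟎 (∀′ 𝟎 (∣ wk (wk x) · v1 -ℚ wk (wk x) · (v1 ⊕ v0) ∣ℚ <ℚ 2^- v1))

-- The bound is 2^-n, not 2^-n + 2^-n.  Representations of one real need not be
-- related by it, but they are joined by a short chain of such pairs.
_≈ℝ_ : Tm Sg Γ 𝟏 → Tm Sg Γ 𝟏 → Formula Sg Γ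
x ≈ℝ y = ∀′ 𝟎 (∣ wk x · v0 -ℚ wk y · v0 ∣ℚ ≤ℚ 2^- v0)

-- The n-th rational of a real is within 2^-n of it, whence the error terms
-- 2^-n + 2^-n here and in the next definition (x ≤ y is the negation of y < x).
_≤ℝ_ : Tm Sg Γ 𝟏 → Tm Sg Γ 𝟏 → Formula Sg Γ
x ≤ℝ y = ∀′ 𝟎 (wk x · v0 ≤ℚ wk y · v0 +ℚ (2^- v0 +ℚ 2^- v0))

∣_-_∣<2^-_ : Tm Sg Γ 𝟏 → Tm Sg Γ 𝟏 → Tm Sg Γ 𝟎 → Formula Sg Γ
∣ x - y ∣<2^- k = ∃′ 𝟎 (∣ wk x · v0 -ℚ wk y · v0 ∣ℚ +ℚ (2^- v0 +ℚ 2^- v0) <ℚ 2^- (wk k))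

0ℝ 1ℝ : Tm Sg Γ 𝟏
0ℝ = con K · mkℚ (num 0) (num 0) (num 1)
1ℝ = con K · mkℚ (num 1) (num 0) (num 1)

_∈[0,1] : Tm Sg Γ 𝟏 → Formula Sg Γ
x ∈[0,1] = x ∈ℝ ∧ 0ℝ ≤ℝ x ∧ x ≤ℝ 1ℝ

∀∈ℝ ∀∈[0,1] : Formula Sg (𝟏 ∷ Γ) → Formula Sg Γ
∀∈ℝ A     = ∀′ 𝟏 (v0 ∈ℝ ⊃ A)
∀∈[0,1] A = ∀′ 𝟏 (v0 ∈[0,1] ⊃ A)

infix 10 _∈ℝ→ℝ _∈C[0,1] _∈C̄[0,1]

_∈ℝ→ℝ : Tm Sg Γ (𝟏 ⟶ 𝟏) → Formula Sg Γ
f ∈ℝ→ℝ =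
  ∀∈ℝ (wk f · v0 ∈ℝ) ∧
  ∀∈ℝ (∀∈ℝ (v1 ≈ℝ v0 ⊃ wk (wk f) · v1 ≈ℝ wk (wk f) · v0))

-- The four quantifiers bind x, k, N and y.
_∈C[0,1] : Tm Sg Γ (𝟏 ⟶ 𝟏) → Formula Sg Γ
f ∈C[0,1] =
  f ∈ℝ→ℝ ∧
  ∀∈[0,1] (∀′ 𝟎 (∃′ 𝟎 (∀∈[0,1]
    (∣ wk v2 - v0 ∣<2^- v1 ⊃
     ∣ wk (wk (wk (wk f))) · wk v2 - wk (wk (wk (wk f))) · v0 ∣<2^- v2))))

_∈C̄[0,1] : Tm Sg Γ (𝟏 ⟶ 𝟏) → Formula Sg Γ
f ∈C̄[0,1] = f ∈C[0,1] ∧ 0ℝ ≤ℝ f · 0ℝ ∧ f · 1ℝ ≤ℝ 0ℝ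

⟨∃²⟩ Π⁰₁-TRANS IVT* UIVT : Formula Sg []

⟨∃²⟩ = ∃′ 𝟐 (∀′ 𝟏 (∃′ 𝟎 (v1 · v0 ≈ num 0) ⇔ v1 · v0 ≈ num 0))

Π⁰₁-TRANS = ∀ˢᵗ 𝟏 (∀ˢᵗ 𝟎 (v1 · v0 ≈ num 0) ⊃ ∀′ 𝟎 (v1 · v0 ≈ num 0))

IVT* = ∀ˢᵗ (𝟏 ⟶ 𝟏) ((v0 ∈C̄[0,1]) ˢᵗ ⊃ ∃ˢᵗ 𝟏 (v0 ∈[0,1] ∧ v1 · v0 ≈ℝ 0ℝ))

-- f is regarded as a function on [0,1], so f(Φ(f)) presupposes Φ(f) ∈ [0,1].
UIVT = ∃′ ((𝟏 ⟶ 𝟏) ⟶ 𝟏) (∀′ (𝟏 ⟶ 𝟏)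
         (v0 ∈C̄[0,1] ⊃ v1 · v0 ∈[0,1] ∧ v0 · (v1 · v0) ≈ℝ 0ℝ))

{-# OPTIONS --safe #-}

-- (∃²) gives Π⁰₁-TRANS because, by QF-AC and PF-TP∀, it has a standard witness that finds zeros of
-- functions, and the zero it finds for a standard function is standard.  Conversely HAC-int
-- turns Π⁰₁-TRANS into a standard functional deciding Σ⁰₁ formulas on standard inputs; Ξ₀ agrees
-- with it there, and PF-TP∀ applies to Ξ₀.  IVT* gives Π⁰₁-TRANS by applying it to a constant
-- function that vanishes on standard inputs.  UIVT gives (∃²) by Grilliot's trick: a root of the
-- zero function jumps to a chosen end point of [0,1] under a tiny perturbation that is present
-- iff a given g has a zero.  Finally (∃²) decides the sign of f at rationals, so that bisection
-- yields a root; since the argument only ever applies the given objects, it also proves the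
-- version in which all quantifiers are relative to standard objects.
--
-- The derivations are carried out in a calculus whose terms have symbols for the arithmetical
-- functions, as the combinatory terms for these are far too large to be computed with.
module Submission where

import Algebra.Solver.CommutativeMonoid
import Algebra.Solver.Ring.NaturalCoefficients.Default
import Defs as D
open import Algebra.Bundles using (CommutativeMonoid; CommutativeSemiring)
open import Data.Empty using (⊥)
open import Data.List using (List; []; _∷_; map; _++_)
open import Data.List.Membership.Propositional using (_∈_)
open import Data.List.Membership.Propositional.Properties using (∈-map⁺; ∈-map⁻; ∈-++⁺ˡ)
open import Data.List.Relation.Unary.All using (All; []; _∷_)
open import Data.List.Relation.Unary.Any using (here; there)
open import Data.Maybe using (nothing)
open import Data.Nat using (ℕ; zero; suc)
open import Data.Product using (_×_; _,_; proj₁; proj₂)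
open import Data.Unit using (⊤; tt)
open import Function using (_∘_; _$_)
open import Level using (0ℓ)
open import Relation.Binary.PropositionalEquality using (_≡_; refl; sym; trans; cong; cong₂)

-- Two obstacles shape the transfer arguments. A functional that merely decides whether a function
-- has a zero does not locate a zero among the standard numbers. A functional μ that names a zero
-- does, since μ(f) is standard whenever μ and f are; hence the detour of (∃²) through search. In
-- the other direction, the decision functional obtained from HAC-int is correct on standard inputs
-- only, and it cannot occur in an instance of PF-TP∀ itself, where it would be a parameter; the
-- constant Ξ₀ does not count as one.
--
-- Grilliot's trick needs an end point away from the root that Φ assigns to the zero function. Which
-- end that is, is settled by comparing a single rational approximation of this root with 1/2, and
-- in either case the decision functional is a term in Φ.
--
-- The root obtained by relativised bisection satisfies f(x) = 0 at standard indices only, whereas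
-- IVT* asks for internal equality; Π⁰₁-TRANS extends the equality to all indices.

-- The auxiliary calculus: terms, formulas and derivation rules.

module Calculus where

  open D using (Ty; 𝟎; 𝟏; 𝟐; _⟶_; _⋆; Ctx; Const)
  open Const

  variable
    Γ Δ : Ctx
    ρ σ τ : Ty

  infixr 31 _⇒_

  -- The head of a context is the innermost variable and becomes the last argument; `Δ ⇒ τ` is thus
  -- the type of a closed abstraction over all of `Δ`.
  _⇒_ : Ctx → Ty → Ty
  [] ⇒ τ      = τ
  (σ ∷ Δ) ⇒ τ = Δ ⇒ (σ ⟶ τ)

  data Fn₁ : Set where
    pred pow tri root π₁ π₂ pos neg den abs inv : Fn₁

  data Fn₂ : Set where
    plus times monus pair plusℚ minusℚ : Fn₂

  infixl 20 _·_

  -- Substitution does not commute with the combinatory abstraction of Defs, hence the only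
  -- abstractions are the closed supercombinators `comb`.
  data Trm (Γ : Ctx) : Ty → Set where
    var  : σ ∈ Γ → Trm Γ σ
    con  : Const σ → Trm Γ σ
    Ξ    : Trm Γ 𝟐
    comb : (Δ : Ctx) → Trm Δ τ → Trm Γ (Δ ⇒ τ)
    _·_  : Trm Γ (σ ⟶ τ) → Trm Γ σ → Trm Γ τ
    ap₁  : Fn₁ → Trm Γ 𝟎 → Trm Γ 𝟎
    ap₂  : Fn₂ → Trm Γ 𝟎 → Trm Γ 𝟎 → Trm Γ 𝟎

  infixl 14 _⊕_ _∸_ _+ℚ_ _-ℚ_
  infixl 15 _⊗_

  pattern v0 = var (here refl)
  pattern v1 = var (there (here refl))
  pattern v2 = var (there (there (here refl)))
  pattern v3 = var (there (there (there (here refl))))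
  pattern v4 = var (there (there (there (there (here refl)))))
  pattern v5 = var (there (there (there (there (there (here refl))))))

  pattern O = con zer
  pattern S′ t = con suc · t
  pattern one = S′ O
  pattern _⊕_ s t = ap₂ plus s t
  pattern _⊗_ s t = ap₂ times s t
  pattern _∸_ s t = ap₂ monus s t
  pattern _+ℚ_ s t = ap₂ plusℚ s t
  pattern _-ℚ_ s t = ap₂ minusℚ s t
  pattern ⟨_,_⟩ s t = ap₂ pair s t
  pattern frac a b d = ⟨ ⟨ a , b ⟩ , ap₁ pred d ⟩
  pattern ∣_∣ q = ap₁ abs q
  pattern 2^-_ n = ap₁ inv n
  pattern 2^_ n = ap₁ pow n

  infix 16 2^_ 2^-_

  infix  10 _≐_ _∋_ _≤_ _≤ℚ_ _<ℚ_
  infix  9 ¬′_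
  infixr 8 _∧_
  infixr 7 _∨_
  infixr 6 _⊃_
  infix  5 _⇔_

  -- Quantifiers over all or over the standard objects, so that formulas A and Aˢᵗ can be
  -- treated at the same time.
  data Range : Set where
    full std : Range

  -- Equality at every type and the comparisons of numbers and rationals are atomic, so that
  -- substitution computes without entering their definitions; rules such as `≐-ext`, `≤E` and `≤ℚE`
  -- give access to these. `full ∋ t` will be read as a trivially true formula, which lets
  -- hypotheses `g ∋ t` be carried for both ranges.
  data Fml (Γ : Ctx) : Set where
    _≐_     : Trm Γ σ → Trm Γ σ → Fml Γ
    _∋_     : Range → Trm Γ σ → Fml Γ
    _≤_     : Trm Γ 𝟎 → Trm Γ 𝟎 → Fml Γ
    _≤ℚ_    : Trm Γ 𝟎 → Trm Γ 𝟎 → Fml Γ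
    _<ℚ_    : Trm Γ 𝟎 → Trm Γ 𝟎 → Fml Γ
    ⊥′      : Fml Γ
    _∧_ _∨_ _⊃_ : Fml Γ → Fml Γ → Fml Γ
    ∀[_] ∃[_] : Range → (σ : Ty) → Fml (σ ∷ Γ) → Fml Γ

  pattern ∀′ σ A = ∀[ full ] σ A
  pattern ∃′ σ A = ∃[ full ] σ A
  pattern st t = std ∋ t

  infix 10 _<_

  pattern _<_ s t = S′ s ≤ t

  ¬′_ : Fml Γ → Fml Γ
  ¬′ A = A ⊃ ⊥′

  _⇔_ : Fml Γ → Fml Γ → Fml Γ
  A ⇔ B = (A ⊃ B) ∧ (B ⊃ A)

  Subst : Ctx → Ctx → Set
  Subst Δ Γ = ∀ {σ} → σ ∈ Δ → Trm Γ σ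

  renT : D.Ren Δ Γ → Trm Δ σ → Trm Γ σ
  renT r (var x)     = var (r x)
  renT r (con c)     = con c
  renT r Ξ           = Ξ
  renT r (comb Θ t)  = comb Θ t
  renT r (s · t)     = renT r s · renT r t
  renT r (ap₁ f s)   = ap₁ f (renT r s)
  renT r (ap₂ f s t) = ap₂ f (renT r s) (renT r t)

  ren : D.Ren Δ Γ → Fml Δ → Fml Γ
  ren r (s ≐ t)  = renT r s ≐ renT r t
  ren r (g ∋ t)  = g ∋ renT r t
  ren r (s ≤ t)  = renT r s ≤ renT r t
  ren r (s ≤ℚ t) = renT r s ≤ℚ renT r t
  ren r (s <ℚ t) = renT r s <ℚ renT r t
  ren r ⊥′       = ⊥′
  ren r (A ∧ B)  = ren r A ∧ ren r B
  ren r (A ∨ B)  = ren r A ∨ ren r B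
  ren r (A ⊃ B)  = ren r A ⊃ ren r B
  ren r (∀[ g ] σ A) = ∀[ g ] σ (ren (D.liftR r) A)
  ren r (∃[ g ] σ A) = ∃[ g ] σ (ren (D.liftR r) A)

  wk : Trm Γ σ → Trm (τ ∷ Γ) σ
  wk = renT there

  lift : Subst Δ Γ → Subst (τ ∷ Δ) (τ ∷ Γ)
  lift s (here p)  = var (here p)
  lift s (there x) = wk (s x)

  subT : Subst Δ Γ → Trm Δ σ → Trm Γ σ
  subT s (var x)     = s x
  subT s (con c)     = con c
  subT s Ξ           = Ξ
  subT s (comb Θ t)  = comb Θ t
  subT s (t · u)     = subT s t · subT s u
  subT s (ap₁ f t)   = ap₁ f (subT s t)
  subT s (ap₂ f t u) = ap₂ f (subT s t) (subT s u)

  sub : Subst Δ Γ → Fml Δ → Fml Γ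
  sub s (t ≐ u)  = subT s t ≐ subT s u
  sub s (g ∋ t)  = g ∋ subT s t
  sub s (t ≤ u)  = subT s t ≤ subT s u
  sub s (t ≤ℚ u) = subT s t ≤ℚ subT s u
  sub s (t <ℚ u) = subT s t <ℚ subT s u
  sub s ⊥′       = ⊥′
  sub s (A ∧ B)  = sub s A ∧ sub s B
  sub s (A ∨ B)  = sub s A ∨ sub s B
  sub s (A ⊃ B)  = sub s A ⊃ sub s B
  sub s (∀[ g ] σ A) = ∀[ g ] σ (sub (lift s) A)
  sub s (∃[ g ] σ A) = ∃[ g ] σ (sub (lift s) A)

  infixr 4 _◂_

  ε : Subst [] Γ
  ε ()

  _◂_ : Trm Γ σ → Subst Δ Γ → Subst (σ ∷ Δ) Γ
  (t ◂ s) (here refl) = t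
  (t ◂ s) (there x)   = s x

  _[_] : Fml (σ ∷ Γ) → Trm Γ σ → Fml Γ
  A [ t ] = sub (t ◂ var) A

  apply : (Δ : Ctx) → Trm Γ (Δ ⇒ τ) → Subst Δ Γ → Trm Γ τ
  apply []      t s = t
  apply (σ ∷ Δ) t s = apply Δ t (λ x → s (there x)) · s (here refl)

  -- Only equality at type `𝟎` remains quantifier-free under the interpretation: at function and
  -- sequence types it stands for a formula with quantifiers.
  QF : Fml Γ → Set
  QF (_≐_ {𝟎} s t)     = ⊤
  QF (_≐_ {_ ⟶ _} s t) = ⊥
  QF (_≐_ {_ ⋆} s t)   = ⊥
  QF (g ∋ t)  = ⊥
  QF (s ≤ t)  = ⊤
  QF (s ≤ℚ t) = ⊤
  QF (s <ℚ t) = ⊤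
  QF ⊥′       = ⊤
  QF (A ∧ B)  = QF A × QF B
  QF (A ∨ B)  = QF A × QF B
  QF (A ⊃ B)  = QF A × QF B
  QF (∀[ g ] σ A) = ⊥
  QF (∃[ g ] σ A) = ⊥

  Internal : Fml Γ → Set
  Internal (s ≐ t)  = ⊤
  Internal (g ∋ t)  = ⊥
  Internal (s ≤ t)  = ⊤
  Internal (s ≤ℚ t) = ⊤
  Internal (s <ℚ t) = ⊤
  Internal ⊥′       = ⊤
  Internal (A ∧ B)  = Internal A × Internal B
  Internal (A ∨ B)  = Internal A × Internal B
  Internal (A ⊃ B)  = Internal A × Internal B
  Internal (∀[ std ] σ A)  = ⊥
  Internal (∃[ std ] σ A)  = ⊥
  Internal (∀[ full ] σ A) = Internal A
  Internal (∃[ full ] σ A) = Internal A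

  ∀ˢᵗ ∃ˢᵗ : (σ : Ty) → Fml (σ ∷ Γ) → Fml Γ
  ∀ˢᵗ σ A = ∀′ σ (st v0 ⊃ A)
  ∃ˢᵗ σ A = ∃′ σ (st v0 ∧ A)

  wkH : List (Fml Γ) → List (Fml (σ ∷ Γ))
  wkH = map (ren there)

  infix 4 _‼_

  -- Out of range, a provable formula.
  _‼_ : List (Fml Γ) → ℕ → Fml Γ
  [] ‼ n          = O ≐ O
  (A ∷ H) ‼ zero  = A
  (A ∷ H) ‼ suc n = H ‼ n

  tail : List (Fml Γ) → List (Fml Γ)
  tail []      = []
  tail (A ∷ H) = H

  infix 3 _⊩_

  -- `drop`, `entail` and `inst` are weakening, cut and substitution as primitive rules, so that
  -- nothing has to be proved about derivations. Most axioms of the theory appear as rules with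
  -- premises, which avoids detours through implications.
  data _⊩_ {Γ : Ctx} (H : List (Fml Γ)) : Fml Γ → Set where
    hyp : (n : ℕ) → H ⊩ H ‼ n
    raa : ∀ {A} → ¬′ A ∷ H ⊩ ⊥′ → H ⊩ A
    ∧I  : ∀ {A B} → H ⊩ A → H ⊩ B → H ⊩ A ∧ B
    ∧E₁ : ∀ {A B} → H ⊩ A ∧ B → H ⊩ A
    ∧E₂ : ∀ {A B} → H ⊩ A ∧ B → H ⊩ B
    ∨I₁ : ∀ {A B} → H ⊩ A → H ⊩ A ∨ B
    ∨I₂ : ∀ {A B} → H ⊩ B → H ⊩ A ∨ B
    ∨E  : ∀ {A B C} → H ⊩ A ∨ B → A ∷ H ⊩ C → B ∷ H ⊩ C → H ⊩ C
    ⊃I  : ∀ {A B} → A ∷ H ⊩ B → H ⊩ A ⊃ B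
    ⊃E  : ∀ {A B} → H ⊩ A ⊃ B → H ⊩ A → H ⊩ B
    ∀I  : ∀ {σ A} → wkH H ⊩ A → H ⊩ ∀′ σ A
    ∀E  : ∀ {σ A} → H ⊩ ∀′ σ A → (t : Trm Γ σ) → H ⊩ A [ t ]
    ∃I  : ∀ {σ A} (t : Trm Γ σ) → H ⊩ A [ t ] → H ⊩ ∃′ σ A
    ∃E  : ∀ {σ A C} → H ⊩ ∃′ σ A → A ∷ wkH H ⊩ ren there C → H ⊩ C

    ∀ᵣI : ∀ {g σ A} → g ∋ v0 ∷ wkH H ⊩ A → H ⊩ ∀[ g ] σ A
    ∀ᵣE : ∀ {g σ A} → H ⊩ ∀[ g ] σ A → (t : Trm Γ σ) → H ⊩ g ∋ t → H ⊩ A [ t ]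
    ∃ᵣI : ∀ {g σ A} (t : Trm Γ σ) → H ⊩ g ∋ t → H ⊩ A [ t ] → H ⊩ ∃[ g ] σ A
    ∃ᵣE : ∀ {g σ A C} → H ⊩ ∃[ g ] σ A → A ∷ g ∋ v0 ∷ wkH H ⊩ ren there C → H ⊩ C

    drop   : ∀ {A} → tail H ⊩ A → H ⊩ A
    entail : ∀ {A} {H′ : List (Fml Γ)} → H′ ⊩ A → All (H ⊩_) H′ → H ⊩ A
    inst   : ∀ {Δ} {As : List (Fml Δ)} {C} → As ⊩ C → (s : Subst Δ Γ) →
             All (λ A → H ⊩ sub s A) As → H ⊩ sub s C

    ≐-refl  : {s : Trm Γ σ} → H ⊩ s ≐ s
    ≐-sym   : {s t : Trm Γ σ} → H ⊩ s ≐ t → H ⊩ t ≐ s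
    ≐-trans : {s t u : Trm Γ σ} → H ⊩ s ≐ t → H ⊩ t ≐ u → H ⊩ s ≐ u
    ·-cong  : {s s′ : Trm Γ (σ ⟶ τ)} {t t′ : Trm Γ σ} → H ⊩ s ≐ s′ → H ⊩ t ≐ t′ → H ⊩ s · t ≐ s′ · t′
    ap₁-cong : ∀ f {s s′} → H ⊩ s ≐ s′ → H ⊩ ap₁ f s ≐ ap₁ f s′
    ap₂-cong : ∀ f {s s′ t t′} → H ⊩ s ≐ s′ → H ⊩ t ≐ t′ → H ⊩ ap₂ f s t ≐ ap₂ f s′ t′
    ≐-ext   : {s t : Trm Γ (σ ⟶ τ)} → wkH H ⊩ wk s · v0 ≐ wk t · v0 → H ⊩ s ≐ t
    ≐-app   : {s t : Trm Γ (σ ⟶ τ)} → H ⊩ s ≐ t → (u : Trm Γ σ) → H ⊩ s · u ≐ t · u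

    β     : (t : Trm Δ τ) (s : Subst Δ Γ) → H ⊩ apply Δ (comb Δ t) s ≐ subT s t
    K-red : {s : Trm Γ σ} {t : Trm Γ τ} → H ⊩ con K · s · t ≐ s

    suc≢zer : ∀ {s} → H ⊩ S′ s ≐ O → H ⊩ ⊥′
    R₀-zer  : ∀ {y z} → H ⊩ con R₀ · O · y · z ≐ y
    R₀-suc  : ∀ {x y z} → H ⊩ con R₀ · S′ x · y · z ≐ z · (con R₀ · x · y · z) · x

    pred-zer  : H ⊩ ap₁ pred O ≐ O
    pred-suc  : ∀ {a} → H ⊩ ap₁ pred (S′ a) ≐ a
    plus-zer  : ∀ {a} → H ⊩ a ⊕ O ≐ a
    plus-suc  : ∀ {a b} → H ⊩ a ⊕ S′ b ≐ S′ (a ⊕ b)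
    times-zer : ∀ {a} → H ⊩ a ⊗ O ≐ O
    times-suc : ∀ {a b} → H ⊩ a ⊗ S′ b ≐ a ⊗ b ⊕ a
    monus-zer : ∀ {a} → H ⊩ a ∸ O ≐ a
    monus-suc : ∀ {a b} → H ⊩ a ∸ S′ b ≐ ap₁ pred (a ∸ b)
    pow-zer   : H ⊩ 2^ O ≐ one
    pow-suc   : ∀ {a} → H ⊩ 2^ S′ a ≐ 2^ a ⊕ 2^ a
    tri-zer   : H ⊩ ap₁ tri O ≐ O
    tri-suc   : ∀ {a} → H ⊩ ap₁ tri (S′ a) ≐ ap₁ tri a ⊕ S′ a
    root-zer  : H ⊩ ap₁ root O ≐ O
    root-suc  : ∀ {a} → H ⊩ ap₁ root (S′ a) ≐
                ap₁ root a ⊕ (one ∸ (ap₁ tri (S′ (ap₁ root a)) ∸ S′ a))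
    π₁-def    : ∀ {a} → H ⊩ ap₁ π₁ a ≐ a ∸ ap₁ tri (ap₁ root a)
    π₂-def    : ∀ {a} → H ⊩ ap₁ π₂ a ≐ ap₁ root a ∸ ap₁ π₁ a
    pair-def  : ∀ {a b} → H ⊩ ⟨ a , b ⟩ ≐ ap₁ tri (a ⊕ b) ⊕ a

    pos-def : ∀ {q} → H ⊩ ap₁ pos q ≐ ap₁ π₁ (ap₁ π₁ q)
    neg-def : ∀ {q} → H ⊩ ap₁ neg q ≐ ap₁ π₂ (ap₁ π₁ q)
    den-def : ∀ {q} → H ⊩ ap₁ den q ≐ S′ (ap₁ π₂ q)
    abs-def : ∀ {q} → H ⊩ ∣ q ∣ ≐
              frac ((ap₁ pos q ∸ ap₁ neg q) ⊕ (ap₁ neg q ∸ ap₁ pos q)) O (ap₁ den q)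
    inv-def : ∀ {n} → H ⊩ 2^- n ≐ frac one O (2^ n)
    +ℚ-def  : ∀ {q r} → H ⊩ q +ℚ r ≐
              frac (ap₁ pos q ⊗ ap₁ den r ⊕ ap₁ pos r ⊗ ap₁ den q)
                   (ap₁ neg q ⊗ ap₁ den r ⊕ ap₁ neg r ⊗ ap₁ den q) (ap₁ den q ⊗ ap₁ den r)
    -ℚ-def  : ∀ {q r} → H ⊩ q -ℚ r ≐
              frac (ap₁ pos q ⊗ ap₁ den r ⊕ ap₁ neg r ⊗ ap₁ den q)
                   (ap₁ neg q ⊗ ap₁ den r ⊕ ap₁ pos r ⊗ ap₁ den q) (ap₁ den q ⊗ ap₁ den r)

    ≤I  : ∀ {s t} → H ⊩ s ∸ t ≐ O → H ⊩ s ≤ t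
    ≤E  : ∀ {s t} → H ⊩ s ≤ t → H ⊩ s ∸ t ≐ O
    ≤ℚI : ∀ {q r} → H ⊩ ap₁ pos q ⊗ ap₁ den r ⊕ ap₁ neg r ⊗ ap₁ den q ≤
                        ap₁ pos r ⊗ ap₁ den q ⊕ ap₁ neg q ⊗ ap₁ den r → H ⊩ q ≤ℚ r
    ≤ℚE : ∀ {q r} → H ⊩ q ≤ℚ r → H ⊩ ap₁ pos q ⊗ ap₁ den r ⊕ ap₁ neg r ⊗ ap₁ den q ≤
                                     ap₁ pos r ⊗ ap₁ den q ⊕ ap₁ neg q ⊗ ap₁ den r
    <ℚI : ∀ {q r} → H ⊩ ap₁ pos q ⊗ ap₁ den r ⊕ ap₁ neg r ⊗ ap₁ den q <
                        ap₁ pos r ⊗ ap₁ den q ⊕ ap₁ neg q ⊗ ap₁ den r → H ⊩ q <ℚ r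
    <ℚE : ∀ {q r} → H ⊩ q <ℚ r → H ⊩ ap₁ pos q ⊗ ap₁ den r ⊕ ap₁ neg r ⊗ ap₁ den q <
                                     ap₁ pos r ⊗ ap₁ den q ⊕ ap₁ neg q ⊗ ap₁ den r

    induction : (A : Fml (𝟎 ∷ Γ)) → QF A → H ⊩ A [ O ] →
                A ∷ wkH H ⊩ sub (S′ v0 ◂ (λ x → var (there x))) A → H ⊩ ∀′ 𝟎 A
    choice    : (A : Fml (𝟎 ∷ 𝟏 ∷ Γ)) → QF A → H ⊩ ∀′ 𝟏 (∃′ 𝟎 A) →
                H ⊩ ∃′ 𝟐 (∀′ 𝟏 (sub (v1 · v0 ◂ v0 ◂ (λ x → var (there (there x)))) A))

    st-≐  : {s t : Trm Γ σ} → H ⊩ s ≐ t → H ⊩ st s → H ⊩ st t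
    st-tm : ∀ {g} (t : Trm Δ σ) (s : Subst Δ Γ) → (∀ {τ} (x : τ ∈ Δ) → H ⊩ g ∋ s x) → H ⊩ g ∋ subT s t
    ∋-full : {t : Trm Γ σ} → H ⊩ full ∋ t

    HAC-int : (A : Fml (𝟎 ∷ 𝟏 ∷ Γ)) → Internal A → H ⊩ ∀ˢᵗ 𝟏 (∃ˢᵗ 𝟎 A) →
              H ⊩ ∃ˢᵗ (𝟏 ⟶ 𝟎 ⋆) (∀ˢᵗ 𝟏 (∃′ 𝟎
                (∃′ 𝟎 (v0 < con len · (v3 · v2) ∧ v1 ≐ con at · (v3 · v2) · v0) ∧
                 sub (v0 ◂ v1 ◂ (λ x → var (there (there (there x))))) A)))
    PF-TP   : (A : Fml (τ ∷ [])) → Internal A →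
              H ⊩ ∀ˢᵗ τ (sub (v0 ◂ ε) A) → H ⊩ ∀′ τ (sub (v0 ◂ ε) A)

    Ξ-ax : H ⊩ ∀ˢᵗ 𝟐 (∀ˢᵗ 𝟏 ((∃ˢᵗ 𝟎 (v1 · v0 ≐ O) ⇔ v1 · v0 ≐ O) ∧ v1 · v0 ≤ one) ⊃
                      ∀ˢᵗ 𝟏 (Ξ · v0 ≐ v1 · v0))

-- Natural numbers: semiring laws, order, truncated subtraction and the Cantor pairing.

module Arithmetic where

  open D using (Ty; 𝟎; 𝟏; 𝟐; _⟶_; _⋆; Ctx; Const)
  open Const
  open Calculus

  private variable
    H : List (Fml Γ)
    A B C : Fml Γ
    a b c d a′ b′ c′ d′ : Trm Γ 𝟎

  infixr 2 _⟫_
  _⟫_ : {s t u : Trm Γ σ} → H ⊩ s ≐ t → H ⊩ t ≐ u → H ⊩ s ≐ u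
  _⟫_ = ≐-trans

  pattern h0 = hyp 0
  pattern h1 = hyp 1
  pattern h2 = hyp 2
  pattern h3 = hyp 3
  pattern h4 = hyp 4
  pattern h5 = hyp 5
  pattern h6 = hyp 6
  pattern h7 = hyp 7
  pattern h8 = hyp 8
  pattern h9 = hyp 9
  pattern h10 = hyp 10
  pattern h11 = hyp 11
  pattern h12 = hyp 12

  infixl 30 _↑
  _↑ : H ⊩ A → B ∷ H ⊩ A
  d ↑ = drop d

  absurd : H ⊩ ⊥′ → H ⊩ A
  absurd d = raa (d ↑)

  have : H ⊩ A → A ∷ H ⊩ B → H ⊩ B
  have d e = ⊃E (⊃I e) d

  em : H ⊩ A ∨ ¬′ A
  em = raa (⊃E h0 (∨I₂ (⊃I (⊃E h1 (∨I₁ h0)))))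

  S-cong : H ⊩ a ≐ b → H ⊩ S′ a ≐ S′ b
  S-cong = ·-cong ≐-refl

  ⊕-cong : H ⊩ a ≐ a′ → H ⊩ b ≐ b′ → H ⊩ a ⊕ b ≐ a′ ⊕ b′
  ⊕-cong = ap₂-cong plus
  ⊗-cong : H ⊩ a ≐ a′ → H ⊩ b ≐ b′ → H ⊩ a ⊗ b ≐ a′ ⊗ b′
  ⊗-cong = ap₂-cong times
  ∸-cong : H ⊩ a ≐ a′ → H ⊩ b ≐ b′ → H ⊩ a ∸ b ≐ a′ ∸ b′
  ∸-cong = ap₂-cong monus

  ⊕-O : H ⊩ O ⊕ a ≐ a
  ⊕-O {a = a} = inst {As = []} (∀E (induction (O ⊕ v0 ≐ v0) tt plus-zer (plus-suc ⟫ S-cong h0)) v0) (a ◂ ε) []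

  -- The parameters are variables during the induction and are instantiated afterwards by `inst`.
  -- With a term `a` in their place, the quantifier rules would leave substitutions into `wk a`,
  -- which do not compute to `a`.
  ⊕-S : H ⊩ S′ a ⊕ b ≐ S′ (a ⊕ b)
  ⊕-S {a = a} {b} = inst {As = []}
    (∀E (induction (S′ v2 ⊕ v0 ≐ S′ (v2 ⊕ v0)) tt (plus-zer ⟫ S-cong (≐-sym plus-zer))
      (plus-suc ⟫ S-cong (h0 ⟫ ≐-sym plus-suc))) v0) (b ◂ a ◂ ε) []

  ⊕-comm : ∀ a b → H ⊩ a ⊕ b ≐ b ⊕ a
  ⊕-comm a b = inst {As = []}
    (∀E (induction (v2 ⊕ v0 ≐ v0 ⊕ v2) tt (plus-zer ⟫ ≐-sym ⊕-O)
      (plus-suc ⟫ S-cong h0 ⟫ ≐-sym ⊕-S)) v0) (b ◂ a ◂ ε) []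

  ⊕-assoc : ∀ a b c → H ⊩ a ⊕ b ⊕ c ≐ a ⊕ (b ⊕ c)
  ⊕-assoc a b c = inst {As = []}
    (∀E (induction (v3 ⊕ v2 ⊕ v0 ≐ v3 ⊕ (v2 ⊕ v0)) tt (plus-zer ⟫ ⊕-cong ≐-refl (≐-sym plus-zer))
      (plus-suc ⟫ S-cong h0 ⟫ ≐-sym plus-suc ⟫ ⊕-cong ≐-refl (≐-sym plus-suc))) v0) (c ◂ b ◂ a ◂ ε) []

  ⊗-O : H ⊩ O ⊗ a ≐ O
  ⊗-O {a = a} = inst {As = []}
    (∀E (induction (O ⊗ v0 ≐ O) tt times-zer (times-suc ⟫ plus-zer ⟫ h0)) v0) (a ◂ ε) []

  ⊕-swap : ∀ a b c → H ⊩ a ⊕ b ⊕ c ≐ a ⊕ c ⊕ b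
  ⊕-swap a b c = ⊕-assoc a b c ⟫ ⊕-cong ≐-refl (⊕-comm b c) ⟫ ≐-sym (⊕-assoc a c b)

  ⊗-S : H ⊩ S′ a ⊗ b ≐ a ⊗ b ⊕ b
  ⊗-S {a = a} {b} = inst {As = []}
    (∀E (induction (S′ v2 ⊗ v0 ≐ v2 ⊗ v0 ⊕ v0) tt (times-zer ⟫ ≐-sym (plus-zer ⟫ times-zer))
      (times-suc ⟫ plus-suc ⟫ S-cong (⊕-cong h0 ≐-refl ⟫ ⊕-swap _ _ _) ⟫ ≐-sym plus-suc ⟫
       ⊕-cong (≐-sym times-suc) ≐-refl)) v0) (b ◂ a ◂ ε) []

  ⊗-comm : ∀ a b → H ⊩ a ⊗ b ≐ b ⊗ a
  ⊗-comm a b = inst {As = []}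
    (∀E (induction (v2 ⊗ v0 ≐ v0 ⊗ v2) tt (times-zer ⟫ ≐-sym ⊗-O)
      (times-suc ⟫ ⊕-cong h0 ≐-refl ⟫ ≐-sym ⊗-S)) v0) (b ◂ a ◂ ε) []

  ⊗-distribˡ : ∀ a b c → H ⊩ a ⊗ (b ⊕ c) ≐ a ⊗ b ⊕ a ⊗ c
  ⊗-distribˡ a b c = inst {As = []}
    (∀E (induction (v3 ⊗ (v2 ⊕ v0) ≐ v3 ⊗ v2 ⊕ v3 ⊗ v0) tt
      (⊗-cong ≐-refl plus-zer ⟫ ≐-sym (⊕-cong ≐-refl times-zer ⟫ plus-zer))
      (⊗-cong ≐-refl plus-suc ⟫ times-suc ⟫ ⊕-cong h0 ≐-refl ⟫ ⊕-assoc _ _ _ ⟫ ⊕-cong ≐-refl (≐-sym times-suc)))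
     v0) (c ◂ b ◂ a ◂ ε) []

  ⊗-distribʳ : ∀ a b c → H ⊩ (b ⊕ c) ⊗ a ≐ b ⊗ a ⊕ c ⊗ a
  ⊗-distribʳ a b c = ⊗-comm _ _ ⟫ ⊗-distribˡ a b c ⟫ ⊕-cong (⊗-comm _ _) (⊗-comm _ _)

  ⊗-assoc : ∀ a b c → H ⊩ a ⊗ b ⊗ c ≐ a ⊗ (b ⊗ c)
  ⊗-assoc a b c = inst {As = []}
    (∀E (induction (v3 ⊗ v2 ⊗ v0 ≐ v3 ⊗ (v2 ⊗ v0)) tt
      (times-zer ⟫ ≐-sym (⊗-cong ≐-refl times-zer ⟫ times-zer))
      (times-suc ⟫ ⊕-cong h0 ≐-refl ⟫ ≐-sym (⊗-distribˡ _ _ _) ⟫ ⊗-cong ≐-refl (≐-sym times-suc)))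
     v0) (c ◂ b ◂ a ◂ ε) []

  ⊗-one : ∀ a → H ⊩ one ⊗ a ≐ a
  ⊗-one a = ⊗-S ⟫ ⊕-cong ⊗-O ≐-refl ⟫ ⊕-O

  S-⊕ : H ⊩ S′ a ≐ a ⊕ one
  S-⊕ = ≐-sym (plus-suc ⟫ S-cong plus-zer)

  -- Derivability of an equation from `H` is taken as the equality of the carrier, so that the ring
  -- solver returns derivations.
  semiring : List (Fml Γ) → CommutativeSemiring 0ℓ 0ℓ
  semiring {Γ} H = record
    { Carrier = Trm Γ 𝟎 ; _≈_ = λ s t → H ⊩ s ≐ t ; _+_ = λ s t → s ⊕ t ; _*_ = λ s t → s ⊗ t ; 0# = O ; 1# = one
    ; isCommutativeSemiring = record
      { isSemiring = record
        { isSemiringWithoutAnnihilatingZero = record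
          { +-isCommutativeMonoid = record
            { isMonoid = record
              { isSemigroup = record
                { isMagma = record { isEquivalence = record { refl = ≐-refl ; sym = ≐-sym ; trans = ≐-trans } ; ∙-cong = ⊕-cong }
                ; assoc = ⊕-assoc }
              ; identity = (λ _ → ⊕-O) , (λ _ → plus-zer) }
            ; comm = ⊕-comm }
          ; *-cong = ⊗-cong ; *-assoc = ⊗-assoc
          ; *-identity = ⊗-one , (λ a → ⊗-comm _ _ ⟫ ⊗-one a)
          ; distrib = ⊗-distribˡ , ⊗-distribʳ }
        ; zero = (λ _ → ⊗-O) , (λ _ → times-zer) }
      ; *-comm = ⊗-comm } }

  module Ring {Γ} (H : List (Fml Γ)) = Algebra.Solver.Ring.NaturalCoefficients.Default (semiring H)

  S-∸-S : ∀ a b → H ⊩ S′ a ∸ S′ b ≐ a ∸ b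
  S-∸-S a b = inst {As = []}
    (∀E (induction (S′ v2 ∸ S′ v0 ≐ v2 ∸ v0) tt
      (monus-suc ⟫ ap₁-cong pred monus-zer ⟫ pred-suc ⟫ ≐-sym monus-zer)
      (monus-suc ⟫ ap₁-cong pred h0 ⟫ ≐-sym monus-suc)) v0) (b ◂ a ◂ ε) []

  O-∸ : ∀ a → H ⊩ O ∸ a ≐ O
  O-∸ a = inst {As = []} (∀E (induction (O ∸ v0 ≐ O) tt monus-zer
    (monus-suc ⟫ ap₁-cong pred h0 ⟫ pred-zer)) v0) (a ◂ ε) []

  ⊕-∸-cancel : ∀ a b c → H ⊩ (a ⊕ c) ∸ (b ⊕ c) ≐ a ∸ b
  ⊕-∸-cancel a b c = inst {As = []}
    (∀E (induction ((v3 ⊕ v0) ∸ (v2 ⊕ v0) ≐ v3 ∸ v2) tt (∸-cong plus-zer plus-zer)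
      (∸-cong plus-suc plus-suc ⟫ S-∸-S _ _ ⟫ h0)) v0) (c ◂ b ◂ a ◂ ε) []

  ⊕-∸ : ∀ a b → H ⊩ (a ⊕ b) ∸ b ≐ a
  ⊕-∸ a b = ∸-cong ≐-refl (≐-sym ⊕-O) ⟫ ⊕-∸-cancel a O b ⟫ monus-zer

  ∸-self : ∀ a → H ⊩ a ∸ a ≐ O
  ∸-self a = ∸-cong (≐-sym ⊕-O) ≐-refl ⟫ ⊕-∸ O a

  zero-or-suc : ∀ a → H ⊩ a ≐ O ∨ a ≐ S′ (ap₁ pred a)
  zero-or-suc a = inst {As = []} (∀E (induction (v0 ≐ O ∨ v0 ≐ S′ (ap₁ pred v0)) (tt , tt) (∨I₁ ≐-refl)
    (∨I₂ (S-cong (≐-sym pred-suc)))) v0) (a ◂ ε) []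

  -- The two disjuncts determine a ∸ b and b ∸ a, from which totality and antisymmetry follow.
  ∸-split : ∀ a b → H ⊩ (a ∸ b ≐ O ∧ b ≐ a ⊕ (b ∸ a)) ∨ a ≐ b ⊕ (a ∸ b)
  ∸-split a b = inst {As = []}
    (∀E (induction ((v2 ∸ v0 ≐ O ∧ v0 ≐ v2 ⊕ (v0 ∸ v2)) ∨ v2 ≐ v0 ⊕ (v2 ∸ v0)) ((tt , tt) , tt)
      (∨I₂ (≐-sym (⊕-O ⟫ monus-zer)))
      (∨E h0
        (∨I₁ (∧I (monus-suc ⟫ ap₁-cong pred (∧E₁ h0) ⟫ pred-zer)
          (S-cong (∧E₂ h0) ⟫ ≐-sym plus-suc ⟫ ⊕-cong ≐-refl
            (≐-sym (∸-cong (S-cong (∧E₂ h0) ⟫ ≐-sym plus-suc ⟫ ⊕-comm _ _) ≐-refl ⟫ ⊕-∸ _ _)))))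
        (∨E (zero-or-suc (v2 ∸ v0))
          (have (h1 ⟫ ⊕-cong ≐-refl h0 ⟫ plus-zer)
            (∨I₁ (∧I (monus-suc ⟫ ap₁-cong pred h1 ⟫ pred-zer)
              (S-cong (≐-sym h0) ⟫ S-⊕ ⟫ ⊕-cong ≐-refl
                (≐-sym (∸-cong (S-cong (≐-sym h0) ⟫ S-⊕ ⟫ ⊕-comm _ _) ≐-refl ⟫ ⊕-∸ _ _))))))
          (∨I₂ (h1 ⟫ ⊕-cong ≐-refl h0 ⟫ plus-suc ⟫ ≐-sym ⊕-S ⟫ ⊕-cong ≐-refl (≐-sym monus-suc))))))
     v0) (b ◂ a ◂ ε) []

  ≤-intro : H ⊩ b ≐ a ⊕ c → H ⊩ a ≤ b
  ≤-intro {b = b} {a} {c} e = ≤I (∸-cong (≐-sym ⊕-O) (e ⟫ ⊕-comm a c) ⟫ ⊕-∸-cancel O c a ⟫ O-∸ c)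

  ≤-elim : H ⊩ a ≤ b → H ⊩ b ≐ a ⊕ (b ∸ a)
  ≤-elim {a = a} {b} d = ∨E (∸-split a b) (∧E₂ h0)
    (have (h0 ⟫ ⊕-cong ≐-refl (≤E d ↑) ⟫ plus-zer)
      (≐-sym (⊕-cong ≐-refl (∸-cong (≐-sym h0) ≐-refl ⟫ ∸-self a) ⟫ plus-zer ⟫ h0)))

  ≤-total : ∀ a b → H ⊩ a ≤ b ∨ b ≤ a
  ≤-total a b = ∨E (∸-split a b) (∨I₁ (≤I (∧E₁ h0))) (∨I₂ (≤-intro h0))

  ≤-resp : H ⊩ a ≐ a′ → H ⊩ b ≐ b′ → H ⊩ a ≤ b → H ⊩ a′ ≤ b′
  ≤-resp e f d = ≤I (∸-cong (≐-sym e) (≐-sym f) ⟫ ≤E d)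

  ≤-refl : H ⊩ a ≤ a
  ≤-refl {a = a} = ≤I (∸-self a)

  ≤-reflexive : H ⊩ a ≐ b → H ⊩ a ≤ b
  ≤-reflexive e = ≤-resp ≐-refl e ≤-refl

  ≤-trans : H ⊩ a ≤ b → H ⊩ b ≤ c → H ⊩ a ≤ c
  ≤-trans d e = ≤-intro (≤-elim e ⟫ ⊕-cong (≤-elim d) ≐-refl ⟫ ⊕-assoc _ _ _)

  ⊕-cancelʳ : H ⊩ a ⊕ c ≐ b ⊕ c → H ⊩ a ≐ b
  ⊕-cancelʳ {a = a} {c} {b} e = ≐-sym (⊕-∸ a c) ⟫ ∸-cong e ≐-refl ⟫ ⊕-∸ b c

  -- Transfers a known inequality along an identity that the ring solver can check. Adding crosswise
  -- takes the place of subtracting, which a semiring does not have.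
  ≤-by : H ⊩ c ≤ d → H ⊩ a ⊕ d ≐ b ⊕ c → H ⊩ a ≤ b
  ≤-by {c = c} {d} {a} {b} l e = ≤-intro {c = d ∸ c} (⊕-cancelʳ {c = c} (≐-sym e ⟫ ⊕-cong ≐-refl (≤-elim l ⟫ ⊕-comm c _) ⟫
    ≐-sym (⊕-assoc a (d ∸ c) c)))

  <-by : H ⊩ c < d → H ⊩ a ⊕ d ≐ b ⊕ c → H ⊩ a < b
  <-by l e = ≤-by l (⊕-S ⟫ S-cong e ⟫ ≐-sym plus-suc)

  ⊕-mono : H ⊩ a ≤ b → H ⊩ c ≤ d → H ⊩ a ⊕ c ≤ b ⊕ d
  ⊕-mono {H = H} {a} {b} {c} {d} l m = ≤-intro (⊕-cong (≤-elim l) (≤-elim m) ⟫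
    (let open Ring H in solve 4 (λ a b c d → a :+ b :+ (c :+ d) := a :+ c :+ (b :+ d)) ≐-refl a (b ∸ a) c (d ∸ c)))

  ⊗-monoʳ : ∀ c → H ⊩ a ≤ b → H ⊩ c ⊗ a ≤ c ⊗ b
  ⊗-monoʳ c l = ≤-intro (⊗-cong ≐-refl (≤-elim l) ⟫ ⊗-distribˡ _ _ _)

  n≤Sn : H ⊩ a ≤ S′ a
  n≤Sn = ≤-intro S-⊕

  O≤ : H ⊩ O ≤ a
  O≤ {a = a} = ≤I (O-∸ a)

  <⇒≤ : H ⊩ a < b → H ⊩ a ≤ b
  <⇒≤ = ≤-trans n≤Sn

  <-irrefl : H ⊩ a < a → H ⊩ ⊥′
  <-irrefl {a = a} l = suc≢zer (≐-sym (⊕-∸ one a) ⟫ ∸-cong (⊕-comm one a ⟫ ≐-sym S-⊕) ≐-refl ⟫ ≤E l)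

  <-or-≥ : ∀ a b → H ⊩ a < b ∨ b ≤ a
  <-or-≥ a b = ∨E (∸-split b a) (∨I₂ (≤I (∧E₁ h0)))
    (∨E (zero-or-suc (b ∸ a)) (∨I₂ (≤-reflexive (h1 ⟫ ⊕-cong ≐-refl h0 ⟫ plus-zer)))
      (∨I₁ (≤-intro (h1 ⟫ ⊕-cong ≐-refl h0 ⟫ plus-suc ⟫ ≐-sym ⊕-S))))

  ≤-antisym : H ⊩ a ≤ b → H ⊩ b ≤ a → H ⊩ a ≐ b
  ≤-antisym {a = a} {b} l m = ∨E (zero-or-suc (b ∸ a))
    (≐-sym (≤-elim (l ↑) ⟫ ⊕-cong ≐-refl h0 ⟫ plus-zer))
    (absurd (<-irrefl {a = a} (≤-trans (≤-intro (≤-elim (l ↑) ⟫ ⊕-cong ≐-refl h0 ⟫ plus-suc ⟫ ≐-sym ⊕-S)) (m ↑))))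

  ⊗-cancel-< : H ⊩ c ⊗ a < c ⊗ b → H ⊩ a < b
  ⊗-cancel-< {c = c} {a} {b} l = ∨E (<-or-≥ a b) h0
    (absurd (<-irrefl (≤-trans (l ↑) (⊗-monoʳ c h0))))

  ⊗-cancel-≤ : H ⊩ S′ c ⊗ a ≤ S′ c ⊗ b → H ⊩ a ≤ b
  ⊗-cancel-≤ {c = c} {a} {b} l = ∨E (<-or-≥ b a)
    (absurd (<-irrefl (≤-trans (≤-trans (≤-intro (times-suc ⟫ plus-suc ⟫ ≐-sym ⊕-S)) (⊗-monoʳ (S′ c) h0)) (l ↑)))) h0

  ⊗-mono-< : H ⊩ a < b → H ⊩ S′ c ⊗ a < S′ c ⊗ b
  ⊗-mono-< {c = c} l = ≤-trans (≤-intro (times-suc ⟫ plus-suc ⟫ ≐-sym ⊕-S)) (⊗-monoʳ (S′ c) l)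

  <-≤-mono : H ⊩ a < b → H ⊩ c ≤ d → H ⊩ a ⊕ c < b ⊕ d
  <-≤-mono l m = ≤-resp ⊕-S ≐-refl (⊕-mono l m)

  ≢O : H ⊩ ¬′ (a ≐ O) → H ⊩ a ≐ S′ (ap₁ pred a)
  ≢O {a = a} n = ∨E (zero-or-suc a) (absurd (⊃E (n ↑) h0)) h0

  tri-mono : H ⊩ a ≤ b → H ⊩ ap₁ tri a ≤ ap₁ tri b
  tri-mono {a = a} {b} l = ≤-resp ≐-refl (ap₁-cong tri (≐-sym (≤-elim l)))
    (inst {As = []} (∀E (induction (ap₁ tri v2 ≤ ap₁ tri (v2 ⊕ v0)) tt (≤-reflexive (ap₁-cong tri (≐-sym plus-zer)))
      (≤-trans h0 (≤-intro (ap₁-cong tri plus-suc ⟫ tri-suc)))) v0) (b ∸ a ◂ a ◂ ε) [])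

  -- The recursion for `root` adds 1 exactly when the next triangular number has been reached, so
  -- the bounds are an invariant.
  root-bounds : ∀ n → H ⊩ ap₁ tri (ap₁ root n) ≤ n ∧ n < ap₁ tri (S′ (ap₁ root n))
  root-bounds n = inst {As = []} (∀E (induction (ap₁ tri (ap₁ root v0) ≤ v0 ∧ v0 < ap₁ tri (S′ (ap₁ root v0))) (tt , tt)
    (∧I (≤-reflexive (ap₁-cong tri root-zer ⟫ tri-zer))
        (≤-reflexive (≐-sym (ap₁-cong tri (S-cong root-zer) ⟫ tri-suc ⟫ ⊕-cong tri-zer ≐-refl ⟫ ⊕-O))))
    (∨E (<-or-≥ (S′ v0) T)
      (have {A = ap₁ root (S′ v0) ≐ ap₁ root v0}
        (root-suc ⟫ ⊕-cong ≐-refl (∸-cong ≐-refl (≢O (⊃I (<-irrefl (≤-trans h1 (≤I h0))))) ⟫ S-∸-S _ _ ⟫ O-∸ _) ⟫ plus-zer)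
        (∧I (≤-resp (ap₁-cong tri (≐-sym h0)) ≐-refl (≤-trans (∧E₁ h2) n≤Sn))
            (≤-resp ≐-refl (ap₁-cong tri (S-cong (≐-sym h0))) h1)))
      -- Here the triangular number is hit exactly: it is at most `S′ v0` and greater than `v0`.
      (have {A = ap₁ root (S′ v0) ≐ S′ (ap₁ root v0)}
        (root-suc ⟫ ⊕-cong ≐-refl (∸-cong ≐-refl (≤E h0) ⟫ monus-zer) ⟫ ≐-sym S-⊕)
        (∧I (≤-resp (ap₁-cong tri (≐-sym h0)) ≐-refl h1)
            (≤-resp ≐-refl (≐-sym (ap₁-cong tri (S-cong h0) ⟫ tri-suc ⟫ plus-suc))
              (≤-intro (S-cong (⊕-cong (≤-antisym h1 (∧E₂ h2)) ≐-refl) ⟫ ≐-sym ⊕-S))))))) v0) (n ◂ ε) []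
    where
    T = ap₁ tri (S′ (ap₁ root v0))

  -- Since `a ≤ b`, the number `tri b ⊕ a` lies between `tri b` and `tri (S′ b)`, and by
  -- monotonicity of `tri` only `b` satisfies `root-bounds` for it. This makes the projections
  -- invert `pair`.
  root-pair : H ⊩ a ≤ b → H ⊩ ap₁ root (ap₁ tri b ⊕ a) ≐ b
  root-pair {a = a} {b} l = ≤-antisym
    (∨E (<-or-≥ b R) (absurd (<-irrefl (≤-trans
        (≤-trans (≤-trans n<T (tri-mono h0)) (∧E₁ (root-bounds n))) ≤-refl))) h0)
    (∨E (<-or-≥ R b) (absurd (<-irrefl (≤-trans
        (≤-trans (∧E₂ (root-bounds n)) (tri-mono h0)) (≤-intro ≐-refl)))) h0)
    where
    n R : Trm _ 𝟎
    n = ap₁ tri b ⊕ a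
    R = ap₁ root n
    n<T : _ ∷ _ ⊩ n < ap₁ tri (S′ b)
    n<T = ≤-resp plus-suc (≐-sym tri-suc) (⊕-mono ≤-refl (≤-resp ≐-refl ≐-refl (⊕-mono-S (l ↑))))
      where
      ⊕-mono-S : H ⊩ a ≤ b → H ⊩ S′ a ≤ S′ b
      ⊕-mono-S m = ≤I (S-∸-S _ _ ⟫ ≤E m)

  π₁-pair : H ⊩ ap₁ π₁ ⟨ a , b ⟩ ≐ a
  π₁-pair {a = a} {b} = π₁-def ⟫ ∸-cong pair-def
    (ap₁-cong tri (ap₁-cong root pair-def ⟫ root-pair (≤-intro {c = b} ≐-refl))) ⟫
    ∸-cong (⊕-comm _ _) ≐-refl ⟫ ⊕-∸ _ _

  π₂-pair : H ⊩ ap₁ π₂ ⟨ a , b ⟩ ≐ b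
  π₂-pair {a = a} {b} = π₂-def ⟫ ∸-cong (ap₁-cong root pair-def ⟫ root-pair (≤-intro {c = b} ≐-refl)) π₁-pair ⟫
    ∸-cong (⊕-comm _ _) ≐-refl ⟫ ⊕-∸ _ _

-- The notions and principles of the theorem, parametrised by the range of their quantifiers.

module Formulas where

  open D using (Ty; 𝟎; 𝟏; 𝟐; _⟶_; _⋆; Ctx; Const)
  open Const
  open Calculus

  infix 10 _∈ℝ[_] _≈ℝ_[_] _≤ℝ_[_] _∈𝕀[_] _∈C̄[_]

  _∈ℝ[_] : Trm Γ 𝟏 → Range → Fml Γ
  x ∈ℝ[ g ] = ∀[ g ] 𝟎 (∀[ g ] 𝟎 (∣ wk (wk x) · v1 -ℚ wk (wk x) · (v1 ⊕ v0) ∣ <ℚ 2^- v1))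

  _≈ℝ_[_] : Trm Γ 𝟏 → Trm Γ 𝟏 → Range → Fml Γ
  x ≈ℝ y [ g ] = ∀[ g ] 𝟎 (∣ wk x · v0 -ℚ wk y · v0 ∣ ≤ℚ 2^- v0)

  _≤ℝ_[_] : Trm Γ 𝟏 → Trm Γ 𝟏 → Range → Fml Γ
  x ≤ℝ y [ g ] = ∀[ g ] 𝟎 (wk x · v0 ≤ℚ wk y · v0 +ℚ (2^- v0 +ℚ 2^- v0))

  near : Range → Trm Γ 𝟏 → Trm Γ 𝟏 → Trm Γ 𝟎 → Fml Γ
  near g x y k = ∃[ g ] 𝟎 (∣ wk x · v0 -ℚ wk y · v0 ∣ +ℚ (2^- v0 +ℚ 2^- v0) <ℚ 2^- (wk k))

  0ℚ 1ℚ : Trm Γ 𝟎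
  0ℚ = frac O O one
  1ℚ = frac one O one

  _∈𝕀[_] : Trm Γ 𝟏 → Range → Fml Γ
  x ∈𝕀[ g ] = x ∈ℝ[ g ] ∧ con K · 0ℚ ≤ℝ x [ g ] ∧ x ≤ℝ con K · 1ℚ [ g ]

  real→real : Range → Trm Γ (𝟏 ⟶ 𝟏) → Fml Γ
  real→real g f =
    ∀[ g ] 𝟏 (v0 ∈ℝ[ g ] ⊃ wk f · v0 ∈ℝ[ g ]) ∧
    ∀[ g ] 𝟏 (v0 ∈ℝ[ g ] ⊃ ∀[ g ] 𝟏 (v0 ∈ℝ[ g ] ⊃ v1 ≈ℝ v0 [ g ] ⊃ wk (wk f) · v1 ≈ℝ wk (wk f) · v0 [ g ]))

  continuous : Range → Trm Γ (𝟏 ⟶ 𝟏) → Fml Γ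
  continuous g f = ∀[ g ] 𝟏 (v0 ∈𝕀[ g ] ⊃ ∀[ g ] 𝟎 (∃[ g ] 𝟎 (∀[ g ] 𝟏 (v0 ∈𝕀[ g ] ⊃
    near g v3 v0 v1 ⊃
    near g (wk (wk (wk (wk f))) · v3) (wk (wk (wk (wk f))) · v0) v2))))

  _∈C̄[_] : Trm Γ (𝟏 ⟶ 𝟏) → Range → Fml Γ
  f ∈C̄[ g ] = (real→real g f ∧ continuous g f) ∧
    con K · 0ℚ ≤ℝ f · (con K · 0ℚ) [ g ] ∧ f · (con K · 1ℚ) ≤ℝ con K · 0ℚ [ g ]

  decides : Range → Trm Γ 𝟐 → Fml Γ
  decides g φ = ∀[ g ] 𝟏 (∃[ g ] 𝟎 (v1 · v0 ≐ O) ⇔ wk φ · v0 ≐ O)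

  ∃² TRANS IVT* UIVT : Fml Γ
  ∃²    = ∃′ 𝟐 (decides full v0)
  TRANS = ∀ˢᵗ 𝟏 (∀ˢᵗ 𝟎 (v1 · v0 ≐ O) ⊃ ∀′ 𝟎 (v1 · v0 ≐ O))
  IVT*  = ∀ˢᵗ (𝟏 ⟶ 𝟏) (v0 ∈C̄[ std ] ⊃ ∃ˢᵗ 𝟏 (v0 ∈𝕀[ full ] ∧ v1 · v0 ≈ℝ con K · 0ℚ [ full ]))
  UIVT  = ∃′ ((𝟏 ⟶ 𝟏) ⟶ 𝟏) (∀′ (𝟏 ⟶ 𝟏)
            (v0 ∈C̄[ full ] ⊃ v1 · v0 ∈𝕀[ full ] ∧ v0 · (v1 · v0) ≈ℝ con K · 0ℚ [ full ]))

-- Rational numbers: order, addition, absolute differences and powers of two.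

module Rationals where

  open D using (Ty; 𝟎; 𝟏; 𝟐; _⟶_; _⋆; Ctx; Const)
  open Const
  open Calculus
  open Arithmetic
  open Formulas using (0ℚ; 1ℚ)

  private variable
    H : List (Fml Γ)
    A B C : Fml Γ
    a b c d : Trm Γ 𝟎
    q r s t q′ r′ : Trm Γ 𝟎

  pattern p[_] q = ap₁ pos q
  pattern n[_] q = ap₁ neg q
  pattern d[_] q = ap₁ den q

  -- Denominators are multiplied out and negative parts moved to the other side, so that `q ≤ℚ r` is
  -- `lhs q r ≤ rhs q r` between natural numbers.
  lhs rhs : Trm Γ 𝟎 → Trm Γ 𝟎 → Trm Γ 𝟎
  lhs q r = p[ q ] ⊗ d[ r ] ⊕ n[ r ] ⊗ d[ q ]
  rhs q r = p[ r ] ⊗ d[ q ] ⊕ n[ q ] ⊗ d[ r ]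

  pos-frac : H ⊩ p[ frac a b c ] ≐ a
  pos-frac = pos-def ⟫ ap₁-cong π₁ π₁-pair ⟫ π₁-pair

  neg-frac : H ⊩ n[ frac a b c ] ≐ b
  neg-frac = neg-def ⟫ ap₁-cong π₂ π₁-pair ⟫ π₂-pair

  den-frac : H ⊩ O < c → H ⊩ d[ frac a b c ] ≐ c
  den-frac {c = c} l = den-def ⟫ S-cong π₂-pair ⟫
    ∨E (zero-or-suc c) (absurd (<-irrefl (≤-resp ≐-refl h0 (l ↑)))) (≐-sym h0)

  O<S : H ⊩ O < S′ a
  O<S = ≤-intro (S-⊕ ⟫ ⊕-comm _ _)

  O<den : ∀ q → H ⊩ O < d[ q ]
  O<den q = ≤-resp ≐-refl (≐-sym den-def) O<S

  O<⊗ : H ⊩ O < a → H ⊩ O < b → H ⊩ O < a ⊗ b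
  O<⊗ l m = ≤-resp ≐-refl (≐-sym (⊗-cong (≤-elim l ⟫ ⊕-S ⟫ S-cong ⊕-O) (≤-elim m ⟫ ⊕-S ⟫ S-cong ⊕-O) ⟫ times-suc ⟫ plus-suc)) O<S

  pos-+ : ∀ q r → H ⊩ p[ q +ℚ r ] ≐ p[ q ] ⊗ d[ r ] ⊕ p[ r ] ⊗ d[ q ]
  pos-+ q r = ap₁-cong pos +ℚ-def ⟫ pos-frac
  neg-+ : ∀ q r → H ⊩ n[ q +ℚ r ] ≐ n[ q ] ⊗ d[ r ] ⊕ n[ r ] ⊗ d[ q ]
  neg-+ q r = ap₁-cong neg +ℚ-def ⟫ neg-frac
  den-+ : ∀ q r → H ⊩ d[ q +ℚ r ] ≐ d[ q ] ⊗ d[ r ]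
  den-+ q r = ap₁-cong den +ℚ-def ⟫ den-frac (O<⊗ (O<den q) (O<den r))

  pos-minus : ∀ q r → H ⊩ p[ q -ℚ r ] ≐ p[ q ] ⊗ d[ r ] ⊕ n[ r ] ⊗ d[ q ]
  pos-minus q r = ap₁-cong pos -ℚ-def ⟫ pos-frac
  neg-minus : ∀ q r → H ⊩ n[ q -ℚ r ] ≐ n[ q ] ⊗ d[ r ] ⊕ p[ r ] ⊗ d[ q ]
  neg-minus q r = ap₁-cong neg -ℚ-def ⟫ neg-frac
  den-minus : ∀ q r → H ⊩ d[ q -ℚ r ] ≐ d[ q ] ⊗ d[ r ]
  den-minus q r = ap₁-cong den -ℚ-def ⟫ den-frac (O<⊗ (O<den q) (O<den r))

  ⊗-cancel-≤′ : H ⊩ O < c → H ⊩ c ⊗ a ≤ c ⊗ b → H ⊩ a ≤ b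
  ⊗-cancel-≤′ l m = ⊗-cancel-≤ (≤-resp (⊗-cong e ≐-refl) (⊗-cong e ≐-refl) m)
    where e = ≤-elim l ⟫ ⊕-S ⟫ S-cong ⊕-O

  ⊗-mono-<′ : H ⊩ O < c → H ⊩ a < b → H ⊩ c ⊗ a < c ⊗ b
  ⊗-mono-<′ l m = ≤-resp (S-cong (⊗-cong (≐-sym e) ≐-refl)) (⊗-cong (≐-sym e) ≐-refl) (⊗-mono-< m)
    where e = ≤-elim l ⟫ ⊕-S ⟫ S-cong ⊕-O

  lhs-cong : H ⊩ q ≐ q′ → H ⊩ r ≐ r′ → H ⊩ lhs q r ≐ lhs q′ r′
  lhs-cong e f = ⊕-cong (⊗-cong (ap₁-cong pos e) (ap₁-cong den f)) (⊗-cong (ap₁-cong neg f) (ap₁-cong den e))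
  rhs-cong : H ⊩ q ≐ q′ → H ⊩ r ≐ r′ → H ⊩ rhs q r ≐ rhs q′ r′
  rhs-cong e f = ⊕-cong (⊗-cong (ap₁-cong pos f) (ap₁-cong den e)) (⊗-cong (ap₁-cong neg e) (ap₁-cong den f))

  ≤ℚ-resp : H ⊩ q ≐ q′ → H ⊩ r ≐ r′ → H ⊩ q ≤ℚ r → H ⊩ q′ ≤ℚ r′
  ≤ℚ-resp e f l = ≤ℚI (≤-resp (lhs-cong e f) (rhs-cong e f) (≤ℚE l))
  <ℚ-resp : H ⊩ q ≐ q′ → H ⊩ r ≐ r′ → H ⊩ q <ℚ r → H ⊩ q′ <ℚ r′
  <ℚ-resp e f l = <ℚI (≤-resp (S-cong (lhs-cong e f)) (rhs-cong e f) (<ℚE l))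

  ≤ℚ-refl : H ⊩ q ≤ℚ q
  ≤ℚ-refl = ≤ℚI ≤-refl

  private
    -- The comparison of `q` with `r` scaled by the denominator of `s`, plus that of `r` with `s`
    -- scaled by the denominator of `q`, is the comparison of `q` with `s` scaled by the denominator
    -- of `r`, up to summands common to both sides.
    trans-eq : ∀ q r s → H ⊩ d[ r ] ⊗ lhs q s ⊕ (d[ s ] ⊗ rhs q r ⊕ d[ q ] ⊗ rhs r s) ≐
                             d[ r ] ⊗ rhs q s ⊕ (d[ s ] ⊗ lhs q r ⊕ d[ q ] ⊗ lhs r s)
    trans-eq {H = H} q r s = let open Ring H in solve 9 (λ p₁ n₁ d₁ p₂ n₂ d₂ p₃ n₃ d₃ →
      d₂ :* (p₁ :* d₃ :+ n₃ :* d₁) :+ (d₃ :* (p₂ :* d₁ :+ n₁ :* d₂) :+ d₁ :* (p₃ :* d₂ :+ n₂ :* d₃)) :=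
      d₂ :* (p₃ :* d₁ :+ n₁ :* d₃) :+ (d₃ :* (p₁ :* d₂ :+ n₂ :* d₁) :+ d₁ :* (p₂ :* d₃ :+ n₃ :* d₂))) ≐-refl
      p[ q ] n[ q ] d[ q ] p[ r ] n[ r ] d[ r ] p[ s ] n[ s ] d[ s ]

  ≤ℚ-trans : H ⊩ q ≤ℚ r → H ⊩ r ≤ℚ s → H ⊩ q ≤ℚ s
  ≤ℚ-trans {q = q} {r} {s} l m = ≤ℚI (⊗-cancel-≤′ (O<den r)
    (≤-by (⊕-mono (⊗-monoʳ d[ s ] (≤ℚE l)) (⊗-monoʳ d[ q ] (≤ℚE m))) (trans-eq q r s)))

  <-≤ℚ-trans : H ⊩ q <ℚ r → H ⊩ r ≤ℚ s → H ⊩ q <ℚ s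
  <-≤ℚ-trans {q = q} {r} {s} l m = <ℚI (⊗-cancel-<
    (<-by (<-≤-mono (⊗-mono-<′ (O<den s) (<ℚE l)) (⊗-monoʳ d[ q ] (≤ℚE m))) (trans-eq q r s)))

  <ℚ⇒≤ℚ : H ⊩ q <ℚ r → H ⊩ q ≤ℚ r
  <ℚ⇒≤ℚ l = ≤ℚI (<⇒≤ (<ℚE l))

  ≤-<-mono : H ⊩ a ≤ b → H ⊩ c < d → H ⊩ a ⊕ c < b ⊕ d
  ≤-<-mono l m = ≤-resp (S-cong (⊕-comm _ _)) (⊕-comm _ _) (<-≤-mono m l)

  ≤-<ℚ-trans : H ⊩ q ≤ℚ r → H ⊩ r <ℚ s → H ⊩ q <ℚ s
  ≤-<ℚ-trans {q = q} {r} {s} l m = <ℚI (⊗-cancel-<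
    (<-by (≤-<-mono (⊗-monoʳ d[ s ] (≤ℚE l)) (⊗-mono-<′ (O<den q) (<ℚE m))) (trans-eq q r s)))

  <ℚ-irrefl : H ⊩ q <ℚ q → H ⊩ ⊥′
  <ℚ-irrefl l = <-irrefl (<ℚE l)

  <ℚ-or-≥ : ∀ q r → H ⊩ q <ℚ r ∨ r ≤ℚ q
  <ℚ-or-≥ q r = ∨E (<-or-≥ (lhs q r) (rhs q r)) (∨I₁ (<ℚI h0)) (∨I₂ (≤ℚI h0))

  ≤ℚ-or-> : ∀ q r → H ⊩ q ≤ℚ r ∨ r <ℚ q
  ≤ℚ-or-> q r = ∨E (<ℚ-or-≥ r q) (∨I₂ h0) (∨I₁ h0)

  infix 4 _∣_≃_
  -- Fractions are not reduced, so a rational has many codes and its equality is `≤ℚ` both ways. As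
  -- a pair of derivations it can serve as the equality of a setoid.
  _∣_≃_ : List (Fml Γ) → Trm Γ 𝟎 → Trm Γ 𝟎 → Set
  H ∣ q ≃ r = (H ⊩ q ≤ℚ r) × (H ⊩ r ≤ℚ q)

  ≃-intro : H ⊩ lhs q r ≐ rhs q r → H ∣ q ≃ r
  ≃-intro e = ≤ℚI (≤-reflexive e) , ≤ℚI (≤-reflexive (≐-sym e))

  ≐⇒≃ : H ⊩ q ≐ r → H ∣ q ≃ r
  ≐⇒≃ e = ≤ℚ-resp ≐-refl e ≤ℚ-refl , ≤ℚ-resp e ≐-refl ≤ℚ-refl

  ≃-sym : H ∣ q ≃ r → H ∣ r ≃ q
  ≃-sym (l , m) = m , l

  ≃-trans : H ∣ q ≃ r → H ∣ r ≃ s → H ∣ q ≃ s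
  ≃-trans (l , m) (l′ , m′) = ≤ℚ-trans l l′ , ≤ℚ-trans m′ m

  -- Adding s scales both sides of a comparison by the square of the denominator of s, up to
  -- a common summand.
  private
    +-lhs : ∀ q r s → H ⊩ lhs (q +ℚ s) (r +ℚ s) ≐
            d[ s ] ⊗ d[ s ] ⊗ lhs q r ⊕ (p[ s ] ⊕ n[ s ]) ⊗ (d[ q ] ⊗ d[ r ] ⊗ d[ s ])
    +-lhs {H = H} q r s = ⊕-cong (⊗-cong (pos-+ q s) (den-+ r s)) (⊗-cong (neg-+ r s) (den-+ q s)) ⟫
      (let open Ring H in solve 7 (λ p₁ d₁ n₂ d₂ p₃ n₃ d₃ →
        (p₁ :* d₃ :+ p₃ :* d₁) :* (d₂ :* d₃) :+ (n₂ :* d₃ :+ n₃ :* d₂) :* (d₁ :* d₃) :=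
        d₃ :* d₃ :* (p₁ :* d₂ :+ n₂ :* d₁) :+ (p₃ :+ n₃) :* (d₁ :* d₂ :* d₃)) ≐-refl
        p[ q ] d[ q ] n[ r ] d[ r ] p[ s ] n[ s ] d[ s ])

    +-rhs : ∀ q r s → H ⊩ rhs (q +ℚ s) (r +ℚ s) ≐
            d[ s ] ⊗ d[ s ] ⊗ rhs q r ⊕ (p[ s ] ⊕ n[ s ]) ⊗ (d[ q ] ⊗ d[ r ] ⊗ d[ s ])
    +-rhs {H = H} q r s = ⊕-cong (⊗-cong (pos-+ r s) (den-+ q s)) (⊗-cong (neg-+ q s) (den-+ r s)) ⟫
      (let open Ring H in solve 7 (λ n₁ d₁ p₂ d₂ p₃ n₃ d₃ →
        (p₂ :* d₃ :+ p₃ :* d₂) :* (d₁ :* d₃) :+ (n₁ :* d₃ :+ n₃ :* d₁) :* (d₂ :* d₃) :=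
        d₃ :* d₃ :* (p₂ :* d₁ :+ n₁ :* d₂) :+ (p₃ :+ n₃) :* (d₁ :* d₂ :* d₃)) ≐-refl
        n[ q ] d[ q ] p[ r ] d[ r ] p[ s ] n[ s ] d[ s ])

    O<den² : ∀ s → H ⊩ O < d[ s ] ⊗ d[ s ]
    O<den² s = O<⊗ (O<den s) (O<den s)

  +ℚ-monoˡ : ∀ s → H ⊩ q ≤ℚ r → H ⊩ q +ℚ s ≤ℚ r +ℚ s
  +ℚ-monoˡ {q = q} {r} s l = ≤ℚI (≤-resp (≐-sym (+-lhs q r s)) (≐-sym (+-rhs q r s))
    (⊕-mono (⊗-monoʳ _ (≤ℚE l)) ≤-refl))

  +ℚ-monoˡ-< : ∀ s → H ⊩ q <ℚ r → H ⊩ q +ℚ s <ℚ r +ℚ s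
  +ℚ-monoˡ-< {q = q} {r} s l = <ℚI (≤-resp (S-cong (≐-sym (+-lhs q r s))) (≐-sym (+-rhs q r s))
    (<-≤-mono (⊗-mono-<′ (O<den² s) (<ℚE l)) ≤-refl))

  +ℚ-cancelʳ : ∀ s → H ⊩ q +ℚ s ≤ℚ r +ℚ s → H ⊩ q ≤ℚ r
  +ℚ-cancelʳ {q = q} {r} s l = ≤ℚI (⊗-cancel-≤′ (O<den² s)
    (≤-by (≤-resp (+-lhs q r s) (+-rhs q r s) (≤ℚE l))
      (≐-sym (⊕-assoc _ _ _) ⟫ ⊕-cong (⊕-comm _ _) ≐-refl ⟫ ⊕-assoc _ _ _)))

  +ℚ-cancelʳ-< : ∀ s → H ⊩ q +ℚ s <ℚ r +ℚ s → H ⊩ q <ℚ r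
  +ℚ-cancelʳ-< {q = q} {r} s l = <ℚI (⊗-cancel-<
    (<-by (≤-resp (S-cong (+-lhs q r s)) (+-rhs q r s) (<ℚE l))
      (≐-sym (⊕-assoc _ _ _) ⟫ ⊕-cong (⊕-comm _ _) ≐-refl ⟫ ⊕-assoc _ _ _)))

  +ℚ-comm : ∀ q r → H ∣ q +ℚ r ≃ r +ℚ q
  +ℚ-comm q r = ≐⇒≃ (+ℚ-def ⟫ ap₂-cong pair (ap₂-cong pair (⊕-comm _ _) (⊕-comm _ _)) (ap₁-cong pred (⊗-comm _ _)) ⟫ ≐-sym +ℚ-def)

  +ℚ-mono : H ⊩ q ≤ℚ r → H ⊩ s ≤ℚ t → H ⊩ q +ℚ s ≤ℚ r +ℚ t
  +ℚ-mono {r = r} {s} {t} l m = ≤ℚ-trans (+ℚ-monoˡ s l) (≤ℚ-trans (proj₁ (+ℚ-comm r s)) (≤ℚ-trans (+ℚ-monoˡ r m) (proj₁ (+ℚ-comm t r))))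

  +ℚ-mono-<≤ : H ⊩ q <ℚ r → H ⊩ s ≤ℚ t → H ⊩ q +ℚ s <ℚ r +ℚ t
  +ℚ-mono-<≤ {r = r} {s} {t} l m = <-≤ℚ-trans (+ℚ-monoˡ-< s l) (≤ℚ-trans (proj₁ (+ℚ-comm r s)) (≤ℚ-trans (+ℚ-monoˡ r m) (proj₁ (+ℚ-comm t r))))

  +ℚ-mono-< : H ⊩ q <ℚ r → H ⊩ s <ℚ t → H ⊩ q +ℚ s <ℚ r +ℚ t
  +ℚ-mono-< l m = +ℚ-mono-<≤ l (<ℚ⇒≤ℚ m)

  +ℚ-assoc : ∀ q r s → H ∣ (q +ℚ r) +ℚ s ≃ q +ℚ (r +ℚ s)
  +ℚ-assoc {H = H} q r s = ≐⇒≃ (+ℚ-def ⟫ ap₂-cong pair (ap₂-cong pair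
      (⊕-cong (⊗-cong (pos-+ q r) ≐-refl) (⊗-cong ≐-refl (den-+ q r)) ⟫ e p[ q ] p[ r ] p[ s ] ⟫
        ≐-sym (⊕-cong (⊗-cong ≐-refl (den-+ r s)) (⊗-cong (pos-+ r s) ≐-refl)))
      (⊕-cong (⊗-cong (neg-+ q r) ≐-refl) (⊗-cong ≐-refl (den-+ q r)) ⟫ e n[ q ] n[ r ] n[ s ] ⟫
        ≐-sym (⊕-cong (⊗-cong ≐-refl (den-+ r s)) (⊗-cong (neg-+ r s) ≐-refl))))
      (ap₁-cong pred (⊗-cong (den-+ q r) ≐-refl ⟫ ⊗-assoc _ _ _ ⟫ ⊗-cong ≐-refl (≐-sym (den-+ r s)))) ⟫ ≐-sym +ℚ-def)
    where
    e : ∀ x y z → H ⊩ (x ⊗ d[ r ] ⊕ y ⊗ d[ q ]) ⊗ d[ s ] ⊕ z ⊗ (d[ q ] ⊗ d[ r ]) ≐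
                      x ⊗ (d[ r ] ⊗ d[ s ]) ⊕ (y ⊗ d[ s ] ⊕ z ⊗ d[ r ]) ⊗ d[ q ]
    e x y z = let open Ring H in solve 6 (λ x y z d₁ d₂ d₃ →
      (x :* d₂ :+ y :* d₁) :* d₃ :+ z :* (d₁ :* d₂) := x :* (d₂ :* d₃) :+ (y :* d₃ :+ z :* d₂) :* d₁) ≐-refl
      x y z d[ q ] d[ r ] d[ s ]

  +ℚ-identityʳ : ∀ q → H ∣ q +ℚ 0ℚ ≃ q
  +ℚ-identityʳ {H = H} q = ≃-intro (⊕-cong (⊗-cong P ≐-refl) (⊗-cong ≐-refl D) ⟫ ≐-sym (⊕-cong (⊗-cong ≐-refl D) (⊗-cong N ≐-refl)))
    where
    one⊗ : ∀ {a b} → H ⊩ a ⊗ d[ 0ℚ ] ⊕ b ⊗ d[ q ] ≐ a ⊕ b ⊗ d[ q ]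
    one⊗ = ⊕-cong (⊗-cong ≐-refl (den-frac O<S) ⟫ ⊗-comm _ _ ⟫ ⊗-one _) ≐-refl
    P = pos-+ q 0ℚ ⟫ one⊗ ⟫ ⊕-cong ≐-refl (⊗-cong pos-frac ≐-refl ⟫ ⊗-O) ⟫ plus-zer
    N = neg-+ q 0ℚ ⟫ one⊗ ⟫ ⊕-cong ≐-refl (⊗-cong neg-frac ≐-refl ⟫ ⊗-O) ⟫ plus-zer
    D = den-+ q 0ℚ ⟫ ⊗-cong ≐-refl (den-frac O<S) ⟫ ⊗-comm _ _ ⟫ ⊗-one _

  -- The estimates ahead add rationals but never multiply them, so a solver for sums suffices.
  +ℚ-monoid : List (Fml Γ) → CommutativeMonoid 0ℓ 0ℓ
  +ℚ-monoid {Γ} H = record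
    { Carrier = Trm Γ 𝟎 ; _≈_ = λ q r → H ∣ q ≃ r ; _∙_ = λ q r → q +ℚ r ; ε = 0ℚ
    ; isCommutativeMonoid = record
      { isMonoid = record
        { isSemigroup = record
          { isMagma = record
            { isEquivalence = record { refl = ≤ℚ-refl , ≤ℚ-refl ; sym = ≃-sym ; trans = ≃-trans }
            ; ∙-cong = λ (l , m) (l′ , m′) → +ℚ-mono l l′ , +ℚ-mono m m′ }
          ; assoc = +ℚ-assoc }
        ; identity = (λ q → ≃-trans (+ℚ-comm 0ℚ q) (+ℚ-identityʳ q)) , +ℚ-identityʳ }
      ; comm = +ℚ-comm } }

  module Sum {Γ} (H : List (Fml Γ)) = Algebra.Solver.CommutativeMonoid (+ℚ-monoid H) renaming (_⊕_ to _:+_; _⊜_ to _:=_; id to :0)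

  -- Fourier–Motzkin steps: a sum of hypotheses x ≤ y yields a ≤ b as soon as a + y = b + x,
  -- which is left to the solver.
  ≤ℚ-by : H ⊩ q ≤ℚ r → H ∣ s +ℚ r ≃ t +ℚ q → H ⊩ s ≤ℚ t
  ≤ℚ-by {q = q} {r} {s} {t} l (e , _) = +ℚ-cancelʳ q (≤ℚ-trans (≤ℚ-trans (proj₁ (+ℚ-comm s q))
    (≤ℚ-trans (+ℚ-monoˡ s l) (proj₁ (+ℚ-comm r s)))) e)

  <ℚ-by : H ⊩ q <ℚ r → H ∣ s +ℚ r ≃ t +ℚ q → H ⊩ s <ℚ t
  <ℚ-by {q = q} {r} {s} {t} l (e , _) = +ℚ-cancelʳ-< q (<-≤ℚ-trans (≤-<ℚ-trans (proj₁ (+ℚ-comm s q))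
    (<-≤ℚ-trans (+ℚ-monoˡ-< s l) (proj₁ (+ℚ-comm r s)))) e)

  private
    -- The distance of natural numbers, in the form in which `abs-def` has it as a numerator: one of
    -- the two summands is always 0.
    gap : Trm Γ 𝟎 → Trm Γ 𝟎 → Trm Γ 𝟎
    gap a b = (a ∸ b) ⊕ (b ∸ a)

    ≤-gap : ∀ a b → H ⊩ a ≤ b ⊕ gap a b
    ≤-gap a b = ∨E (≤-total a b) (≤-trans h0 (≤-intro ≐-refl))
      (≤-trans (≤-reflexive (≤-elim h0)) (⊕-mono ≤-refl (≤-intro ≐-refl)))

    gap-comm : ∀ a b → H ⊩ gap a b ≐ gap b a
    gap-comm a b = ⊕-comm _ _

    gap-split : ∀ a b → H ⊩ a ≐ b ⊕ gap a b ∨ b ≐ a ⊕ gap a b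
    gap-split a b = ∨E (≤-total a b)
      (∨I₂ (≤-elim h0 ⟫ ⊕-cong ≐-refl (≐-sym (⊕-cong (≤E h0) ≐-refl ⟫ ⊕-O))))
      (∨I₁ (≤-elim h0 ⟫ ⊕-cong ≐-refl (≐-sym (⊕-cong ≐-refl (≤E h0) ⟫ plus-zer))))

    -- Over the common denominator `E`, the difference q - r has numerator U - V and its absolute
    -- value has numerator `M`. After multiplying out, the bound `s` on the absolute value and the
    -- inequalities `q ≤ℚ r +ℚ s` and `r ≤ℚ q +ℚ s` differ only in having `M`, `U` against `V`, or
    -- `V` against `U` as the quantity that is bounded.
    module AbsDiff {Γ} {H : List (Fml Γ)} (q r s : Trm Γ 𝟎) where
      U V M E : Trm Γ 𝟎
      U = p[ q ] ⊗ d[ r ] ⊕ n[ r ] ⊗ d[ q ]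
      V = n[ q ] ⊗ d[ r ] ⊕ p[ r ] ⊗ d[ q ]
      M = gap U V
      E = d[ q ] ⊗ d[ r ]

      abs-lhs : H ⊩ lhs ∣ q -ℚ r ∣ s ≐ M ⊗ d[ s ] ⊕ n[ s ] ⊗ E
      abs-lhs = ⊕-cong (⊗-cong (ap₁-cong pos abs-def ⟫ pos-frac ⟫ ⊕-cong (∸-cong (pos-minus q r) (neg-minus q r)) (∸-cong (neg-minus q r) (pos-minus q r))) ≐-refl)
        (⊗-cong ≐-refl (ap₁-cong den abs-def ⟫ den-frac (O<den _) ⟫ den-minus q r))

      abs-rhs : H ⊩ rhs ∣ q -ℚ r ∣ s ≐ p[ s ] ⊗ E
      abs-rhs = ⊕-cong (⊗-cong ≐-refl (ap₁-cong den abs-def ⟫ den-frac (O<den _) ⟫ den-minus q r))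
        (⊗-cong (ap₁-cong neg abs-def ⟫ neg-frac) ≐-refl ⟫ ⊗-O) ⟫ plus-zer

      sum-lhs : H ⊩ lhs q (r +ℚ s) ≐ U ⊗ d[ s ] ⊕ n[ s ] ⊗ E
      sum-lhs = ⊕-cong (⊗-cong ≐-refl (den-+ r s)) (⊗-cong (neg-+ r s) ≐-refl) ⟫
        (let open Ring H in solve 6 (λ p₁ d₁ n₂ d₂ n₃ d₃ →
          p₁ :* (d₂ :* d₃) :+ (n₂ :* d₃ :+ n₃ :* d₂) :* d₁ := (p₁ :* d₂ :+ n₂ :* d₁) :* d₃ :+ n₃ :* (d₁ :* d₂)) ≐-refl
          p[ q ] d[ q ] n[ r ] d[ r ] n[ s ] d[ s ])

      sum-rhs : H ⊩ rhs q (r +ℚ s) ≐ V ⊗ d[ s ] ⊕ p[ s ] ⊗ E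
      sum-rhs = ⊕-cong (⊗-cong (pos-+ r s) ≐-refl) (⊗-cong ≐-refl (den-+ r s)) ⟫
        (let open Ring H in solve 6 (λ n₁ d₁ p₂ d₂ p₃ d₃ →
          (p₂ :* d₃ :+ p₃ :* d₂) :* d₁ :+ n₁ :* (d₂ :* d₃) := (n₁ :* d₂ :+ p₂ :* d₁) :* d₃ :+ p₃ :* (d₁ :* d₂)) ≐-refl
          n[ q ] d[ q ] p[ r ] d[ r ] p[ s ] d[ s ])

      sum-lhs′ : H ⊩ lhs r (q +ℚ s) ≐ V ⊗ d[ s ] ⊕ n[ s ] ⊗ E
      sum-lhs′ = ⊕-cong (⊗-cong ≐-refl (den-+ q s)) (⊗-cong (neg-+ q s) ≐-refl) ⟫
        (let open Ring H in solve 6 (λ n₁ d₁ p₂ d₂ n₃ d₃ →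
          p₂ :* (d₁ :* d₃) :+ (n₁ :* d₃ :+ n₃ :* d₁) :* d₂ := (n₁ :* d₂ :+ p₂ :* d₁) :* d₃ :+ n₃ :* (d₁ :* d₂)) ≐-refl
          n[ q ] d[ q ] p[ r ] d[ r ] n[ s ] d[ s ])

      sum-rhs′ : H ⊩ rhs r (q +ℚ s) ≐ U ⊗ d[ s ] ⊕ p[ s ] ⊗ E
      sum-rhs′ = ⊕-cong (⊗-cong (pos-+ q s) ≐-refl) (⊗-cong ≐-refl (den-+ q s)) ⟫
        (let open Ring H in solve 6 (λ p₁ d₁ n₂ d₂ p₃ d₃ →
          (p₁ :* d₃ :+ p₃ :* d₁) :* d₂ :+ n₂ :* (d₁ :* d₃) := (p₁ :* d₂ :+ n₂ :* d₁) :* d₃ :+ p₃ :* (d₁ :* d₂)) ≐-refl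
          p[ q ] d[ q ] n[ r ] d[ r ] p[ s ] d[ s ])

      -- U ≤ V + M turns a bound on M into one on U, and conversely if U = V + M.
      push : ∀ {x y} → H ⊩ x ≤ y ⊕ M → ∀ {k l} → H ⊩ M ⊗ d[ s ] ⊕ k ≤ l → H ⊩ x ⊗ d[ s ] ⊕ k ≤ y ⊗ d[ s ] ⊕ l
      push {x} {y} e {k} {l} m = ≤-trans (⊕-mono (≤-resp (⊗-comm _ _) (⊗-comm _ _) (⊗-monoʳ d[ s ] e)) ≤-refl)
        (≤-resp (≐-sym (⊕-cong (⊗-distribʳ _ _ _) ≐-refl ⟫ ⊕-assoc _ _ _)) ≐-refl (⊕-mono ≤-refl m))

      pull : ∀ {x y} → H ⊩ x ≐ y ⊕ M → ∀ {k l} → H ⊩ x ⊗ d[ s ] ⊕ k ≤ y ⊗ d[ s ] ⊕ l → H ⊩ M ⊗ d[ s ] ⊕ k ≤ l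
      pull {x} {y} e {k} {l} m = ≤-by (≤-resp (⊕-cong (⊗-cong e ≐-refl) ≐-refl) ≐-refl m)
        (let open Ring H in solve 5 (λ m d k y l → m :* d :+ k :+ (y :* d :+ l) := l :+ ((y :+ m) :* d :+ k)) ≐-refl M d[ s ] k y l)

    module _ {Γ} {H : List (Fml Γ)} (q r s : Trm Γ 𝟎) where
      open AbsDiff {H = H} q r s
      absE : H ⊩ ∣ q -ℚ r ∣ ≤ℚ s → (H ⊩ q ≤ℚ r +ℚ s) × (H ⊩ r ≤ℚ q +ℚ s)
      absE l = ≤ℚI (≤-resp (≐-sym sum-lhs) (≐-sym sum-rhs) (push (≤-gap U V) l′)) ,
               ≤ℚI (≤-resp (≐-sym sum-lhs′) (≐-sym sum-rhs′) (push (≤-trans (≤-gap V U) (⊕-mono ≤-refl (≤-reflexive (gap-comm V U)))) l′))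
        where l′ = ≤-resp abs-lhs abs-rhs (≤ℚE l)

      absE< : H ⊩ ∣ q -ℚ r ∣ <ℚ s → (H ⊩ q <ℚ r +ℚ s) × (H ⊩ r <ℚ q +ℚ s)
      absE< l = <ℚI (≤-resp (plus-suc ⟫ S-cong (≐-sym sum-lhs)) (≐-sym sum-rhs) (push (≤-gap U V) l′)) ,
                <ℚI (≤-resp (plus-suc ⟫ S-cong (≐-sym sum-lhs′)) (≐-sym sum-rhs′) (push (≤-trans (≤-gap V U) (⊕-mono ≤-refl (≤-reflexive (gap-comm V U)))) l′))
        where l′ = ≤-resp (S-cong abs-lhs ⟫ ≐-sym plus-suc) abs-rhs (<ℚE l)

  abs-≤ : H ⊩ q ≤ℚ r +ℚ s → H ⊩ r ≤ℚ q +ℚ s → H ⊩ ∣ q -ℚ r ∣ ≤ℚ s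
  abs-≤ {q = q} {r} {s} l m = ≤ℚI (≤-resp (≐-sym abs-lhs) (≐-sym abs-rhs) (∨E (gap-split U V)
    (AbsDiff.pull q r s h0 ((≤-resp sum-lhs sum-rhs (≤ℚE l)) ↑))
    (AbsDiff.pull q r s h0 ((≤-resp sum-lhs′ sum-rhs′ (≤ℚE m)) ↑))))
    where open AbsDiff q r s

  abs-< : H ⊩ q <ℚ r +ℚ s → H ⊩ r <ℚ q +ℚ s → H ⊩ ∣ q -ℚ r ∣ <ℚ s
  abs-< {q = q} {r} {s} l m = <ℚI (≤-resp (plus-suc ⟫ S-cong (≐-sym abs-lhs)) (≐-sym abs-rhs) (∨E (gap-split U V)
    (AbsDiff.pull q r s h0 ((≤-resp (S-cong sum-lhs ⟫ ≐-sym plus-suc) sum-rhs (<ℚE l)) ↑))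
    (AbsDiff.pull q r s h0 ((≤-resp (S-cong sum-lhs′ ⟫ ≐-sym plus-suc) sum-rhs′ (<ℚE m)) ↑))))
    where open AbsDiff q r s

  abs-≤ˡ : H ⊩ ∣ q -ℚ r ∣ ≤ℚ s → H ⊩ q ≤ℚ r +ℚ s
  abs-≤ˡ l = proj₁ (absE _ _ _ l)
  abs-≤ʳ : H ⊩ ∣ q -ℚ r ∣ ≤ℚ s → H ⊩ r ≤ℚ q +ℚ s
  abs-≤ʳ l = proj₂ (absE _ _ _ l)
  abs-<ˡ : H ⊩ ∣ q -ℚ r ∣ <ℚ s → H ⊩ q <ℚ r +ℚ s
  abs-<ˡ l = proj₁ (absE< _ _ _ l)
  abs-<ʳ : H ⊩ ∣ q -ℚ r ∣ <ℚ s → H ⊩ r <ℚ q +ℚ s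
  abs-<ʳ l = proj₂ (absE< _ _ _ l)

  n<2^n : ∀ n → H ⊩ n < 2^ n
  n<2^n n = inst {As = []} (∀E (induction (v0 < 2^ v0) tt (≤-reflexive (≐-sym pow-zer))
    (≤-resp ≐-refl (≐-sym pow-suc) (≤-resp (S-cong (≐-sym S-⊕)) ≐-refl
      (<-≤-mono h0 (≤-trans O<S h0))))) v0) (n ◂ ε) []

  O<2^ : ∀ n → H ⊩ O < 2^ n
  O<2^ n = ≤-trans O<S (n<2^n n)

  2^-mono : H ⊩ a ≤ b → H ⊩ 2^ a ≤ 2^ b
  2^-mono {a = a} {b} l = ≤-resp ≐-refl (ap₁-cong pow (≐-sym (≤-elim l)))
    (inst {As = []} (∀E (induction (2^ v2 ≤ 2^ (v2 ⊕ v0)) tt (≤-reflexive (ap₁-cong pow (≐-sym plus-zer)))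
      (≤-trans h0 (≤-intro (ap₁-cong pow plus-suc ⟫ pow-suc)))) v0) (b ∸ a ◂ a ◂ ε) [])

  pos-2^- : ∀ n → H ⊩ p[ 2^- n ] ≐ one
  pos-2^- n = ap₁-cong pos inv-def ⟫ pos-frac
  neg-2^- : ∀ n → H ⊩ n[ 2^- n ] ≐ O
  neg-2^- n = ap₁-cong neg inv-def ⟫ neg-frac
  den-2^- : ∀ n → H ⊩ d[ 2^- n ] ≐ 2^ n
  den-2^- n = ap₁-cong den inv-def ⟫ den-frac (O<2^ n)

  2^-antitone : H ⊩ a ≤ b → H ⊩ 2^- b ≤ℚ 2^- a
  2^-antitone {a = a} {b} l = ≤ℚI (≤-resp
    (≐-sym (⊕-cong (⊗-cong (pos-2^- b) (den-2^- a) ⟫ ⊗-one _) (⊗-cong (neg-2^- a) ≐-refl ⟫ ⊗-O) ⟫ plus-zer))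
    (≐-sym (⊕-cong (⊗-cong (pos-2^- a) (den-2^- b) ⟫ ⊗-one _) (⊗-cong (neg-2^- b) ≐-refl ⟫ ⊗-O) ⟫ plus-zer))
    (2^-mono l))

  O<2^- : ∀ n → H ⊩ 0ℚ <ℚ 2^- n
  O<2^- n = <ℚI (≤-resp
    (S-cong (≐-sym (⊕-cong (⊗-cong pos-frac ≐-refl ⟫ ⊗-O) (⊗-cong (neg-2^- n) ≐-refl ⟫ ⊗-O) ⟫ plus-zer)))
    (≐-sym (⊕-cong (⊗-cong (pos-2^- n) (den-frac O<S) ⟫ ⊗-one _) (⊗-cong neg-frac ≐-refl ⟫ ⊗-O) ⟫ plus-zer)) ≤-refl)

  2^-halves : ∀ n → H ∣ 2^- n ≃ 2^- (S′ n) +ℚ 2^- (S′ n)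
  2^-halves {H = H} n = ≃-intro (
    ⊕-cong (⊗-cong (pos-2^- n) D) (⊗-cong (neg-+ m m ⟫ ⊕-cong Z Z ⟫ plus-zer) ≐-refl ⟫ ⊗-O) ⟫ plus-zer ⟫ ⊗-one _ ⟫
    ≐-sym (⊕-cong (⊗-cong (pos-+ m m ⟫ ⊕-cong P P) (den-2^- n)) (⊗-cong (neg-2^- n) ≐-refl ⟫ ⊗-O) ⟫ plus-zer ⟫
      ⊗-cong ≐-refl (≐-refl) ⟫ e))
    where
    m = 2^- (S′ n)
    Z = ⊗-cong (neg-2^- (S′ n)) ≐-refl ⟫ ⊗-O
    P = ⊗-cong (pos-2^- (S′ n)) (den-2^- (S′ n) ⟫ pow-suc) ⟫ ⊗-one _
    D = den-+ m m ⟫ ⊗-cong (den-2^- (S′ n) ⟫ pow-suc) (den-2^- (S′ n) ⟫ pow-suc)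
    e : H ⊩ (2^ n ⊕ 2^ n ⊕ (2^ n ⊕ 2^ n)) ⊗ 2^ n ≐ (2^ n ⊕ 2^ n) ⊗ (2^ n ⊕ 2^ n)
    e = let open Ring H in solve 1 (λ x → (x :+ x :+ (x :+ x)) :* x := (x :+ x) :* (x :+ x)) ≐-refl (2^ n)

  -- The difference of two fractions is at least one over the product of the denominators.
  archimedean : ∀ k → H ⊩ d[ q ] ⊗ d[ r ] ≤ k → H ⊩ q <ℚ r → H ⊩ q +ℚ 2^- k ≤ℚ r
  archimedean {H = H} {q} {r} k m l = ≤ℚI (≤-resp
    (≐-sym (⊕-cong (⊗-cong (pos-+ q (2^- k) ⟫ ⊕-cong (⊗-cong ≐-refl (den-2^- k)) (⊗-cong (pos-2^- k) ≐-refl ⟫ ⊗-one _)) ≐-refl)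
       (⊗-cong ≐-refl (den-+ q (2^- k) ⟫ ⊗-cong ≐-refl (den-2^- k))) ⟫
       (let open Ring H in solve 5 (λ p₁ d₁ n₂ d₂ x → (p₁ :* x :+ d₁) :* d₂ :+ n₂ :* (d₁ :* x) :=
         x :* (p₁ :* d₂ :+ n₂ :* d₁) :+ d₁ :* d₂) ≐-refl p[ q ] d[ q ] n[ r ] d[ r ] (2^ k))))
    (≐-sym (⊕-cong (⊗-cong ≐-refl (den-+ q (2^- k) ⟫ ⊗-cong ≐-refl (den-2^- k)))
       (⊗-cong (neg-+ q (2^- k) ⟫ ⊕-cong (⊗-cong ≐-refl (den-2^- k)) (⊗-cong (neg-2^- k) ≐-refl ⟫ ⊗-O) ⟫ plus-zer) ≐-refl) ⟫
       (let open Ring H in solve 5 (λ n₁ d₁ p₂ d₂ x → p₂ :* (d₁ :* x) :+ (n₁ :* x) :* d₂ :=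
         x :* (p₂ :* d₁ :+ n₁ :* d₂)) ≐-refl n[ q ] d[ q ] p[ r ] d[ r ] (2^ k))))
    (≤-trans (⊕-mono (≤-refl {a = 2^ k ⊗ lhs q r}) (≤-trans m (<⇒≤ (n<2^n k))))
      (≤-trans (≤-reflexive (≐-sym times-suc)) (⊗-monoʳ (2^ k) (<ℚE l)))))

-- The equivalence of (∃²) and Π⁰₁-TRANS.

module Transfer where

  open D using (Ty; 𝟎; 𝟏; 𝟐; _⟶_; _⋆; Ctx; Const)
  open Const
  open Calculus
  open Arithmetic
  open Formulas

  private variable
    H : List (Fml Γ)
    a b : Trm Γ 𝟎

  -- Feferman's search operator, with some zero in place of the least one.
  searches : Fml (𝟐 ∷ Γ)
  searches = ∀′ 𝟏 (∀′ 𝟎 (v1 · v0 ≐ O ⊃ v1 · (v2 · v1) ≐ O))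

  ∃²⇒search : H ⊩ ∃² → H ⊩ ∃′ 𝟐 searches
  ∃²⇒search d = ∃E d (∃E
    -- The matrix is quantifier-free because the functional has decided the existence of a zero; if
    -- there is none, the premise fails and 0 will do as a value.
    (choice (v2 · v1 ≐ O ⊃ v1 · v0 ≐ O) (tt , tt)
      (∀I (∨E (em {A = v1 · v0 ≐ O})
        (∃E (⊃E (∧E₂ (∀E h1 v0)) h0) (∃I v0 (⊃I h1)))
        (∃I O (⊃I (absurd (⊃E h1 h0)))))))
    (∃I v0 (∀I (∀I (⊃I (⊃E (∀E h1 v1) (⊃E (∧E₁ (∀E h2 v1)) (∃I v0 h0))))))))

  -- If no standard functional satisfied `searches`, then transfer, applied to the negation, would
  -- exclude all functionals. The negation is internal and has the functional as its only free
  -- variable.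
  search⇒ˢᵗ : {H : List (Fml [])} → H ⊩ ∃′ 𝟐 searches → H ⊩ ∃ˢᵗ 𝟐 searches
  search⇒ˢᵗ d = raa (∃E (d ↑) (⊃E (∀E (PF-TP (¬′ searches) (( tt , tt) , tt)
    (∀I (⊃I (⊃I (⊃E h3 (∃I v0 (∧I h1 h0))))))) v0) h0))

  -- Exchanges zeros and non-zero values, so that a counterexample to a function's vanishing
  -- everywhere becomes something to search for.
  complement : Trm Γ (𝟏 ⟶ 𝟏)
  complement = comb (𝟎 ∷ 𝟏 ∷ []) (one ∸ v1 · v0)

  β-complement : (f : Trm Γ 𝟏) (n : Trm Γ 𝟎) → H ⊩ complement · f · n ≐ one ∸ f · n
  β-complement f n = β (one ∸ v1 · v0) (n ◂ f ◂ ε)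

  ∃²⇒TRANS : {H : List (Fml [])} → H ⊩ ∃² → H ⊩ TRANS
  ∃²⇒TRANS d = ∃E (search⇒ˢᵗ (∃²⇒search d)) (∀I (⊃I (⊃I (∀I (raa (have g-root
    (suc≢zer (≐-sym (∸-cong ≐-refl (⊃E (∀E h2 witness) st-witness) ⟫ monus-zer) ⟫ h0))))))))
    where
    witness : Trm (𝟎 ∷ 𝟏 ∷ 𝟐 ∷ []) 𝟎
    witness = v2 · (complement · v1)
    g-root : _ ⊩ one ∸ v1 · witness ≐ O
    g-root = ≐-sym (β-complement v1 witness) ⟫ ⊃E (∀E (∀E (∧E₂ h3) (complement · v1)) v0)
      (β-complement v1 v0 ⟫ ∸-cong ≐-refl (≢O h0) ⟫ S-∸-S _ _ ⟫ O-∸ _)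
    st-witness : _ ⊩ st witness
    st-witness = st-tm (v1 · (complement · v0)) (v1 ◂ v2 ◂ ε)
      (λ { (here refl) → h3 ; (there (here refl)) → ∧E₁ h4 })

  complement-O : (f : Trm Γ 𝟏) (n : Trm Γ 𝟎) → H ⊩ ¬′ (f · n ≐ O) → H ⊩ complement · f · n ≐ O
  complement-O f n d = β-complement f n ⟫ ∸-cong ≐-refl (≢O d) ⟫ S-∸-S _ _ ⟫ O-∸ _

  complement-O⁻ : (f : Trm Γ 𝟏) (n : Trm Γ 𝟎) → H ⊩ complement · f · n ≐ O → H ⊩ f · n ≐ O → H ⊩ ⊥′
  complement-O⁻ f n d e = suc≢zer (≐-sym (β-complement f n ⟫ ∸-cong ≐-refl e ⟫ monus-zer) ⟫ d)

  st-complement : {f : Trm Γ 𝟏} → H ⊩ st f → H ⊩ st (complement · f)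
  st-complement {f = f} d = st-tm (complement · v0) (f ◂ ε) (λ { (here refl) → d })

  -- The contrapositive of Π⁰₁-TRANS for `complement · f`, which is standard along with `f`.
  TRANS-∃ : (f : Trm Γ 𝟏) → H ⊩ TRANS → H ⊩ st f → H ⊩ ∃′ 𝟎 (wk f · v0 ≐ O) → H ⊩ ∃ˢᵗ 𝟎 (wk f · v0 ≐ O)
  TRANS-∃ f d e m = inst {As = TRANS ∷ st v0 ∷ ∃′ 𝟎 (v1 · v0 ≐ O) ∷ []} {∃ˢᵗ 𝟎 (v1 · v0 ≐ O)}
    (raa (∃E h3 (complement-O⁻ v1 v0
      (∀E (⊃E (⊃E (∀E h2 (complement · v1)) (st-complement h3))
        (∀I (⊃I (complement-O v2 v0 (⊃I (⊃E h3 (∃I v0 (∧I h1 h0)))))))) v0) h0)))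
    (f ◂ ε) (d ∷ e ∷ m ∷ [])

  -- The specification of `Ξ` bounds the values by 1, which makes them unique; a functional that is
  -- to agree with `Ξ` must therefore have the values 0 and 1.
  sg : Trm Γ 𝟎 → Trm Γ 𝟎
  sg a = one ∸ (one ∸ a)

  sg-O : H ⊩ a ≐ O → H ⊩ sg a ≐ O
  sg-O e = ∸-cong ≐-refl (∸-cong ≐-refl e ⟫ monus-zer) ⟫ ∸-self one

  sg-O⁻ : H ⊩ sg a ≐ O → H ⊩ a ≐ O
  sg-O⁻ {a = a} e = raa (suc≢zer (≐-sym monus-zer ⟫ ∸-cong ≐-refl (≐-sym (∸-cong ≐-refl (≢O h0) ⟫ S-∸-S _ _ ⟫ O-∸ _)) ⟫ (e ↑)))

  sg-≤ : H ⊩ sg a ≤ one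
  sg-≤ {a = a} = ∨E (zero-or-suc (one ∸ a)) (≤-reflexive (∸-cong ≐-refl h0 ⟫ monus-zer))
    (≤-trans (≤-reflexive (∸-cong ≐-refl h0 ⟫ S-∸-S _ _ ⟫ O-∸ _)) O≤)

  product-step : Trm Γ (𝟎 ⋆ ⟶ 𝟏 ⟶ 𝟎 ⟶ 𝟎 ⟶ 𝟎)
  product-step = comb (𝟎 ∷ 𝟎 ∷ 𝟏 ∷ 𝟎 ⋆ ∷ []) (v1 ⊗ v2 · (con at · v3 · v0))

  -- A product of values serves as a bounded existential quantifier: it vanishes as soon as `f`
  -- vanishes at one of the first `k` entries of `s`.
  product : Trm Γ (𝟎 ⋆) → Trm Γ 𝟏 → Trm Γ 𝟎 → Trm Γ 𝟎
  product s f k = con R₀ · k · one · (product-step · s · f)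

  product-suc : (s : Trm Γ (𝟎 ⋆)) (f : Trm Γ 𝟏) (k : Trm Γ 𝟎) →
                H ⊩ product s f (S′ k) ≐ product s f k ⊗ f · (con at · s · k)
  product-suc s f k = R₀-suc ⟫ β (v1 ⊗ v2 · (con at · v3 · v0)) (k ◂ product s f k ◂ f ◂ s ◂ ε)

  product-O : (s : Trm Γ (𝟎 ⋆)) (f : Trm Γ 𝟏) (i k : Trm Γ 𝟎) →
              H ⊩ i < k → H ⊩ f · (con at · s · i) ≐ O → H ⊩ product s f k ≐ O
  product-O s f i k d e = ⊃E (inst {As = v2 · (con at · v3 · v1) ≐ O ∷ []}
    (∀E (induction (v2 < v0 ⊃ product v4 v3 v0 ≐ O) (tt , tt)
      (⊃I (absurd (<-irrefl (≤-trans h0 O≤))))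
      (⊃I (product-suc v4 v3 v0 ⟫ ∨E (<-or-≥ v2 v0) (⊗-cong (⊃E h2 h0) ≐-refl ⟫ ⊗-O)
        (⊗-cong ≐-refl (·-cong ≐-refl (·-cong ≐-refl (≤-antisym h0 (≤I (≐-sym (S-∸-S _ _) ⟫ ≤E h1)))) ⟫ h3) ⟫ times-zer)))) v0)
    (k ◂ i ◂ f ◂ s ◂ ε) (e ∷ [])) d

  product-≢O : (s : Trm Γ (𝟎 ⋆)) (f : Trm Γ 𝟏) (k : Trm Γ 𝟎) →
               H ⊩ ∀′ 𝟎 (¬′ (wk f · v0 ≐ O)) → H ⊩ ¬′ (product s f k ≐ O)
  product-≢O s f k d = inst {As = ∀′ 𝟎 (¬′ (v2 · v0 ≐ O)) ∷ []}
    (∀E (induction (¬′ (product v3 v2 v0 ≐ O)) (tt , tt)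
      (⊃I (suc≢zer (≐-sym R₀-zer ⟫ h0)))
      (⊃I (<-irrefl (≤-resp ≐-refl (≐-sym (product-suc v3 v2 v0) ⟫ h0)
        (O<⊗ (positive h1) (positive (∀E h2 _))))))) v0)
    (k ◂ f ◂ s ◂ ε) (d ∷ [])
    where
    open Rationals using (O<⊗; O<S)
    positive : H ⊩ ¬′ (a ≐ O) → H ⊩ O < a
    positive n = ≤-resp ≐-refl (≐-sym (≢O n)) O<S

  some-root : Trm Γ ((𝟏 ⟶ 𝟎 ⋆) ⟶ 𝟐)
  some-root = comb (𝟏 ∷ (𝟏 ⟶ 𝟎 ⋆) ∷ []) (sg (product (v1 · v0) v0 (con len · (v1 · v0))))

  β-some-root : (Φ : Trm Γ (𝟏 ⟶ 𝟎 ⋆)) (f : Trm Γ 𝟏) →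
                H ⊩ some-root · Φ · f ≐ sg (product (Φ · f) f (con len · (Φ · f)))
  β-some-root Φ f = β (sg (product (v1 · v0) v0 (con len · (v1 · v0)))) (f ◂ Φ ◂ ε)

  st-O : H ⊩ st (con {Γ} zer)
  st-O = st-tm O ε (λ ())

  private
    -- The second disjunct gives functions without zeros a witness too, as HAC-int demands one for
    -- every standard function. Under Π⁰₁-TRANS a standard function without standard zeros satisfies
    -- it, with 0 as the standard witness.
    root-or-not : Fml (𝟎 ∷ 𝟏 ∷ Γ)
    root-or-not = v1 · v0 ≐ O ∨ ∀′ 𝟎 (¬′ (v2 · v0 ≐ O))

    candidates decided agrees : Fml ((𝟏 ⟶ 𝟎 ⋆) ∷ Γ)
    candidates = ∀ˢᵗ 𝟏 (∃′ 𝟎 (∃′ 𝟎 (v0 < con len · (v3 · v2) ∧ v1 ≐ con at · (v3 · v2) · v0) ∧ root-or-not))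
    decided = ∀ˢᵗ 𝟏 ((∃ˢᵗ 𝟎 (v1 · v0 ≐ O) ⇔ some-root · v1 · v0 ≐ O) ∧ some-root · v1 · v0 ≤ one)
    agrees = ∀ˢᵗ 𝟏 (Ξ · v0 ≐ some-root · v1 · v0)

    st-candidates : H ⊩ TRANS → H ⊩ ∃ˢᵗ (𝟏 ⟶ 𝟎 ⋆) candidates
    st-candidates d = HAC-int root-or-not (tt , tt , tt) (have d (∀I (⊃I (∨E (em {A = ∃ˢᵗ 𝟎 (v1 · v0 ≐ O)})
      (∃E h0 (∃I v0 (∧I (∧E₁ h0) (∨I₁ (∧E₂ h0)))))
      (∃I O (∧I st-O (∨I₂ (∀I (⊃I (⊃E h1 (TRANS-∃ v1 h3 h2 (∃I v0 h0))))))))))))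

    candidates⇒decided : TRANS ∷ candidates ∷ H ⊩ decided
    candidates⇒decided = ∀I (⊃I (∧I (∧I
      -- A zero of the function refutes the second disjunct of `root-or-not`, so the listed
      -- candidate is a zero as well.
      (⊃I (∃E h0 (∃E (⊃E (∀E h4 v1) h2) (∃E (∧E₁ h0) (β-some-root v4 v3 ⟫ sg-O (product-O (v4 · v3) v3 v0 (con len · (v4 · v3))
        (∧E₁ h0) (·-cong ≐-refl (≐-sym (∧E₂ h0)) ⟫ ∨E (∧E₂ h1) h0 (absurd (⊃E (∀E h0 v2) (∧E₂ h3))))))))))
      -- A vanishing product only refutes that there are no zeros at all; a standard zero is then
      -- supplied by `TRANS-∃`.
      (⊃I (TRANS-∃ v0 h2 h1 (raa (⊃E
        (product-≢O (v1 · v0) v0 (con len · (v1 · v0)) (∀I (⊃I (⊃E h1 (∃I v0 h0)))))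
        (sg-O⁻ (≐-sym (β-some-root v1 v0) ⟫ h1)))))))
      (≤-resp (≐-sym (β-some-root v1 v0)) ≐-refl sg-≤)))

  TRANS⇒∃² : {H : List (Fml [])} → H ⊩ TRANS → H ⊩ ∃²
  TRANS⇒∃² d = have d (∃E (st-candidates h0)
    (have {A = decided} (entail (candidates⇒decided {H = []}) (h1 ∷ ∧E₂ h0 ∷ []))
    (have {A = agrees} (⊃E (⊃E (∀E Ξ-ax (some-root · v0)) (st-tm (some-root · v0) (v0 ◂ ε) (λ { (here refl) → ∧E₁ h1 }))) h0)
    -- The transferred formula mentions `Ξ` alone, as `some-root` with its choice functional is
    -- eliminated through `agrees`. Its existential quantifier is over all numbers, and `TRANS-∃`
    -- passes from these to the standard ones.
    (∃I Ξ (PF-TP (∃′ 𝟎 (v1 · v0 ≐ O) ⇔ Ξ · v0 ≐ O) ((tt , tt) , (tt , tt)) (∀I (⊃I (∧I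
      (⊃I (⊃E (∀E h2 v0) h1 ⟫ ⊃E (∧E₁ (∧E₁ (⊃E (∀E h3 v0) h1))) (TRANS-∃ v0 h5 h1 h0)))
      (⊃I (∃E (⊃E (∧E₂ (∧E₁ (⊃E (∀E h3 v0) h1))) (≐-sym (⊃E (∀E h2 v0) h1) ⟫ h0)) (∃I v0 (∧E₂ h0))))))))))))

-- From IVT* to Π⁰₁-TRANS.

module Constant where

  open D using (Ty; 𝟎; 𝟏; 𝟐; _⟶_; _⋆; Ctx; Const)
  open Const
  open Calculus
  open Arithmetic
  open Rationals
  open Formulas
  open Transfer

  private variable
    H : List (Fml Γ)
    a b k n q r s t : Trm Γ 𝟎

  ≤ℚ-+ : H ⊩ 0ℚ ≤ℚ s → H ⊩ q ≤ℚ q +ℚ s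
  ≤ℚ-+ {H = H} {s = s} {q} l = ≤ℚ-by l (let open Sum H in solve 2 (λ q s → q :+ s := (q :+ s) :+ :0) (≤ℚ-refl , ≤ℚ-refl) q s)

  <ℚ-+ : H ⊩ 0ℚ <ℚ s → H ⊩ q <ℚ q +ℚ s
  <ℚ-+ {H = H} {s = s} {q} l = <ℚ-by l (let open Sum H in solve 2 (λ q s → q :+ s := (q :+ s) :+ :0) (≤ℚ-refl , ≤ℚ-refl) q s)

  ≤ℚ-dist : H ⊩ q ≐ r → H ⊩ 0ℚ ≤ℚ s → H ⊩ ∣ q -ℚ r ∣ ≤ℚ s
  ≤ℚ-dist e l = abs-≤ (≤ℚ-trans (proj₁ (≐⇒≃ e)) (≤ℚ-+ l)) (≤ℚ-trans (proj₂ (≐⇒≃ e)) (≤ℚ-+ l))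

  <ℚ-dist : H ⊩ q ≐ r → H ⊩ 0ℚ <ℚ s → H ⊩ ∣ q -ℚ r ∣ <ℚ s
  <ℚ-dist e l = abs-< (≤-<ℚ-trans (proj₁ (≐⇒≃ e)) (<ℚ-+ l)) (≤-<ℚ-trans (proj₂ (≐⇒≃ e)) (<ℚ-+ l))

  -- At index k + 2 the two error terms add up to 2^-(k+1), which leaves the other half of 2^-k for
  -- the distance itself.
  near-intro : H ⊩ q <ℚ 2^- (S′ k) → H ⊩ q +ℚ (2^- (S′ (S′ k)) +ℚ 2^- (S′ (S′ k))) <ℚ 2^- k
  near-intro {k = k} l = <-≤ℚ-trans (+ℚ-mono-<≤ l (proj₂ (2^-halves (S′ k)))) (proj₂ (2^-halves k))

  O≤2^-+2^- : ∀ n → H ⊩ 0ℚ ≤ℚ 2^- n +ℚ 2^- n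
  O≤2^-+2^- n = ≤ℚ-trans (<ℚ⇒≤ℚ (O<2^- n)) (≤ℚ-+ (<ℚ⇒≤ℚ (O<2^- n)))

  2^-≤1 : ∀ n → H ⊩ 2^- n ≤ℚ 1ℚ
  2^-≤1 n = ≤ℚ-resp ≐-refl (inv-def ⟫ ap₂-cong pair ≐-refl (ap₁-cong pred pow-zer)) (2^-antitone O≤)

  nat≤1 : H ⊩ frac a O one ≤ℚ 0ℚ +ℚ 1ℚ → H ⊩ a ≤ one
  nat≤1 {a = a} l = ≤-resp
    (⊕-cong (⊗-cong pos-frac (den-frac O<S)) (⊗-cong neg-frac ≐-refl) ⟫ ⊕-cong (⊗-comm _ _ ⟫ ⊗-one _) ⊗-O ⟫ plus-zer)
    (⊕-cong (⊗-cong pos-frac (den-frac O<S)) (⊗-cong neg-frac ≐-refl) ⟫ ⊕-cong (⊗-one _) ⊗-O ⟫ plus-zer)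
    (≤ℚE (≤ℚ-trans l (≤ℚ-trans (proj₁ (+ℚ-comm _ _)) (proj₁ (+ℚ-identityʳ _)))))

  double≤1 : H ⊩ a ⊕ a ≤ one → H ⊩ a ≐ O
  double≤1 {a = a} l = ∨E (zero-or-suc a) h0 (absurd (suc≢zer (≤-antisym {b = O}
    (≤I (≐-sym (S-∸-S _ O) ⟫ ≤E (≤-resp (⊕-cong h0 h0 ⟫ plus-suc ⟫ S-cong ⊕-S) ≐-refl (l ↑)))) O≤)))

  -- Equality with 0 bounds the value at index 0 only by 2^-0 = 1; the factor 2 is what excludes the
  -- value 1 of the given function.
  twice : Trm Γ (𝟏 ⟶ 𝟏)
  twice = comb (𝟎 ∷ 𝟏 ∷ []) (frac (v1 · v0 ⊕ v1 · v0) O one)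

  -- The constant function with value the "real" n ↦ 2 f(n), which vanishes on standard inputs.
  const : Trm Γ 𝟏 → Trm Γ (𝟏 ⟶ 𝟏)
  const f = con K · (twice · f)

  β-const : (f x : Trm Γ 𝟏) (n : Trm Γ 𝟎) → H ⊩ const f · x · n ≐ frac (f · n ⊕ f · n) O one
  β-const f x n = ≐-app K-red n ⟫ β (frac (v1 · v0 ⊕ v1 · v0) O one) (n ◂ f ◂ ε)

  vanishes : (f x : Trm Γ 𝟏) (n : Trm Γ 𝟎) → H ⊩ f · n ≐ O → H ⊩ const f · x · n ≐ 0ℚ
  vanishes f x n e = β-const f x n ⟫ ap₂-cong pair (ap₂-cong pair (⊕-cong e e ⟫ plus-zer) ≐-refl) ≐-refl

  equal-0ℚ : (f x y : Trm Γ 𝟏) (m n : Trm Γ 𝟎) → H ⊩ f · m ≐ O → H ⊩ f · n ≐ O → H ⊩ const f · x · m ≐ const f · y · n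
  equal-0ℚ f x y m n d e = vanishes f x m d ⟫ ≐-sym (vanishes f y n e)

  st-⊕ : H ⊩ st a → H ⊩ st b → H ⊩ st (a ⊕ b)
  st-⊕ {a = a} {b} d e = st-tm (v0 ⊕ v1) (a ◂ b ◂ ε) (λ { (here refl) → d ; (there (here refl)) → e })

  st-S : H ⊩ st a → H ⊩ st (S′ a)
  st-S {a = a} d = st-tm (S′ v0) (a ◂ ε) (λ { (here refl) → d })

  vanishing : List (Fml (𝟏 ∷ Γ))
  vanishing = ∀ˢᵗ 𝟎 (v1 · v0 ≐ O) ∷ []

  -- Relative to `std` only standard indices are inspected, and there the values are the rational 0
  -- itself. Seen from outside, the sequence need not even be Cauchy.
  const-real→real : vanishing {Γ} ⊩ real→real std (const v0)
  const-real→real = ∧I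
    (∀ᵣI $ ⊃I $ ∀ᵣI $ ∀ᵣI $ <ℚ-dist (equal-0ℚ v3 v2 v2 v1 (v1 ⊕ v0) (⊃E (∀E h4 v1) h1)
       (⊃E (∀E h4 (v1 ⊕ v0)) (st-⊕ h1 h0))) (O<2^- _))
    (∀ᵣI $ ⊃I $ ∀ᵣI $ ⊃I $ ⊃I $ ∀ᵣI $ ≤ℚ-dist
      (equal-0ℚ v3 v2 v1 v0 v0 (⊃E (∀E h6 v0) h0) (⊃E (∀E h6 v0) h0)) (<ℚ⇒≤ℚ (O<2^- _)))

  const-continuous : vanishing {Γ} ⊩ continuous std (const v0)
  const-continuous = ∀ᵣI $ ⊃I $ ∀ᵣI $ ∃ᵣI O st-O $ ∀ᵣI $ ⊃I $ ⊃I $ have (st-S (st-S h3)) $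
    ∃ᵣI (S′ (S′ v1)) h0 $ near-intro $ <ℚ-dist
      (have (⊃E (∀E h7 (S′ (S′ v1))) h0) (equal-0ℚ v3 v2 v0 (S′ (S′ v1)) (S′ (S′ v1)) h0 h0)) (O<2^- _)

  const-signs : vanishing {Γ} ⊩ con K · 0ℚ ≤ℝ const v0 · (con K · 0ℚ) [ std ] ∧
                const v0 · (con K · 1ℚ) ≤ℝ con K · 0ℚ [ std ]
  const-signs = ∧I
    (∀ᵣI ((≤ℚ-trans (proj₁ (≐⇒≃ (K-red ⟫ ≐-sym (vanishes v1 (con K · 0ℚ) v0 (⊃E (∀E h1 v0) h0))))) (≤ℚ-+ (O≤2^-+2^- _)))))
    (∀ᵣI ((≤ℚ-trans (proj₁ (≐⇒≃ (vanishes v1 (con K · 1ℚ) v0 (⊃E (∀E h1 v0) h0) ⟫ ≐-sym K-red))) (≤ℚ-+ (O≤2^-+2^- _)))))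

  IVT*⇒TRANS : H ⊩ IVT* → H ⊩ TRANS
  IVT*⇒TRANS d = have d $ ∀I $ ⊃I $ ⊃I $ ∃E
    (⊃E (⊃E (∀E h2 (const v0)) (st-tm (const v0) (v0 ◂ ε) (λ { (here refl) → h1 })))
      (entail (∧I (∧I const-real→real const-continuous) const-signs) (h0 ∷ [])))
    -- The equality in the conclusion of IVT* is internal, so 2 f(n) ≤ 2^-n ≤ 1 holds at every
    -- index, standard or not.
    (∀I $ double≤1 $ nat≤1 $ ≤ℚ-trans
      (≤ℚ-resp (β-const v2 v1 v0) (ap₂-cong plusℚ K-red ≐-refl) (abs-≤ˡ (∀E (∧E₂ (∧E₂ h0)) v0)))
      (+ℚ-mono ≤ℚ-refl (2^-≤1 _)))

-- From UIVT to (∃²) by Grilliot's trick.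

module Grilliot where

  open D using (Ty; 𝟎; 𝟏; 𝟐; _⟶_; _⋆; Ctx; Const)
  open Const
  open Calculus
  open Arithmetic
  open Rationals
  open Formulas
  open Transfer
  open Constant

  private variable
    H : List (Fml Γ)
    a b c k n q r s t u : Trm Γ 𝟎
    f g x y : Trm Γ 𝟏

  select : Trm Γ 𝟎 → Trm Γ 𝟎 → Trm Γ 𝟎 → Trm Γ 𝟎
  select c q r = con R₀ · c · q · (comb (𝟎 ∷ 𝟎 ∷ 𝟎 ∷ []) v2 · r)

  select-O : H ⊩ c ≐ O → H ⊩ select c q r ≐ q
  select-O e = ·-cong (·-cong (·-cong ≐-refl e) ≐-refl) ≐-refl ⟫ R₀-zer

  select-S : H ⊩ ¬′ (c ≐ O) → H ⊩ select c q r ≐ r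
  select-S {c = c} {q} {r} d = ·-cong (·-cong (·-cong ≐-refl (≢O d)) ≐-refl) ≐-refl ⟫ R₀-suc ⟫
    β v2 (ap₁ pred c ◂ select (ap₁ pred c) q r ◂ r ◂ ε)

  min : Trm Γ 𝟎 → Trm Γ 𝟎 → Trm Γ 𝟎
  min q r = select (lhs q r ∸ rhs q r) q r

  min-split : ∀ q r → H ⊩ (q ≤ℚ r ∧ min q r ≐ q) ∨ (r ≤ℚ q ∧ min q r ≐ r)
  min-split q r = ∨E (≤ℚ-or-> q r) (∨I₁ (∧I h0 (select-O (≤E (≤ℚE h0)))))
    (∨I₂ (∧I (<ℚ⇒≤ℚ h0) (select-S (⊃I (<ℚ-irrefl (<-≤ℚ-trans h1 (≤ℚI (≤I h0))))))))

  min-≤ˡ : H ⊩ min q r ≤ℚ q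
  min-≤ˡ {q = q} {r} = ∨E (min-split q r) (proj₁ (≐⇒≃ (∧E₂ h0))) (≤ℚ-trans (proj₁ (≐⇒≃ (∧E₂ h0))) (∧E₁ h0))

  min-≤ʳ : H ⊩ min q r ≤ℚ r
  min-≤ʳ {q = q} {r} = ∨E (min-split q r) (≤ℚ-trans (proj₁ (≐⇒≃ (∧E₂ h0))) (∧E₁ h0)) (proj₁ (≐⇒≃ (∧E₂ h0)))

  min-glb : H ⊩ s ≤ℚ q → H ⊩ s ≤ℚ r → H ⊩ s ≤ℚ min q r
  min-glb {q = q} {r} l m = ∨E (min-split q r) (≤ℚ-trans (l ↑) (proj₂ (≐⇒≃ (∧E₂ h0))))
    (≤ℚ-trans (m ↑) (proj₂ (≐⇒≃ (∧E₂ h0))))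

  min-lipschitz : H ⊩ 0ℚ ≤ℚ s → H ⊩ q ≤ℚ r +ℚ s → H ⊩ min q t ≤ℚ min r t +ℚ s
  min-lipschitz {s = s} {r = r} {t} p l = ∨E (min-split r t)
    (≤ℚ-trans (≤ℚ-trans min-≤ˡ (l ↑)) (+ℚ-monoˡ s (proj₂ (≐⇒≃ (∧E₂ h0)))))
    (≤ℚ-trans (≤ℚ-trans min-≤ʳ (≤ℚ-+ (p ↑))) (+ℚ-monoˡ s (proj₂ (≐⇒≃ (∧E₂ h0)))))

  O≤abs : H ⊩ 0ℚ ≤ℚ ∣ q ∣
  O≤abs = ≤ℚI (≤-resp (≐-sym (⊕-cong (⊗-cong pos-frac ≐-refl ⟫ ⊗-O) (⊗-cong (ap₁-cong neg abs-def ⟫ neg-frac) ≐-refl ⟫ ⊗-O) ⟫ plus-zer))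
    ≐-refl O≤)

  abs-lipschitz : H ⊩ ∣ q -ℚ r ∣ ≤ℚ s → H ⊩ ∣ q -ℚ t ∣ ≤ℚ ∣ r -ℚ t ∣ +ℚ s
  abs-lipschitz {H = H} {q} {r} {s} {t} l = abs-≤
    (≤ℚ-by (+ℚ-mono (abs-≤ˡ l) (abs-≤ˡ ≤ℚ-refl)) (let open Sum H in solve 5 (λ q r s t u →
      q :+ ((r :+ s) :+ (t :+ u)) := (t :+ (u :+ s)) :+ (q :+ r)) (≤ℚ-refl , ≤ℚ-refl) q r s t ∣ r -ℚ t ∣))
    (≤ℚ-by (+ℚ-mono (abs-≤ʳ l) (abs-≤ʳ ≤ℚ-refl)) (let open Sum H in solve 5 (λ q r s t u →
      t :+ ((q :+ s) :+ (r :+ u)) := (q :+ (u :+ s)) :+ (r :+ t)) (≤ℚ-refl , ≤ℚ-refl) q r s t ∣ r -ℚ t ∣))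

  minus-plus : ∀ q r → H ∣ (q -ℚ r) +ℚ r ≃ q
  minus-plus {H = H} q r = ≃-intro (
    ⊕-cong (⊗-cong (pos-+ (q -ℚ r) r ⟫ ⊕-cong (⊗-cong (pos-minus q r) ≐-refl) (⊗-cong ≐-refl (den-minus q r))) ≐-refl)
           (⊗-cong ≐-refl (den-+ (q -ℚ r) r ⟫ ⊗-cong (den-minus q r) ≐-refl)) ⟫
    (let open Ring H in solve 6 (λ p₁ n₁ d₁ p₂ n₂ d₂ →
      ((p₁ :* d₂ :+ n₂ :* d₁) :* d₂ :+ p₂ :* (d₁ :* d₂)) :* d₁ :+ n₁ :* ((d₁ :* d₂) :* d₂) :=
      p₁ :* ((d₁ :* d₂) :* d₂) :+ ((n₁ :* d₂ :+ p₂ :* d₁) :* d₂ :+ n₂ :* (d₁ :* d₂)) :* d₁) ≐-refl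
      p[ q ] n[ q ] d[ q ] p[ r ] n[ r ] d[ r ]) ⟫
    ≐-sym (⊕-cong (⊗-cong ≐-refl (den-+ (q -ℚ r) r ⟫ ⊗-cong (den-minus q r) ≐-refl))
      (⊗-cong (neg-+ (q -ℚ r) r ⟫ ⊕-cong (⊗-cong (neg-minus q r) ≐-refl) (⊗-cong ≐-refl (den-minus q r))) ≐-refl)))

  data Side : Set where
    left right : Side

  end : Side → Trm Γ 𝟎
  end left  = 0ℚ
  end right = 1ℚ

  -- The sign is chosen to respect the boundary conditions: minus the distance from 0 is 0 at the
  -- left end and negative at the right one, plus the distance from 1 is positive at the left end
  -- and 0 at the right one.
  signed : Side → Trm Γ 𝟎 → Trm Γ 𝟎
  signed left  q = 0ℚ -ℚ q
  signed right q = q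

  signed-lipschitz : ∀ i → H ⊩ q ≤ℚ r +ℚ s → H ⊩ r ≤ℚ q +ℚ s → H ⊩ ∣ signed i q -ℚ signed i r ∣ ≤ℚ s
  signed-lipschitz right l m = abs-≤ l m
  signed-lipschitz left l m = abs-≤ (flip m) (flip l)
    where
    flip : H ⊩ q ≤ℚ r +ℚ s → H ⊩ 0ℚ -ℚ r ≤ℚ (0ℚ -ℚ q) +ℚ s
    flip {H = H} {q} {r} {s} l = ≤ℚ-by (+ℚ-mono l (+ℚ-mono (proj₁ (minus-plus 0ℚ r)) (proj₂ (minus-plus 0ℚ q))))
      (let open Sum H in solve 5 (λ q r s q′ r′ →
        r′ :+ ((r :+ s) :+ (:0 :+ (q′ :+ q))) := (q′ :+ s) :+ (q :+ ((r′ :+ r) :+ :0))) (≤ℚ-refl , ≤ℚ-refl) q r s (0ℚ -ℚ q) (0ℚ -ℚ r))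

  freeze-step : Trm Γ (𝟏 ⟶ 𝟎 ⟶ 𝟎 ⟶ 𝟎)
  freeze-step = comb (𝟎 ∷ 𝟎 ∷ 𝟏 ∷ []) (v1 ⊕ sg (v2 · v1))

  -- The minimum of i and the least zero of g.
  stage : Trm Γ 𝟏 → Trm Γ 𝟎 → Trm Γ 𝟎
  stage g i = con R₀ · i · O · (freeze-step · g)

  cong-stage : ∀ (g : Trm Γ 𝟏) {a b} → H ⊩ a ≐ b → H ⊩ stage g a ≐ stage g b
  cong-stage g e = ·-cong (·-cong (·-cong ≐-refl e) ≐-refl) ≐-refl

  stage-suc : ∀ g i → H ⊩ stage g (S′ i) ≐ stage g i ⊕ sg (g · stage g i)
  stage-suc g i = R₀-suc ⟫ β (v1 ⊕ sg (v2 · v1)) (i ◂ stage g i ◂ g ◂ ε)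

  stage-stop : ∀ g i → H ⊩ g · stage g i ≐ O → H ⊩ stage g (S′ i) ≐ stage g i
  stage-stop g i e = stage-suc g i ⟫ ⊕-cong ≐-refl (sg-O e) ⟫ plus-zer

  sg-S : H ⊩ ¬′ (a ≐ O) → H ⊩ sg a ≐ one
  sg-S d = ∸-cong ≐-refl (∸-cong ≐-refl (≢O d) ⟫ S-∸-S _ _ ⟫ O-∸ _) ⟫ monus-zer

  stage-go : ∀ g i → H ⊩ ¬′ (g · stage g i ≐ O) → H ⊩ stage g (S′ i) ≐ S′ (stage g i)
  stage-go g i d = stage-suc g i ⟫ ⊕-cong ≐-refl (sg-S d) ⟫ ≐-sym S-⊕

  -- As long as no zero of `g` has been passed the stage is `i` itself, afterwards it is frozen at a
  -- zero. The facts about the perturbation rest on this distinction, which the perturbation makes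
  -- by testing whether `i ∸ stage g i` is 0.
  stage-status : ∀ g i → H ⊩ stage g i ≐ i ∨ (g · stage g i ≐ O ∧ stage g i < i)
  stage-status g i = inst {As = []} (∀E (induction (stage v2 v0 ≐ v0 ∨ (v2 · stage v2 v0 ≐ O ∧ stage v2 v0 < v0)) (tt , tt , tt)
    (∨I₁ R₀-zer)
    (∨E (em {A = v2 · stage v2 v0 ≐ O})
      (∨I₂ (∧I (·-cong ≐-refl (stage-stop v2 v0 h0) ⟫ h0) (∨E h1
        (≤-reflexive (S-cong (stage-stop v2 v0 h1 ⟫ h0)))
        (≤-resp (S-cong (≐-sym (stage-stop v2 v0 h1))) ≐-refl (≤-trans (∧E₂ h0) n≤Sn)))))
      (∨E h1 (∨I₁ (stage-go v2 v0 h1 ⟫ S-cong h0)) (absurd (⊃E h1 (∧E₁ h0)))))) v0) (i ◂ g ◂ ε) []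

  stage-stays : ∀ g n i → H ⊩ g · stage g n ≐ O → H ⊩ stage g (n ⊕ i) ≐ stage g n
  stage-stays g n i d = inst {As = v2 · stage v2 v1 ≐ O ∷ []}
    (∀E (induction (stage v3 (v2 ⊕ v0) ≐ stage v3 v2) tt (cong-stage v2 plus-zer)
      (cong-stage v3 plus-suc ⟫ stage-stop v3 _ (·-cong ≐-refl h0 ⟫ h1) ⟫ h0)) v0) (i ◂ n ◂ g ◂ ε) (d ∷ [])

  stage-mono : ∀ g n i → H ⊩ stage g n ≤ stage g (n ⊕ i)
  stage-mono g n i = inst {As = []}
    (∀E (induction (stage v3 v2 ≤ stage v3 (v2 ⊕ v0)) tt (≤-reflexive (≐-sym (cong-stage v2 plus-zer)))
      (≤-trans h0 (≤-intro (cong-stage v3 plus-suc ⟫ stage-suc v3 _)))) v0) (i ◂ n ◂ g ◂ ε) []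

  stage-≤ : ∀ g m i → H ⊩ g · m ≐ O → H ⊩ stage g i ≤ m
  stage-≤ g m i d = inst {As = v2 · v1 ≐ O ∷ []}
    (∀E (induction (stage v3 v0 ≤ v2) tt (≤-resp (≐-sym R₀-zer) ≐-refl O≤)
      (∨E (em {A = v3 · stage v3 v0 ≐ O}) (≤-resp (≐-sym (stage-stop v3 v0 h0)) ≐-refl h1)
        (∨E (<-or-≥ (stage v3 v0) v2) (≤-resp (≐-sym (stage-go v3 v0 h1)) ≐-refl h0)
          (absurd (⊃E h1 (·-cong ≐-refl (≤-antisym h2 h0) ⟫ h3)))))) v0) (i ◂ m ◂ g ◂ ε) (d ∷ [])

  -- Below the first zero m of g the perturbed function vanishes, beyond it is
  -- ± min(|x - a|, 2^-(m+1)), whose only root is the end point a.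
  bump : Side → Trm Γ 𝟏 → Trm Γ 𝟏 → Trm Γ 𝟎 → Trm Γ 𝟎
  bump j g x i = min ∣ x · i -ℚ end j ∣ (2^- (S′ (stage g i)))

  perturbation : Side → Trm Γ (𝟏 ⟶ 𝟏 ⟶ 𝟏)
  perturbation j = comb (𝟎 ∷ 𝟏 ∷ 𝟏 ∷ []) (select (v0 ∸ stage v2 v0) 0ℚ (signed j (bump j v2 v1 v0)))

  -- Substitution passes through `signed j` and `end j` only for a concrete side, hence the two
  -- parallel clauses.
  β-perturbation : ∀ j (g x : Trm Γ 𝟏) i → H ⊩ perturbation j · g · x · i ≐
                   select (i ∸ stage g i) 0ℚ (signed j (bump j g x i))
  β-perturbation left  g x i = β (select (v0 ∸ stage v2 v0) 0ℚ (signed left (bump left v2 v1 v0))) (i ◂ x ◂ g ◂ ε)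
  β-perturbation right g x i = β (select (v0 ∸ stage v2 v0) 0ℚ (signed right (bump right v2 v1 v0))) (i ◂ x ◂ g ◂ ε)

  before : ∀ j (g x : Trm Γ 𝟏) i → H ⊩ stage g i ≐ i → H ⊩ perturbation j · g · x · i ≐ 0ℚ
  before j g x i e = β-perturbation j g x i ⟫ select-O (∸-cong ≐-refl e ⟫ ∸-self i)

  after : ∀ j (g x : Trm Γ 𝟏) i → H ⊩ stage g i < i → H ⊩ perturbation j · g · x · i ≐ signed j (bump j g x i)
  after j g x i l = β-perturbation j g x i ⟫ select-S (⊃I (<-irrefl (≤-trans (l ↑) (≤I h0))))

  dist-cong : H ⊩ q ≐ r → H ⊩ s ≐ t → H ⊩ ∣ q -ℚ s ∣ ≐ ∣ r -ℚ t ∣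
  dist-cong e f = ap₁-cong abs (ap₂-cong minusℚ e f)

  dist-swap : H ⊩ ∣ q -ℚ r ∣ ≤ℚ s → H ⊩ ∣ r -ℚ q ∣ ≤ℚ s
  dist-swap l = abs-≤ (abs-≤ʳ l) (abs-≤ˡ l)

  min-congʳ : H ⊩ r ≐ t → H ⊩ min q r ≐ min q t
  min-congʳ e = ·-cong (·-cong (·-cong ≐-refl (∸-cong (lhs-cong ≐-refl e) (rhs-cong ≐-refl e))) ≐-refl) (·-cong ≐-refl e)

  signed-cong : ∀ j → H ⊩ q ≐ r → H ⊩ signed j q ≐ signed j r
  signed-cong left  e = ap₂-cong minusℚ ≐-refl e
  signed-cong right e = e

  O≤bump : ∀ j (g x : Trm Γ 𝟏) i → H ⊩ 0ℚ ≤ℚ bump j g x i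
  O≤bump j g x i = min-glb O≤abs (<ℚ⇒≤ℚ (O<2^- _))

  after-lipschitz : ∀ j (g x y : Trm Γ 𝟏) m n → H ⊩ stage g m < m → H ⊩ stage g n < n → H ⊩ stage g n ≐ stage g m →
    H ⊩ ∣ x · m -ℚ y · n ∣ ≤ℚ s → H ⊩ ∣ perturbation j · g · x · m -ℚ perturbation j · g · y · n ∣ ≤ℚ s
  after-lipschitz {H = H} {s = s} j g x y m n l l′ e d = ≤ℚ-resp
    (≐-sym (dist-cong (after j g x m l) (after j g y n l′ ⟫ signed-cong j (min-congʳ (ap₁-cong inv (S-cong e)))))) ≐-refl
    (signed-lipschitz j (min-lipschitz O≤s (abs-lipschitz d)) (min-lipschitz O≤s (abs-lipschitz (dist-swap d))))
    where
    O≤s : H ⊩ 0ℚ ≤ℚ s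
    O≤s = ≤ℚ-trans O≤abs d

  -- Arguments are compared at the same index, where both values are 0 or both are bumps of the same
  -- height. One estimate thus covers respect for equality of reals and continuity.
  lipschitz : ∀ j (g x y : Trm Γ 𝟏) n → H ⊩ ∣ x · n -ℚ y · n ∣ ≤ℚ s →
              H ⊩ ∣ perturbation j · g · x · n -ℚ perturbation j · g · y · n ∣ ≤ℚ s
  lipschitz j g x y n d = ∨E (stage-status g n)
    (≤ℚ-dist (before j g x n h0 ⟫ ≐-sym (before j g y n h0)) (≤ℚ-trans O≤abs (d ↑)))
    (after-lipschitz j g x y n n (∧E₂ h0) (∧E₂ h0) ≐-refl (d ↑))

  signed-bound : ∀ j → H ⊩ 0ℚ ≤ℚ q → H ⊩ q ≤ℚ s → H ⊩ ∣ 0ℚ -ℚ signed j q ∣ ≤ℚ s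
  signed-bound {H = H} {q} {s} right l m = abs-≤
    (≤ℚ-by (+ℚ-mono l (≤ℚ-trans l m)) (let open Sum H in solve 2 (λ q s → :0 :+ (q :+ s) := (q :+ s) :+ (:0 :+ :0)) (≤ℚ-refl , ≤ℚ-refl) q s))
    (≤ℚ-by m (let open Sum H in solve 2 (λ q s → q :+ s := (:0 :+ s) :+ q) (≤ℚ-refl , ≤ℚ-refl) q s))
  signed-bound {H = H} {q} {s} left l m = abs-≤
    (≤ℚ-by (+ℚ-mono m (proj₂ (minus-plus 0ℚ q))) (let open Sum H in solve 3 (λ q s z → :0 :+ (s :+ (z :+ q)) := (z :+ s) :+ (q :+ :0)) (≤ℚ-refl , ≤ℚ-refl) q s (0ℚ -ℚ q)))
    (≤ℚ-by (+ℚ-mono (+ℚ-mono l (≤ℚ-trans l m)) (proj₁ (minus-plus 0ℚ q))) (let open Sum H in solve 3 (λ q s z → z :+ ((q :+ s) :+ :0) := (:0 :+ s) :+ ((:0 :+ :0) :+ (z :+ q))) (≤ℚ-refl , ≤ℚ-refl) q s (0ℚ -ℚ q)))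

  2^-S< : ∀ n → H ⊩ 2^- (S′ n) <ℚ 2^- n
  2^-S< n = <-≤ℚ-trans (<ℚ-+ (O<2^- _)) (proj₂ (2^-halves n))

  -- The critical case has `n` before and `n ⊕ i` after the first zero m of `g`: the value jumps
  -- from 0 to one of size at most 2^-(m+1), and n ≤ m. The exponent m + 1 makes this strictly less
  -- than 2^-n even for n = m.
  perturbation-real : ∀ j (g x : Trm Γ 𝟏) n i → H ⊩ ∣ x · n -ℚ x · (n ⊕ i) ∣ <ℚ 2^- n →
    H ⊩ ∣ perturbation j · g · x · n -ℚ perturbation j · g · x · (n ⊕ i) ∣ <ℚ 2^- n
  perturbation-real j g x n i d = ∨E (stage-status g n)
    (∨E (stage-status g (n ⊕ i))
      (<ℚ-dist (before j g x n h1 ⟫ ≐-sym (before j g x (n ⊕ i) h0)) (O<2^- n))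
      (≤-<ℚ-trans (≤ℚ-resp (≐-sym (dist-cong (before j g x n h1) (after j g x (n ⊕ i) (∧E₂ h0)))) ≐-refl
        (signed-bound j (O≤bump j g x (n ⊕ i)) (≤ℚ-trans min-≤ʳ (2^-antitone
          (≤-resp (S-cong h1) ≐-refl (≤I (S-∸-S _ _ ⟫ ≤E (stage-mono g n i)))))))) (2^-S< n)))
    (have (stage-stays g n i (∧E₁ h0)) (≤-<ℚ-trans (after-lipschitz j g x x n (n ⊕ i) (∧E₂ h1)
      (≤-trans (≤-resp (S-cong (≐-sym h0)) ≐-refl (∧E₂ h1)) (≤-intro ≐-refl)) h0 ≤ℚ-refl) (d ↑ ↑)))

  perturbation-start : ∀ j (g : Trm Γ 𝟏) n → H ⊩ 0ℚ ≤ℚ perturbation j · g · (con K · 0ℚ) · n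
  perturbation-start j g n = ∨E (stage-status g n) (≤ℚ-resp ≐-refl (≐-sym (before j g (con K · 0ℚ) n h0)) ≤ℚ-refl)
    (≤ℚ-resp ≐-refl (≐-sym (after j g (con K · 0ℚ) n (∧E₂ h0))) (bound j))
    where
    bound : ∀ j → H ⊩ 0ℚ ≤ℚ signed j (bump j g (con K · 0ℚ) n)
    bound right = O≤bump right g (con K · 0ℚ) n
    bound {H = H} left  = ≤ℚ-by (+ℚ-mono (≤ℚ-trans min-≤ˡ (≤ℚ-dist K-red ≤ℚ-refl)) (proj₂ (minus-plus 0ℚ B)))
      (let open Sum H in solve 2 (λ q z → :0 :+ (:0 :+ (z :+ q)) := z :+ (q :+ :0)) (≤ℚ-refl , ≤ℚ-refl) B (0ℚ -ℚ B))
      where B = bump left g (con K · 0ℚ) n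

  perturbation-end : ∀ j (g : Trm Γ 𝟏) n → H ⊩ perturbation j · g · (con K · 1ℚ) · n ≤ℚ 0ℚ
  perturbation-end j g n = ∨E (stage-status g n) (≤ℚ-resp (≐-sym (before j g (con K · 1ℚ) n h0)) ≐-refl ≤ℚ-refl)
    (≤ℚ-resp (≐-sym (after j g (con K · 1ℚ) n (∧E₂ h0))) ≐-refl (bound j))
    where
    bound : ∀ j → H ⊩ signed j (bump j g (con K · 1ℚ) n) ≤ℚ 0ℚ
    bound right = ≤ℚ-trans min-≤ˡ (≤ℚ-dist K-red ≤ℚ-refl)
    bound {H = H} left  = ≤ℚ-by (+ℚ-mono (O≤bump left g (con K · 1ℚ) n) (proj₁ (minus-plus 0ℚ B)))
      (let open Sum H in solve 2 (λ q z → z :+ (q :+ :0) := :0 :+ (:0 :+ (z :+ q))) (≤ℚ-refl , ≤ℚ-refl) B (0ℚ -ℚ B))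
      where B = bump left g (con K · 1ℚ) n

  perturbation-C̄ : ∀ j → [] ⊩ (perturbation j · var {𝟏 ∷ Γ} (here refl)) ∈C̄[ full ]
  perturbation-C̄ j = ∧I (∧I (∧I
      (∀I $ ⊃I $ ∀I $ ∀I $ perturbation-real j v3 v2 v1 v0 (∀E (∀E h0 v1) v0))
      (∀I $ ⊃I $ ∀I $ ⊃I $ ⊃I $ ∀I $ lipschitz j v3 v2 v1 v0 (∀E h0 v0)))
      -- For a 1-Lipschitz function the modulus is the required accuracy itself, and the index that
      -- witnesses closeness of the arguments also does for the values.
      (∀I $ ⊃I $ ∀I $ ∃I v0 $ ∀I $ ⊃I $ ⊃I $ ∃E h0 $ ∃I v0 $
        ≤-<ℚ-trans (+ℚ-mono (lipschitz j v4 v3 v1 v0 ≤ℚ-refl) ≤ℚ-refl) h0))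
    (∧I (∀I $ ≤ℚ-trans (≤ℚ-resp (≐-sym K-red) ≐-refl (perturbation-start j v1 v0)) (≤ℚ-+ (O≤2^-+2^- _)))
        (∀I $ ≤ℚ-trans (≤ℚ-resp ≐-refl (≐-sym K-red) (perturbation-end j v1 v0)) (≤ℚ-+ (O≤2^-+2^- _))))

  signed-small : ∀ j → H ⊩ ∣ signed j q -ℚ 0ℚ ∣ ≤ℚ s → H ⊩ q ≤ℚ s
  signed-small {H = H} {q} {s} right l = ≤ℚ-trans (abs-≤ˡ l) (≤ℚ-trans (proj₁ (+ℚ-comm _ _)) (proj₁ (+ℚ-identityʳ _)))
  signed-small {H = H} {q} {s} left  l = ≤ℚ-by (+ℚ-mono (abs-≤ʳ l) (proj₁ (minus-plus 0ℚ q)))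
    (let open Sum H in solve 3 (λ q s z → q :+ ((z :+ s) :+ :0) := s :+ (:0 :+ (z :+ q))) (≤ℚ-refl , ≤ℚ-refl) q s (0ℚ -ℚ q))

  -- The index at which roots are read off: the approximation error 2^-3 and a distance of at most
  -- 2^-3 from the end point stay together below 1/4, so that comparison with 1/2 recognises the end
  -- point.
  three : Trm Γ 𝟎
  three = S′ (S′ one)

  -- At the index 3 + (m+1) the bump is too small to be 2^-(m+1), hence it is |x - a|.
  root-near-end : ∀ j (g x : Trm Γ 𝟏) m → H ⊩ g · m ≐ O →
    H ⊩ ∣ x · three -ℚ x · (three ⊕ S′ m) ∣ <ℚ 2^- three →
    H ⊩ ∣ perturbation j · g · x · (three ⊕ S′ m) -ℚ con K · 0ℚ · (three ⊕ S′ m) ∣ ≤ℚ 2^- (three ⊕ S′ m) →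
    H ⊩ ∣ x · three -ℚ end j ∣ <ℚ 2^- (S′ one)
  root-near-end {H = H} j g x m z real vanish = abs-<
      (<ℚ-by (+ℚ-mono-<≤ (abs-<ˡ real) (+ℚ-mono (abs-≤ˡ close) (proj₂ (2^-halves (S′ one)))))
        (let open Sum H in solve 5 (λ X Y a h k → X :+ ((Y :+ h) :+ ((a :+ h) :+ k)) := (a :+ k) :+ (X :+ (Y :+ (h :+ h)))) (≤ℚ-refl , ≤ℚ-refl) (x · three) (x · i) (end j) (2^- three) (2^- (S′ one))))
      (<ℚ-by (+ℚ-mono-<≤ (abs-<ʳ real) (+ℚ-mono (abs-≤ʳ close) (proj₂ (2^-halves (S′ one)))))
        (let open Sum H in solve 5 (λ X Y a h k → a :+ ((X :+ h) :+ ((Y :+ h) :+ k)) := (X :+ k) :+ (Y :+ (a :+ (h :+ h)))) (≤ℚ-refl , ≤ℚ-refl) (x · three) (x · i) (end j) (2^- three) (2^- (S′ one))))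
    where
    i : Trm _ 𝟎
    i = three ⊕ S′ m
    i≐ : H ⊩ i ≐ S′ (S′ m) ⊕ S′ one
    i≐ = let open Ring H in ⊕-cong (S-⊕ ⟫ ⊕-cong S-⊕ ≐-refl) S-⊕ ⟫
      solve 1 (λ m → ((con 1 :+ con 1) :+ con 1) :+ (m :+ con 1) := ((m :+ con 1) :+ con 1) :+ (con 1 :+ con 1)) ≐-refl m ⟫
      ≐-sym (⊕-cong (S-⊕ ⟫ ⊕-cong S-⊕ ≐-refl) S-⊕)
    Sm<i : H ⊩ S′ m < i
    Sm<i = ≤-intro i≐
    reached : H ⊩ stage g i < i
    reached = ≤-trans (≤I (S-∸-S _ _ ⟫ ≤E (stage-≤ g m i z))) (<⇒≤ Sm<i)
    small : H ⊩ bump j g x i ≤ℚ 2^- i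
    small = signed-small j (≤ℚ-resp (dist-cong (after j g x i reached) K-red) ≐-refl vanish)
    close : H ⊩ ∣ x · i -ℚ end j ∣ ≤ℚ 2^- three
    close = ≤ℚ-trans (∨E (min-split ∣ x · i -ℚ end j ∣ (2^- (S′ (stage g i))))
      (≤ℚ-trans (proj₂ (≐⇒≃ (∧E₂ h0))) (small ↑))
      (absurd (<ℚ-irrefl (≤-<ℚ-trans (≤ℚ-trans (proj₂ (≐⇒≃ (∧E₂ h0))) (small ↑))
        (≤-<ℚ-trans (2^-antitone (Sm<i ↑)) (<-≤ℚ-trans (2^-S< (S′ m)) (2^-antitone (≤I (S-∸-S _ _ ⟫ ≤E (stage-≤ g m i z ↑))))))))))
      (2^-antitone (≤-intro ≐-refl))

  half : Trm Γ 𝟎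
  half = 2^- one

  -- The truth value of `tested` as a number, with 0 for true, as `zero-test` has to be a term.
  test : Side → Trm Γ 𝟎 → Trm Γ 𝟎
  test left  q = lhs q half ∸ rhs q half
  test right q = S′ (lhs half q) ∸ rhs half q

  tested : Side → Trm Γ 𝟎 → Fml Γ
  tested left  q = q ≤ℚ half
  tested right q = half <ℚ q

  test-O : ∀ j → H ⊩ tested j q → H ⊩ test j q ≐ O
  test-O left  d = ≤E (≤ℚE d)
  test-O right d = ≤E (<ℚE d)

  test-O⁻ : ∀ j → H ⊩ test j q ≐ O → H ⊩ tested j q
  test-O⁻ left  d = ≤ℚI (≤I d)
  test-O⁻ right d = <ℚI (≤I d)

  tested-resp : ∀ j → H ⊩ q ≐ r → H ⊩ tested j q → H ⊩ tested j r
  tested-resp left  e d = ≤ℚ-resp e ≐-refl d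
  tested-resp right e d = <ℚ-resp ≐-refl e d

  tested-end : ∀ j → H ⊩ ∣ q -ℚ end j ∣ <ℚ 2^- (S′ one) → H ⊩ tested j q
  tested-end {H = H} {q} left d = <ℚ⇒≤ℚ (<ℚ-by (+ℚ-mono-< (abs-<ˡ d) (2^-S< one))
    (let open Sum H in solve 3 (λ q k h → q :+ ((:0 :+ k) :+ h) := h :+ (q :+ k)) (≤ℚ-refl , ≤ℚ-refl) q (2^- (S′ one)) half))
  tested-end {H = H} {q} right d = <ℚ-by (+ℚ-mono-< (abs-<ʳ d) (<-≤ℚ-trans (+ℚ-mono-<≤ (2^-S< one) ≤ℚ-refl)
      (≤ℚ-trans (proj₂ (2^-halves O)) (2^-≤1 O))))
    (let open Sum H in solve 4 (λ q k h o → h :+ ((q :+ k) :+ o) := q :+ (o :+ (k :+ h))) (≤ℚ-refl , ≤ℚ-refl) q (2^- (S′ one)) half 1ℚ)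

  zero-function : Trm Γ (𝟏 ⟶ 𝟏)
  zero-function = con K · (con K · 0ℚ)

  -- The equality is one of functionals, so by extensionality Φ cannot tell the perturbation from
  -- the zero function. This is the point at which Grilliot's trick exploits the uniformity of the
  -- root.
  perturbation-trivial : ∀ j (g : Trm Γ 𝟏) → H ⊩ ∀′ 𝟎 (¬′ (wk g · v0 ≐ O)) → H ⊩ perturbation j · g ≐ zero-function
  perturbation-trivial j g d = inst {As = ∀′ 𝟎 (¬′ (v1 · v0 ≐ O)) ∷ []} {perturbation j · v0 ≐ zero-function}
    (≐-ext (≐-ext (∨E (stage-status v2 v0)
      (before j v2 v1 v0 h0 ⟫ ≐-sym (≐-app K-red v0 ⟫ K-red))
      (absurd (⊃E (∀E h1 (stage v2 v0)) (∧E₁ h0)))))) (g ◂ ε) (d ∷ [])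

  zero-test : Side → Trm Γ (((𝟏 ⟶ 𝟏) ⟶ 𝟏) ⟶ 𝟐)
  zero-test j = comb (𝟏 ∷ ((𝟏 ⟶ 𝟏) ⟶ 𝟏) ∷ []) (test j (v1 · (perturbation j · v0) · three))

  β-zero-test : ∀ j (Φ : Trm Γ ((𝟏 ⟶ 𝟏) ⟶ 𝟏)) (g : Trm Γ 𝟏) →
                H ⊩ zero-test j · Φ · g ≐ test j (Φ · (perturbation j · g) · three)
  β-zero-test left  Φ g = β (test left  (v1 · (perturbation left · v0) · three)) (g ◂ Φ ◂ ε)
  β-zero-test right Φ g = β (test right (v1 · (perturbation right · v0) · three)) (g ◂ Φ ◂ ε)

  uniform-root : Fml (((𝟏 ⟶ 𝟏) ⟶ 𝟏) ∷ Γ)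
  uniform-root = ∀′ (𝟏 ⟶ 𝟏) (v0 ∈C̄[ full ] ⊃ v1 · v0 ∈𝕀[ full ] ∧ v0 · (v1 · v0) ≈ℝ con K · 0ℚ [ full ])

  -- Side `j` is one on which Φ does not place the root of the zero function. If `g` has a zero, the
  -- root of the perturbation is near end `j` and passes the test; if it has none, the perturbation
  -- is the zero function and the test fails.
  zero-test-correct : ∀ j → H ⊩ uniform-root → H ⊩ ¬′ (tested j (v0 · zero-function · three)) → H ⊩ ∃′ 𝟐 (decides full v0)
  zero-test-correct j d e = have d (have (e ↑) (∃I (zero-test j · v0) (∀I (have
    (⊃E (∀E h1 (perturbation j · v0)) (entail (perturbation-C̄ j) []))
    (∧I
      (⊃I (β-zero-test j v1 v0 ⟫ test-O j (tested-end j (∃E h0 (end↑ j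
        (root-near-end j v1 (v2 · (perturbation j · v1)) v0 h0 (∀E (∀E (∧E₁ (∧E₁ h2)) three) (S′ v0)) (∀E (∧E₂ h2) (three ⊕ S′ v0))))))))
      (⊃I (raa (⊃E (stuck↑ j h3) (tested-resp j
        (≐-app (·-cong ≐-refl (perturbation-trivial j v0 (∀I (⊃I (⊃E h1 (∃I v0 h0)))))) three)
        (test-O⁻ j (≐-sym (β-zero-test j v1 v0) ⟫ h1))))))))))) 
    where
    stuck↑ : ∀ j → H ⊩ ren there (¬′ (tested j (v0 · zero-function · three))) → H ⊩ ¬′ (tested j (v1 · zero-function · three))
    stuck↑ left  d = d
    stuck↑ right d = d
    end↑ : ∀ j → H ⊩ ∣ wk {τ = τ} q -ℚ end j ∣ <ℚ wk s → H ⊩ ren there (∣ q -ℚ end j ∣ <ℚ s)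
    end↑ left  d = d
    end↑ right d = d

  UIVT⇒∃² : {H : List (Fml [])} → H ⊩ UIVT → H ⊩ ∃²
  UIVT⇒∃² d = ∃E d (∨E (≤ℚ-or-> (v0 · zero-function · three) half)
    (zero-test-correct right h1 (⊃I (<ℚ-irrefl (<-≤ℚ-trans h0 h1))))
    (zero-test-correct left h1 (⊃I (<ℚ-irrefl (<-≤ℚ-trans h1 h0)))))

-- Roots by bisection: from (∃²) to UIVT and from Π⁰₁-TRANS to IVT*.

module Bisection where

  open D using (Ty; 𝟎; 𝟏; 𝟐; _⟶_; _⋆; Ctx; Const)
  open Const
  open Calculus
  open Arithmetic
  open Rationals
  open Formulas
  open Transfer
  open Constant
  open Grilliot using (select; select-O; select-S; 2^-S<; O≤abs; dist-cong)

  private variable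
    H : List (Fml Γ)
    a b c k n q r s t u : Trm Γ 𝟎
    φ : Trm Γ 𝟐
    f : Trm Γ (𝟏 ⟶ 𝟏)

  -- negative-at f q vanishes somewhere iff the real f(q) is negative.
  negative-at : Trm Γ ((𝟏 ⟶ 𝟏) ⟶ 𝟎 ⟶ 𝟎 ⟶ 𝟎)
  negative-at = comb (𝟎 ∷ 𝟎 ∷ (𝟏 ⟶ 𝟏) ∷ [])
    (S′ (lhs (v2 · (con K · v1) · v0 +ℚ (2^- v0 +ℚ 2^- v0)) 0ℚ) ∸ rhs (v2 · (con K · v1) · v0 +ℚ (2^- v0 +ℚ 2^- v0)) 0ℚ)

  neg-value : Trm Γ (𝟏 ⟶ 𝟏) → Trm Γ 𝟎 → Trm Γ 𝟎 → Trm Γ 𝟎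
  neg-value f q m = f · (con K · q) · m +ℚ (2^- m +ℚ 2^- m)

  negative-O : ∀ (f : Trm Γ (𝟏 ⟶ 𝟏)) q m → H ⊩ neg-value f q m <ℚ 0ℚ → H ⊩ negative-at · f · q · m ≐ O
  negative-O f q m l = β (S′ (lhs (neg-value v2 v1 v0) 0ℚ) ∸ rhs (neg-value v2 v1 v0) 0ℚ) (m ◂ q ◂ f ◂ ε) ⟫ ≤E (<ℚE l)

  negative-O⁻ : ∀ (f : Trm Γ (𝟏 ⟶ 𝟏)) q m → H ⊩ negative-at · f · q · m ≐ O → H ⊩ neg-value f q m <ℚ 0ℚ
  negative-O⁻ f q m e = <ℚI (≤I (≐-sym (β (S′ (lhs (neg-value v2 v1 v0) 0ℚ) ∸ rhs (neg-value v2 v1 v0) 0ℚ) (m ◂ q ◂ f ◂ ε)) ⟫ e))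

  -- A state codes the end points of an interval; the n-th one has length 2^-n.
  bisect : Trm Γ (𝟐 ⟶ (𝟏 ⟶ 𝟏) ⟶ 𝟎 ⟶ 𝟎 ⟶ 𝟎)
  bisect = comb (𝟎 ∷ 𝟎 ∷ (𝟏 ⟶ 𝟏) ∷ 𝟐 ∷ [])
    (select (v3 · (negative-at · v2 · (ap₁ π₁ v1 +ℚ 2^- (S′ v0))))
      ⟨ ap₁ π₁ v1 , ap₁ π₁ v1 +ℚ 2^- (S′ v0) ⟩ ⟨ ap₁ π₁ v1 +ℚ 2^- (S′ v0) , ap₁ π₂ v1 ⟩)

  module _ (φ : Trm Γ 𝟐) (f : Trm Γ (𝟏 ⟶ 𝟏)) where
    state lo hi mid : Trm Γ 𝟎 → Trm Γ 𝟎
    state n = con R₀ · n · ⟨ 0ℚ , 1ℚ ⟩ · (bisect · φ · f)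
    lo n  = ap₁ π₁ (state n)
    hi n  = ap₁ π₂ (state n)
    mid n = lo n +ℚ 2^- (S′ n)

    negative : Trm Γ 𝟎 → Fml Γ
    negative q = φ · (negative-at · f · q) ≐ O

    state-suc : ∀ n → H ⊩ state (S′ n) ≐ select (φ · (negative-at · f · mid n)) ⟨ lo n , mid n ⟩ ⟨ mid n , hi n ⟩
    state-suc n = R₀-suc ⟫ β (select (v3 · (negative-at · v2 · (ap₁ π₁ v1 +ℚ 2^- (S′ v0))))
      ⟨ ap₁ π₁ v1 , ap₁ π₁ v1 +ℚ 2^- (S′ v0) ⟩ ⟨ ap₁ π₁ v1 +ℚ 2^- (S′ v0) , ap₁ π₂ v1 ⟩) (n ◂ state n ◂ f ◂ φ ◂ ε)

    step : ∀ n → H ⊩ (negative (mid n) ∧ lo (S′ n) ≐ lo n ∧ hi (S′ n) ≐ mid n) ∨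
                     (¬′ negative (mid n) ∧ lo (S′ n) ≐ mid n ∧ hi (S′ n) ≐ hi n)
    step n = ∨E (em {A = negative (mid n)})
      (∨I₁ (have (state-suc n ⟫ select-O h0) (∧I h1 (∧I (ap₁-cong π₁ h0 ⟫ π₁-pair) (ap₁-cong π₂ h0 ⟫ π₂-pair)))))
      (∨I₂ (have (state-suc n ⟫ select-S h0) (∧I h1 (∧I (ap₁-cong π₁ h0 ⟫ π₁-pair) (ap₁-cong π₂ h0 ⟫ π₂-pair)))))

    lo-O : H ⊩ lo O ≐ 0ℚ
    lo-O = ap₁-cong π₁ R₀-zer ⟫ π₁-pair
    hi-O : H ⊩ hi O ≐ 1ℚ
    hi-O = ap₁-cong π₂ R₀-zer ⟫ π₂-pair

    lo-cong : H ⊩ a ≐ b → H ⊩ lo a ≐ lo b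
    lo-cong e = ap₁-cong π₁ (·-cong (·-cong (·-cong ≐-refl e) ≐-refl) ≐-refl)
    hi-cong : H ⊩ a ≐ b → H ⊩ hi a ≐ hi b
    hi-cong e = ap₁-cong π₂ (·-cong (·-cong (·-cong ≐-refl e) ≐-refl) ≐-refl)

  1≃2^-O : H ∣ 1ℚ ≃ 2^- O
  1≃2^-O = ≐⇒≃ (≐-sym (inv-def ⟫ ap₂-cong pair ≐-refl (ap₁-cong pred pow-zer)))

  O+ : H ∣ 0ℚ +ℚ q ≃ q
  O+ {q = q} = ≃-trans (+ℚ-comm 0ℚ q) (+ℚ-identityʳ q)

  width : ∀ φ (f : Trm Γ (𝟏 ⟶ 𝟏)) n → H ∣ hi φ f n ≃ lo φ f n +ℚ 2^- n
  width φ f n = ∧E₁ both , ∧E₂ both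
    where
    both : _ ⊩ hi φ f n ≤ℚ lo φ f n +ℚ 2^- n ∧ lo φ f n +ℚ 2^- n ≤ℚ hi φ f n
    both = inst {As = []} (∀E (induction (hi v3 v2 v0 ≤ℚ lo v3 v2 v0 +ℚ 2^- v0 ∧ lo v3 v2 v0 +ℚ 2^- v0 ≤ℚ hi v3 v2 v0) (tt , tt)
      (have (hi-O v2 v1) (have (lo-O v2 v1) (∧I
        (≤ℚ-resp (≐-sym h1) (ap₂-cong plusℚ (≐-sym h0) ≐-refl) (≤ℚ-trans (proj₁ 1≃2^-O) (proj₂ O+)))
        (≤ℚ-resp (ap₂-cong plusℚ (≐-sym h0) ≐-refl) (≐-sym h1) (≤ℚ-trans (proj₁ O+) (proj₂ 1≃2^-O))))))
      (∨E (step v3 v2 v0)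
        (have (∧E₂ (∧E₂ h0)) (have (∧E₁ (∧E₂ h1)) (∧I
          (≤ℚ-resp (≐-sym h1) (ap₂-cong plusℚ (≐-sym h0) ≐-refl) ≤ℚ-refl)
          (≤ℚ-resp (ap₂-cong plusℚ (≐-sym h0) ≐-refl) (≐-sym h1) ≤ℚ-refl))))
        (have (∧E₂ (∧E₂ h0)) (have (∧E₁ (∧E₂ h1)) (∧I
          (≤ℚ-resp (≐-sym h1) (ap₂-cong plusℚ (≐-sym h0) ≐-refl) (≤ℚ-trans (∧E₁ h3) (proj₁ split)))
          (≤ℚ-resp (ap₂-cong plusℚ (≐-sym h0) ≐-refl) (≐-sym h1) (≤ℚ-trans (proj₂ split) (∧E₂ h3)))))))) v0)
      (n ◂ f ◂ φ ◂ ε) []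
      where
      split : ∀ {Γ} {H : List (Fml Γ)} {q n} → H ∣ q +ℚ 2^- n ≃ (q +ℚ 2^- (S′ n)) +ℚ 2^- (S′ n)
      split {q = q} = ≃-trans (+ℚ-mono ≤ℚ-refl (proj₁ (2^-halves _)) , +ℚ-mono ≤ℚ-refl (proj₂ (2^-halves _))) (≃-sym (+ℚ-assoc q _ _))

  lo-step : ∀ φ (f : Trm Γ (𝟏 ⟶ 𝟏)) n → H ⊩ lo φ f n ≤ℚ lo φ f (S′ n)
  lo-step φ f n = ∨E (step φ f n) (proj₂ (≐⇒≃ (∧E₁ (∧E₂ h0))))
    (≤ℚ-resp ≐-refl (≐-sym (∧E₁ (∧E₂ h0))) (≤ℚ-+ (<ℚ⇒≤ℚ (O<2^- _))))

  hi-step : ∀ φ (f : Trm Γ (𝟏 ⟶ 𝟏)) n → H ⊩ hi φ f (S′ n) ≤ℚ hi φ f n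
  hi-step φ f n = ∨E (step φ f n)
    (≤ℚ-resp (≐-sym (∧E₂ (∧E₂ h0))) ≐-refl (≤ℚ-trans (+ℚ-mono ≤ℚ-refl (<ℚ⇒≤ℚ (2^-S< n))) (proj₂ (width φ f n))))
    (proj₁ (≐⇒≃ (∧E₂ (∧E₂ h0))))

  nested : ∀ φ (f : Trm Γ (𝟏 ⟶ 𝟏)) n i → H ⊩ lo φ f n ≤ℚ lo φ f (n ⊕ i) ∧ hi φ f (n ⊕ i) ≤ℚ hi φ f n
  nested φ f n i = inst {As = []} (∀E (induction
    (lo v4 v3 v2 ≤ℚ lo v4 v3 (v2 ⊕ v0) ∧ hi v4 v3 (v2 ⊕ v0) ≤ℚ hi v4 v3 v2) (tt , tt)
    (∧I (proj₂ (≐⇒≃ (lo-cong v3 v2 plus-zer))) (proj₁ (≐⇒≃ (hi-cong v3 v2 plus-zer))))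
    (∧I (≤ℚ-resp ≐-refl (≐-sym (lo-cong v4 v3 plus-suc)) (≤ℚ-trans (∧E₁ h0) (lo-step v4 v3 _)))
        (≤ℚ-resp (≐-sym (hi-cong v4 v3 plus-suc)) ≐-refl (≤ℚ-trans (hi-step v4 v3 _) (∧E₂ h0))))) v0)
    (i ◂ n ◂ f ◂ φ ◂ ε) []

  limit : Trm Γ (𝟐 ⟶ (𝟏 ⟶ 𝟏) ⟶ 𝟏)
  limit = comb (𝟎 ∷ (𝟏 ⟶ 𝟏) ∷ 𝟐 ∷ []) (lo v2 v1 v0)

  β-limit : ∀ φ (f : Trm Γ (𝟏 ⟶ 𝟏)) n → H ⊩ limit · φ · f · n ≐ lo φ f n
  β-limit φ f n = β (lo v2 v1 v0) (n ◂ f ◂ φ ◂ ε)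

  lo-≤-hi : ∀ φ (f : Trm Γ (𝟏 ⟶ 𝟏)) n → H ⊩ lo φ f n ≤ℚ hi φ f n
  lo-≤-hi φ f n = ≤ℚ-trans (≤ℚ-+ (<ℚ⇒≤ℚ (O<2^- n))) (proj₂ (width φ f n))

  -- Bisection keeps the intervals nested and halves their length whatever `φ` answers, so the left
  -- ends form a real in any case.
  limit-real : ∀ φ (f : Trm Γ (𝟏 ⟶ 𝟏)) n i → H ⊩ ∣ limit · φ · f · n -ℚ limit · φ · f · (n ⊕ i) ∣ <ℚ 2^- n
  limit-real φ f n i = <ℚ-resp (ap₁-cong abs (ap₂-cong minusℚ (≐-sym (β-limit φ f n)) (≐-sym (β-limit φ f (n ⊕ i))))) ≐-refl
    (abs-< (≤-<ℚ-trans (∧E₁ (nested φ f n i)) (<ℚ-+ (O<2^- n)))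
      (<-≤ℚ-trans (<ℚ-+ (O<2^- (n ⊕ i))) (≤ℚ-trans (proj₂ (width φ f (n ⊕ i)))
        (≤ℚ-trans (∧E₂ (nested φ f n i)) (proj₁ (width φ f n))))))

  O≤lo : ∀ φ (f : Trm Γ (𝟏 ⟶ 𝟏)) n → H ⊩ 0ℚ ≤ℚ lo φ f n
  O≤lo φ f n = ≤ℚ-resp (lo-O φ f) (lo-cong φ f ⊕-O) (∧E₁ (nested φ f O n))
  hi≤1 : ∀ φ (f : Trm Γ (𝟏 ⟶ 𝟏)) n → H ⊩ hi φ f n ≤ℚ 1ℚ
  hi≤1 φ f n = ≤ℚ-resp (hi-cong φ f ⊕-O) (hi-O φ f) (∧E₂ (nested φ f O n))

  limit-𝕀 : ∀ g φ (f : Trm Γ (𝟏 ⟶ 𝟏)) → H ⊩ limit · φ · f ∈𝕀[ g ]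
  limit-𝕀 g φ f = inst {As = []} {limit · v1 · v0 ∈𝕀[ g ]} (∧I
    (∀ᵣI $ ∀ᵣI $ limit-real v3 v2 v1 v0) (∧I
    (∀ᵣI $ ≤ℚ-resp (≐-sym K-red) (ap₂-cong plusℚ (≐-sym (β-limit v2 v1 v0)) ≐-refl)
      (≤ℚ-trans (O≤lo v2 v1 v0) (≤ℚ-+ (O≤2^-+2^- _))))
    (∀ᵣI $ ≤ℚ-resp (≐-sym (β-limit v2 v1 v0)) (ap₂-cong plusℚ (≐-sym K-red) ≐-refl)
      (≤ℚ-trans (≤ℚ-trans (lo-≤-hi v2 v1 v0) (hi≤1 v2 v1 v0)) (≤ℚ-+ (O≤2^-+2^- _)))))) (f ◂ φ ◂ ε) []

  in-S : ∀ {g} → H ⊩ g ∋ a → H ⊩ g ∋ S′ a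
  in-S {a = a} d = st-tm (S′ v0) (a ◂ ε) (λ { (here refl) → d })

  in-∸ : ∀ {g} → H ⊩ g ∋ a → H ⊩ g ∋ b → H ⊩ g ∋ (a ∸ b)
  in-∸ {a = a} {b} d e = st-tm (v0 ∸ v1) (a ◂ b ◂ ε) (λ { (here refl) → d ; (there (here refl)) → e })

  cauchy : ∀ g (z : Trm Γ 𝟏) m n → H ⊩ g ∋ m → H ⊩ g ∋ n → H ⊩ z ∈ℝ[ g ] → H ⊩ m ≤ n → H ⊩ ∣ z · m -ℚ z · n ∣ <ℚ 2^- m
  cauchy g z m n d e r l = <ℚ-resp (ap₁-cong abs (ap₂-cong minusℚ ≐-refl (·-cong ≐-refl (≐-sym (≤-elim l))))) ≐-refl
    (inst {As = g ∋ v1 ∷ g ∋ v0 ∷ v2 ∈ℝ[ g ] ∷ []} {∣ v2 · v1 -ℚ v2 · (v1 ⊕ v0) ∣ <ℚ 2^- v1}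
      (∀ᵣE (∀ᵣE h2 v1 h0) v0 h1) (n ∸ m ◂ m ◂ z ◂ ε) (d ∷ in-∸ e d ∷ r ∷ []))

  rational-𝕀 : ∀ g (q : Trm Γ 𝟎) → H ⊩ 0ℚ ≤ℚ q → H ⊩ q ≤ℚ 1ℚ → H ⊩ con K · q ∈𝕀[ g ]
  rational-𝕀 g q l m = inst {As = 0ℚ ≤ℚ v0 ∷ v0 ≤ℚ 1ℚ ∷ []} {con K · v0 ∈𝕀[ g ]} (∧I
    (∀ᵣI $ ∀ᵣI $ <ℚ-dist (K-red ⟫ ≐-sym K-red) (O<2^- _)) (∧I
    (∀ᵣI $ ≤ℚ-resp (≐-sym K-red) (ap₂-cong plusℚ (≐-sym K-red) ≐-refl) (≤ℚ-trans h1 (≤ℚ-+ (O≤2^-+2^- _))))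
    (∀ᵣI $ ≤ℚ-resp (≐-sym K-red) (ap₂-cong plusℚ (≐-sym K-red) ≐-refl) (≤ℚ-trans h2 (≤ℚ-+ (O≤2^-+2^- _))))))
    (q ◂ ε) (l ∷ m ∷ [])

  nonnegative : ∀ {g} → decides g v3 ∷ g ∋ v2 ∷ g ∋ v1 ∷ g ∋ v0 ∷ ¬′ negative v3 v2 v1 ∷ [] ⊩
                0ℚ ≤ℚ neg-value {𝟎 ∷ 𝟎 ∷ (𝟏 ⟶ 𝟏) ∷ 𝟐 ∷ Γ} v2 v1 v0
  nonnegative = ∨E (≤ℚ-or-> 0ℚ (neg-value v2 v1 v0)) h0 (absurd (⊃E h5
    (⊃E (∧E₁ (∀ᵣE h1 (negative-at · v2 · v1) (st-tm (negative-at · v1 · v0) (v1 ◂ v2 ◂ ε) (λ { (here refl) → h3 ; (there (here refl)) → h2 }))))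
      (∃ᵣI v0 h4 (negative-O v2 v1 v0 h0)))))

  -- A single index m with value below -2·2^-m informs all others by the Cauchy property: at later
  -- indices the value stays negative, at an earlier index n it is below 2·2^-n.
  nonpositive : ∀ {g} → decides g v3 ∷ g ∋ v2 ∷ g ∋ v1 ∷ g ∋ v0 ∷ negative v3 v2 v1 ∷ v2 · (con K · v1) ∈ℝ[ g ] ∷ [] ⊩
                _≤ℚ_ {𝟎 ∷ 𝟎 ∷ (𝟏 ⟶ 𝟏) ∷ 𝟐 ∷ Γ} (v2 · (con K · v1) · v0) (2^- v0 +ℚ 2^- v0)
  nonpositive {g = g} = ∃ᵣE (⊃E (∧E₂ (∀ᵣE h0 (negative-at · v2 · v1) (st-tm (negative-at · v1 · v0) (v1 ◂ v2 ◂ ε) (λ { (here refl) → h2 ; (there (here refl)) → h1 })))) h4)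
    (have (negative-O⁻ v3 v2 v0 h0) (∨E (≤-total v0 v1)
      (have (abs-<ʳ (cauchy g (v3 · (con K · v2)) v0 v1 h3 h7 h9 h0))
        (≤ℚ-trans (<ℚ⇒≤ℚ (below (<ℚ⇒≤ℚ (O<2^- _)) h0 h2)) (O≤2^-+2^- _)))
      (have (abs-<ˡ (cauchy g (v3 · (con K · v2)) v1 v0 h7 h3 h9 h0))
        (<ℚ⇒≤ℚ (above (<ℚ⇒≤ℚ (O<2^- _)) (<ℚ⇒≤ℚ (O<2^- _)) h0 h2)))))
    where
    below : H ⊩ 0ℚ ≤ℚ s → H ⊩ q <ℚ r +ℚ s → H ⊩ r +ℚ (s +ℚ s) <ℚ 0ℚ → H ⊩ q <ℚ 0ℚ
    below p l m = <-≤ℚ-trans l (≤ℚ-trans (+ℚ-mono ≤ℚ-refl (≤ℚ-+ p)) (<ℚ⇒≤ℚ m))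
    above : H ⊩ 0ℚ ≤ℚ s → H ⊩ 0ℚ ≤ℚ t → H ⊩ q <ℚ r +ℚ s → H ⊩ r +ℚ (t +ℚ t) <ℚ 0ℚ → H ⊩ q <ℚ s +ℚ s
    above p p′ l m = <-≤ℚ-trans l (+ℚ-mono (≤ℚ-trans (≤ℚ-trans (≤ℚ-+ (≤ℚ-trans p′ (≤ℚ-+ p′))) (<ℚ⇒≤ℚ m)) p) ≤ℚ-refl)

  -- To be read with `z` and `w` as the values at index `m` of f at the limit and at an end point of
  -- a short interval, `zᵢ` as the value at the limit at index `i`, and `k` as the accuracy to which
  -- f agrees at the limit and the end point.
  module _ {Γ} {H : List (Fml Γ)} (i k m z w zᵢ : Trm Γ 𝟎)
           (k≥i : H ⊩ i ≤ k) (close : H ⊩ ∣ z -ℚ w ∣ +ℚ (2^- m +ℚ 2^- m) <ℚ 2^- k) where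
    -- Closeness to within 2^-k includes the error terms at `m`, whence 2^-m < 2^-k ≤ 2^-i.
    index : H ⊩ i ≤ m
    index = ∨E (≤-total i m) h0 (absurd (<ℚ-irrefl (<-≤ℚ-trans
      (≤-<ℚ-trans (≤ℚ-trans (≤ℚ-+ (<ℚ⇒≤ℚ (O<2^- m))) (≤ℚ-trans (proj₂ O+) (+ℚ-mono O≤abs ≤ℚ-refl))) (close ↑))
      (2^-antitone (≤-trans h0 (k≥i ↑))))))

    -- The chain is z_i < z + 2^-i ≤ w + |z - w| + 2^-i with w ≤ 2·2^-m, so that z_i < 2^-k + 2^-i.
    -- This is applied at the right end of the interval; `lower` is its mirror image at the left
    -- end.
    upper : H ⊩ w ≤ℚ 2^- m +ℚ 2^- m → H ⊩ ∣ zᵢ -ℚ z ∣ <ℚ 2^- i → H ⊩ 2^- i +ℚ 2^- k ≤ℚ zᵢ → H ⊩ ⊥′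
    upper l c u = <ℚ-irrefl {q = 0ℚ} (<ℚ-by (+ℚ-mono-< close (+ℚ-mono-<≤ (abs-<ˡ c) (+ℚ-mono (abs-≤ˡ ≤ℚ-refl) (+ℚ-mono l u))))
      (let open Sum H in solve 7 (λ z w zᵢ e d a b →
        :0 :+ (b :+ ((z :+ a) :+ ((w :+ d) :+ ((e :+ e) :+ zᵢ)))) := :0 :+ ((d :+ (e :+ e)) :+ (zᵢ :+ (z :+ (w :+ (a :+ b)))))) (≤ℚ-refl , ≤ℚ-refl)
        z w zᵢ (2^- m) ∣ z -ℚ w ∣ (2^- i) (2^- k)))

    lower : H ⊩ 0ℚ ≤ℚ w +ℚ (2^- m +ℚ 2^- m) → H ⊩ ∣ zᵢ -ℚ z ∣ <ℚ 2^- i → H ⊩ (zᵢ +ℚ 2^- i) +ℚ 2^- k ≤ℚ 0ℚ → H ⊩ ⊥′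
    lower l c u = <ℚ-irrefl {q = 0ℚ} (<ℚ-by (+ℚ-mono-< close (+ℚ-mono-<≤ (abs-<ʳ c) (+ℚ-mono (abs-≤ʳ ≤ℚ-refl) (+ℚ-mono l u))))
      (let open Sum H in solve 7 (λ z w zᵢ e d a b →
        :0 :+ (b :+ ((zᵢ :+ a) :+ ((z :+ d) :+ ((w :+ (e :+ e)) :+ :0)))) := :0 :+ ((d :+ (e :+ e)) :+ (z :+ (w :+ (:0 :+ ((zᵢ :+ a) :+ b)))))) (≤ℚ-refl , ≤ℚ-refl)
        z w zᵢ (2^- m) ∣ z -ℚ w ∣ (2^- i) (2^- k)))

  in-lo : ∀ {g φ} {f : Trm Γ (𝟏 ⟶ 𝟏)} → H ⊩ g ∋ φ → H ⊩ g ∋ f → H ⊩ g ∋ n → H ⊩ g ∋ lo φ f n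
  in-lo {n = n} {φ = φ} {f} d e e′ = st-tm (lo v2 v1 v0) (n ◂ f ◂ φ ◂ ε)
    (λ { (here refl) → e′ ; (there (here refl)) → e ; (there (there (here refl))) → d })

  in-hi : ∀ {g φ} {f : Trm Γ (𝟏 ⟶ 𝟏)} → H ⊩ g ∋ φ → H ⊩ g ∋ f → H ⊩ g ∋ n → H ⊩ g ∋ hi φ f n
  in-hi {n = n} {φ = φ} {f} d e e′ = st-tm (hi v2 v1 v0) (n ◂ f ◂ φ ◂ ε)
    (λ { (here refl) → e′ ; (there (here refl)) → e ; (there (there (here refl))) → d })

  in-limit : ∀ {g φ} {f : Trm Γ (𝟏 ⟶ 𝟏)} → H ⊩ g ∋ φ → H ⊩ g ∋ f → H ⊩ g ∋ limit · φ · f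
  in-limit {φ = φ} {f} d e = st-tm (limit · v1 · v0) (f ◂ φ ◂ ε) (λ { (here refl) → e ; (there (here refl)) → d })

  in-K : ∀ {g} → H ⊩ g ∋ q → H ⊩ g ∋ con {Γ} (K {τ = 𝟎}) · q
  in-K {q = q} d = st-tm (con K · v0) (q ◂ ε) (λ { (here refl) → d })

  negative-cong : ∀ φ (f : Trm Γ (𝟏 ⟶ 𝟏)) → H ⊩ q ≐ r → H ⊩ negative φ f q → H ⊩ negative φ f r
  negative-cong φ f e d = ·-cong ≐-refl (·-cong ≐-refl (≐-sym e)) ⟫ d

  -- The right end starts at 1, where f ≤ 0 is known but f < 0 is not; hence the second alternative.
  signs : ∀ φ (f : Trm Γ (𝟏 ⟶ 𝟏)) n → H ⊩ ¬′ negative φ f 0ℚ →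
          H ⊩ ¬′ negative φ f (lo φ f n) ∧ (negative φ f (hi φ f n) ∨ hi φ f n ≐ 1ℚ)
  signs φ f n d = inst {As = ¬′ negative v2 v1 0ℚ ∷ []} (∀E (induction
    (¬′ negative v3 v2 (lo v3 v2 v0) ∧ (negative v3 v2 (hi v3 v2 v0) ∨ hi v3 v2 v0 ≐ 1ℚ)) ((tt , tt) , (tt , tt))
    (∧I (⊃I (⊃E h1 (negative-cong v2 v1 (lo-O v2 v1) h0))) (∨I₂ (hi-O v2 v1)))
    (∨E (step v3 v2 v0)
      (∧I (⊃I (⊃E (∧E₁ h2) (negative-cong v3 v2 (∧E₁ (∧E₂ h1)) h0)))
          (∨I₁ (negative-cong v3 v2 (≐-sym (∧E₂ (∧E₂ h0))) (∧E₁ h0))))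
      (∧I (⊃I (⊃E (∧E₁ h1) (negative-cong v3 v2 (∧E₁ (∧E₂ h1)) h0)))
          (∨E (∧E₂ h1) (∨I₁ (negative-cong v3 v2 (≐-sym (∧E₂ (∧E₂ h1))) h0)) (∨I₂ (∧E₂ (∧E₂ h1) ⟫ h0)))))) v0)
    (n ◂ f ◂ φ ◂ ε) (d ∷ [])

  start : ∀ {g} → g ∋ v0 ∷ decides g v1 ∷ con K · 0ℚ ≤ℝ v0 · (con K · 0ℚ) [ g ] ∷ [] ⊩
          ¬′ negative {(𝟏 ⟶ 𝟏) ∷ 𝟐 ∷ Γ} v1 v0 0ℚ
  start = ⊃I (∃ᵣE (⊃E (∧E₂ (∀ᵣE h2 (negative-at · v0 · 0ℚ) (st-tm (negative-at · v0 · 0ℚ) (v0 ◂ ε) (λ { (here refl) → h1 })))) h0)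
    (<ℚ-irrefl (<-≤ℚ-trans (negative-O⁻ v1 0ℚ v0 h0) (≤ℚ-resp K-red ≐-refl (∀ᵣE h5 v0 h1)))))

  -- The variables are k, f and φ.
  converges : ∀ {g} → g ∋ v2 ∷ g ∋ v1 ∷ g ∋ v0 ∷ continuous g v1 ∷ [] ⊩
    ∃[_] {𝟎 ∷ (𝟏 ⟶ 𝟏) ∷ 𝟐 ∷ Γ} g 𝟎 (near g (v2 · (limit · v3 · v2)) (v2 · (con K · lo v3 v2 v0)) v1 ∧
                                    near g (v2 · (limit · v3 · v2)) (v2 · (con K · hi v3 v2 v0)) v1)
  converges {g = g} = ∃ᵣE (∀ᵣE (⊃E (∀ᵣE h3 (limit · v2 · v1) (in-limit h0 h1)) (limit-𝕀 g v2 v1)) v0 h2) (have (in-S (in-S h1))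
    (∃ᵣI (S′ (S′ v0)) h0 (∧I
      (⊃E (⊃E (∀ᵣE h1 (con K · lo v3 v2 N) (in-K (in-lo h3 h4 h0)))
          (rational-𝕀 g _ (O≤lo v3 v2 N) (≤ℚ-trans (lo-≤-hi v3 v2 N) (hi≤1 v3 v2 N))))
        (∃ᵣI N h0 (near-intro (<ℚ-dist (β-limit v3 v2 N ⟫ ≐-sym K-red) (O<2^- _)))))
      (⊃E (⊃E (∀ᵣE h1 (con K · hi v3 v2 N) (in-K (in-hi h3 h4 h0)))
          (rational-𝕀 g _ (≤ℚ-trans (O≤lo v3 v2 N) (lo-≤-hi v3 v2 N)) (hi≤1 v3 v2 N)))
        (∃ᵣI N h0 (near-intro (<ℚ-resp (dist-cong (≐-sym (β-limit v3 v2 N)) (≐-sym K-red)) ≐-refl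
          (≤-<ℚ-trans (abs-≤ (≤ℚ-trans (lo-≤-hi v3 v2 N) (≤ℚ-+ (<ℚ⇒≤ℚ (O<2^- N)))) (proj₁ (width v3 v2 N))) (2^-S< (S′ v0))))))))))
    where
    -- Two more than the modulus of continuity: the interval has length 2^-N, for which the error
    -- terms at index N leave room as in `near-intro`.
    N : ∀ {Γ} → Trm (𝟎 ∷ Γ) 𝟎
    N = S′ (S′ v0)

  -- The variables are m, n, f and φ.
  bounds : ∀ {g} → g ∋ v3 ∷ g ∋ v2 ∷ g ∋ v1 ∷ g ∋ v0 ∷ decides g v3 ∷ v2 ∈C̄[ g ] ∷ [] ⊩
    0ℚ ≤ℚ neg-value {𝟎 ∷ 𝟎 ∷ (𝟏 ⟶ 𝟏) ∷ 𝟐 ∷ []} v2 (lo v3 v2 v1) v0 ∧ v2 · (con K · hi v3 v2 v1) · v0 ≤ℚ 2^- v0 +ℚ 2^- v0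
  bounds {g = g} = have (inst start (v2 ◂ v3 ◂ ε) (h1 ∷ h4 ∷ ∧E₁ (∧E₂ h5) ∷ [])) (∧I
    (inst (nonnegative {Γ = []}) (v0 ◂ lo v3 v2 v1 ◂ v2 ◂ v3 ◂ ε)
      (h5 ∷ h2 ∷ in-lo h1 h2 h3 ∷ h4 ∷ ∧E₁ (signs v3 v2 v1 h0) ∷ []))
    (∨E (∧E₂ (signs v3 v2 v1 h0))
      (inst (nonpositive {Γ = []}) (v0 ◂ hi v3 v2 v1 ◂ v2 ◂ v3 ◂ ε) (h6 ∷ h3 ∷ in-hi h2 h3 h4 ∷ h5 ∷ h0 ∷
        ⊃E (∀ᵣE (∧E₁ (∧E₁ (∧E₁ h7))) (con K · hi v3 v2 v1) (in-K (in-hi h2 h3 h4)))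
          (∧E₁ (rational-𝕀 g _ (≤ℚ-trans (O≤lo v3 v2 v1) (lo-≤-hi v3 v2 v1)) (hi≤1 v3 v2 v1))) ∷ []))
      (≤ℚ-trans (≤ℚ-resp (·-cong (·-cong ≐-refl (·-cong ≐-refl (≐-sym h0))) ≐-refl) (ap₂-cong plusℚ K-red ≐-refl)
        (∀ᵣE (∧E₂ (∧E₂ h7)) v0 h5)) (proj₁ O+))))

  -- The variables are k, i, f and φ.
  squeezed : ∀ {g} → g ∋ v3 ∷ g ∋ v2 ∷ g ∋ v1 ∷ g ∋ v0 ∷ decides g v3 ∷ v2 ∈C̄[ g ] ∷ v1 ≤ v0 ∷ [] ⊩
    ¬′ (2^- v1 +ℚ 2^- v0 ≤ℚ v2 · (limit · v3 · v2) · v1) ∧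
    ¬′ _≤ℚ_ {𝟎 ∷ 𝟎 ∷ (𝟏 ⟶ 𝟏) ∷ 𝟐 ∷ []} ((v2 · (limit · v3 · v2) · v1 +ℚ 2^- v1) +ℚ 2^- v0) 0ℚ
  squeezed {g = g} =
    have (⊃E (∀ᵣE (∧E₁ (∧E₁ (∧E₁ h5))) (limit · v3 · v2) (in-limit h0 h1)) (∧E₁ (limit-𝕀 g v3 v2)))
    (∃ᵣE (inst (converges {Γ = []}) (v0 ◂ v2 ◂ v3 ◂ ε) (h1 ∷ h2 ∷ h4 ∷ ∧E₂ (∧E₁ h6) ∷ [])) (∧I
      (⊃I (∃ᵣE (∧E₂ h1)
        (upper v3 v2 v0 (v4 · X · v0) (v4 · (con K · hi v5 v4 v1) · v0) (v4 · X · v3) h12 h0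
          (∧E₂ (inst bounds (v0 ◂ v1 ◂ v4 ◂ v5 ◂ ε) (h6 ∷ h7 ∷ h4 ∷ h1 ∷ h10 ∷ h11 ∷ []))) (cauchy g (v4 · X) v3 v0 h8 h1 h5 (index v3 v2 v0 (v4 · X · v0) (v4 · (con K · hi v5 v4 v1) · v0) (v4 · X · v3) h12 h0)) h2)))
      (⊃I (∃ᵣE (∧E₁ h1)
        (lower v3 v2 v0 (v4 · X · v0) (v4 · (con K · lo v5 v4 v1) · v0) (v4 · X · v3) h12 h0
          (∧E₁ (inst bounds (v0 ◂ v1 ◂ v4 ◂ v5 ◂ ε) (h6 ∷ h7 ∷ h4 ∷ h1 ∷ h10 ∷ h11 ∷ []))) (cauchy g (v4 · X) v3 v0 h8 h1 h5 (index v3 v2 v0 (v4 · X · v0) (v4 · (con K · lo v5 v4 v1) · v0) (v4 · X · v3) h12 h0)) h2)))))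
    where
    X : Trm (𝟎 ∷ 𝟎 ∷ 𝟎 ∷ 𝟎 ∷ (𝟏 ⟶ 𝟏) ∷ 𝟐 ∷ []) 𝟏
    X = limit · v5 · v4

  -- The accuracy used with `archimedean` is the product of the denominators concerned, plus `i` so
  -- as to be at least `i`. It is a term in the given data and therefore lies in the range.
  in-threshold : ∀ {g} (f : Trm Γ (𝟏 ⟶ 𝟏)) φ i → H ⊩ g ∋ φ → H ⊩ g ∋ f → H ⊩ g ∋ i →
    let z = f · (limit · φ · f) · i in
    H ⊩ g ∋ (d[ 2^- i ] ⊗ d[ z ] ⊕ i) × H ⊩ g ∋ (d[ z +ℚ 2^- i ] ⊗ d[ 0ℚ ] ⊕ i)
  in-threshold {H = H} {g} f φ i d e e′ =
    st-tm (d[ 2^- v0 ] ⊗ d[ v1 · (limit · v2 · v1) · v0 ] ⊕ v0) (i ◂ f ◂ φ ◂ ε) ins ,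
    st-tm (d[ v1 · (limit · v2 · v1) · v0 +ℚ 2^- v0 ] ⊗ d[ 0ℚ ] ⊕ v0) (i ◂ f ◂ φ ◂ ε) ins
    where
    ins : ∀ {τ} (x : τ ∈ 𝟎 ∷ (𝟏 ⟶ 𝟏) ∷ 𝟐 ∷ []) → H ⊩ g ∋ (i ◂ f ◂ φ ◂ ε) x
    ins (here refl)                 = e′
    ins (there (here refl))         = e
    ins (there (there (here refl))) = d

  -- By `archimedean`, a value at index i outside [-2^-i, 2^-i] would miss this interval by some
  -- 2^-k, against `squeezed`. Arguing by contradiction yields exactly the bound 2^-i that equality
  -- of reals asks for.
  limit-root : ∀ {g} → g ∋ v1 ∷ g ∋ v0 ∷ decides g v1 ∷ v0 ∈C̄[ g ] ∷ [] ⊩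
         v0 · (limit · v1 · v0) ≈ℝ con {(𝟏 ⟶ 𝟏) ∷ 𝟐 ∷ []} K · 0ℚ [ g ]
  limit-root {g = g} = ∀ᵣI (≤ℚ-resp (dist-cong ≐-refl (≐-sym K-red)) ≐-refl (abs-≤
    (∨E (≤ℚ-or-> z (2^- v0)) (≤ℚ-trans h0 (proj₂ O+))
      (absurd (⊃E (∧E₁ (inst squeezed (d[ 2^- v0 ] ⊗ d[ z ] ⊕ v0 ◂ v0 ◂ v1 ◂ v2 ◂ ε)
        (h2 ∷ h3 ∷ h1 ∷ proj₁ (in-threshold v1 v2 v0 h2 h3 h1) ∷ h4 ∷ h5 ∷ ≤-intro (⊕-comm _ _) ∷ [])))
        (archimedean _ (≤-intro ≐-refl) h0))))
    (∨E (≤ℚ-or-> 0ℚ (z +ℚ 2^- v0)) h0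
      (absurd (⊃E (∧E₂ (inst squeezed (d[ z +ℚ 2^- v0 ] ⊗ d[ 0ℚ ] ⊕ v0 ◂ v0 ◂ v1 ◂ v2 ◂ ε)
        (h2 ∷ h3 ∷ h1 ∷ proj₂ (in-threshold v1 v2 v0 h2 h3 h1) ∷ h4 ∷ h5 ∷ ≤-intro (⊕-comm _ _) ∷ [])))
        (archimedean _ (≤-intro ≐-refl) h0))))))
    where
    z : Trm (𝟎 ∷ (𝟏 ⟶ 𝟏) ∷ 𝟐 ∷ []) 𝟎
    z = v1 · (limit · v2 · v1) · v0

  ∃²⇒UIVT : {H : List (Fml [])} → H ⊩ ∃² → H ⊩ UIVT
  ∃²⇒UIVT d = ∃E d $ ∃I (limit · v0) $ ∀I $ ⊃I $ ∧I (limit-𝕀 full v1 v0)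
    (inst (limit-root {full}) (v0 ◂ v1 ◂ ε) (∋-full ∷ ∋-full ∷ h1 ∷ h0 ∷ []))

  -- If f vanishes anywhere it vanishes at μ(f), which is standard with f and μ. The functional
  -- therefore decides the existence of standard zeros, as bisection relative to `std` requires.
  value-at : Trm Γ (𝟐 ⟶ 𝟐)
  value-at = comb (𝟏 ∷ 𝟐 ∷ []) (v0 · (v1 · v0))

  β-value-at : (μ : Trm Γ 𝟐) (f : Trm Γ 𝟏) → H ⊩ value-at · μ · f ≐ f · (μ · f)
  β-value-at μ f = β (v0 · (v1 · v0)) (f ◂ μ ◂ ε)

  searches⇒decidesˢᵗ : st v0 ∷ searches ∷ [] ⊩ decides std (value-at · var {𝟐 ∷ Γ} (here refl))
  searches⇒decidesˢᵗ = ∀ᵣI $ ∧I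
    (⊃I (∃ᵣE h0 (β-value-at v2 v1 ⟫ ⊃E (∀E (∀E h5 v1) v0) h0)))
    (⊃I (∃ᵣI (v1 · v0) (st-tm (v1 · v0) (v0 ◂ v1 ◂ ε) (λ { (here refl) → h1 ; (there (here refl)) → h2 }))
      (≐-sym (β-value-at v1 v0) ⟫ h0)))

  excess : Trm Γ 𝟎 → Trm Γ 𝟎 → Trm Γ 𝟎
  excess q r = lhs q r ∸ rhs q r

  -- Vanishes at n iff the n-th condition for f(x) = 0 holds. Equality with 0 thereby takes the form
  -- to which Π⁰₁-TRANS applies.
  error : Trm Γ ((𝟏 ⟶ 𝟏) ⟶ 𝟏 ⟶ 𝟏)
  error = comb (𝟎 ∷ 𝟏 ∷ (𝟏 ⟶ 𝟏) ∷ []) (excess (∣ v2 · v1 · v0 -ℚ con K · 0ℚ · v0 ∣) (2^- v0))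

  β-error : (f : Trm Γ (𝟏 ⟶ 𝟏)) (x : Trm Γ 𝟏) (n : Trm Γ 𝟎) → H ⊩ error · f · x · n ≐
            excess (∣ f · x · n -ℚ con K · 0ℚ · n ∣) (2^- n)
  β-error f x n = β (excess (∣ v2 · v1 · v0 -ℚ con K · 0ℚ · v0 ∣) (2^- v0)) (n ◂ x ◂ f ◂ ε)

  rootˢᵗ⇒root : TRANS ∷ st v0 ∷ st v1 ∷ v1 · v0 ≈ℝ con K · 0ℚ [ std ] ∷ [] ⊩
                v1 · v0 ≈ℝ con {𝟏 ∷ (𝟏 ⟶ 𝟏) ∷ Γ} K · 0ℚ [ full ]
  rootˢᵗ⇒root = have (⊃E (⊃E (∀E h0 (error · v1 · v0))
      (st-tm (error · v1 · v0) (v0 ◂ v1 ◂ ε) (λ { (here refl) → h1 ; (there (here refl)) → h2 })))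
      (∀I (⊃I (β-error v2 v1 v0 ⟫ ≤E (≤ℚE (∀ᵣE h4 v0 h0))))))
    (∀I (≤ℚI (≤I (≐-sym (β-error v2 v1 v0) ⟫ ∀E h0 v0))))

  TRANS⇒IVT* : {H : List (Fml [])} → H ⊩ TRANS → H ⊩ IVT*
  TRANS⇒IVT* d = have d $ ∃E (search⇒ˢᵗ (∃²⇒search (TRANS⇒∃² h0))) $ ∀I $ ⊃I $ ⊃I $
    have {A = st (value-at · v1)} (st-tm (value-at · v0) (v1 ◂ ε) (λ { (here refl) → ∧E₁ h2 })) $
    have (in-limit h0 h2) $
    ∃I (limit · (value-at · v1) · v0) $ ∧I h0 $ ∧I (limit-𝕀 full (value-at · v1) v0) $
      inst (rootˢᵗ⇒root {[]}) (limit · (value-at · v1) · v0 ◂ v0 ◂ ε) (h5 ∷ h0 ∷ h3 ∷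
        inst (limit-root {std}) (v0 ◂ value-at · v1 ◂ ε) (h1 ∷ h3 ∷
          inst (searches⇒decidesˢᵗ {[]}) (v1 ◂ ε) (∧E₁ h4 ∷ ∧E₂ h4 ∷ []) ∷ h2 ∷ []) ∷ [])

-- Renaming and substitution for the combinatory terms.

module Substitution where

  open D hiding (sub; ren; renT; subT; wk; closed; v0; v1; v2; Sub; wkH; ∀ˢᵗ; ∃ˢᵗ; Internal; QuantifierFree; _⊢_) 

  private variable
    Sg : Signature
    Γ Δ Θ : Ctx
    ρ σ τ : Ty

  renT-cong : {r r′ : Ren Δ Γ} → (∀ {τ} (x : τ ∈ Δ) → r x ≡ r′ x) → (t : Tm Sg Δ σ) → D.renT r t ≡ D.renT r′ t
  renT-cong e (var x) = cong var (e x)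
  renT-cong e (con c) = refl
  renT-cong e (ext c) = refl
  renT-cong e (s · t) = cong₂ _·_ (renT-cong e s) (renT-cong e t)

  subT-cong : {s s′ : D.Sub Sg Δ Γ} → (∀ {τ} (x : τ ∈ Δ) → s x ≡ s′ x) → (t : Tm Sg Δ σ) → D.subT s t ≡ D.subT s′ t
  subT-cong e (var x) = e x
  subT-cong e (con c) = refl
  subT-cong e (ext c) = refl
  subT-cong e (s · t) = cong₂ _·_ (subT-cong e s) (subT-cong e t)

  renT-renT : (r : Ren Δ Θ) (r′ : Ren Θ Γ) (t : Tm Sg Δ σ) → D.renT r′ (D.renT r t) ≡ D.renT (r′ ∘ r) t
  renT-renT r r′ (var x) = refl
  renT-renT r r′ (con c) = refl
  renT-renT r r′ (ext c) = refl
  renT-renT r r′ (s · t) = cong₂ _·_ (renT-renT r r′ s) (renT-renT r r′ t)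

  subT-renT : (r : Ren Δ Θ) (s : D.Sub Sg Θ Γ) (t : Tm Sg Δ σ) → D.subT s (D.renT r t) ≡ D.subT (s ∘ r) t
  subT-renT r s (var x) = refl
  subT-renT r s (con c) = refl
  subT-renT r s (ext c) = refl
  subT-renT r s (t · u) = cong₂ _·_ (subT-renT r s t) (subT-renT r s u)

  renT-subT : (s : D.Sub Sg Δ Θ) (r : Ren Θ Γ) (t : Tm Sg Δ σ) → D.renT r (D.subT s t) ≡ D.subT (D.renT r ∘ s) t
  renT-subT s r (var x) = refl
  renT-subT s r (con c) = refl
  renT-subT s r (ext c) = refl
  renT-subT s r (t · u) = cong₂ _·_ (renT-subT s r t) (renT-subT s r u)

  subT-var : (t : Tm Sg Γ σ) → D.subT var t ≡ t
  subT-var (var x) = refl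
  subT-var (con c) = refl
  subT-var (ext c) = refl
  subT-var (s · t) = cong₂ _·_ (subT-var s) (subT-var t)

  renT-as-subT : (r : Ren Δ Γ) (t : Tm Sg Δ σ) → D.renT r t ≡ D.subT (var ∘ r) t
  renT-as-subT r (var x) = refl
  renT-as-subT r (con c) = refl
  renT-as-subT r (ext c) = refl
  renT-as-subT r (s · t) = cong₂ _·_ (renT-as-subT r s) (renT-as-subT r t)

  renT-liftR-wk : (r : Ren Δ Γ) (t : Tm Sg Δ σ) → D.renT (liftR {τ = τ} r) (D.wk t) ≡ D.wk (D.renT r t)
  renT-liftR-wk r t = trans (renT-renT there (liftR r) t) (sym (renT-renT r there t))

  subT-liftS-wk : (s : D.Sub Sg Δ Γ) (t : Tm Sg Δ σ) → D.subT (liftS {τ = τ} s) (D.wk t) ≡ D.wk (D.subT s t)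
  subT-liftS-wk s t = trans (subT-renT there (liftS s) t) (sym (renT-subT s there t))

  subT-single-wk : (u : Tm Sg Γ τ) (t : Tm Sg Γ σ) → D.subT (single u) (D.wk t) ≡ t
  subT-single-wk u t = trans (subT-renT there (single u) t) (subT-var t)

  renT-ƛ : (r : Ren Δ Γ) (t : Tm Sg (σ ∷ Δ) τ) → D.renT r (ƛ t) ≡ ƛ (D.renT (liftR r) t)
  renT-ƛ r (var (here refl)) = refl
  renT-ƛ r (var (there x)) = refl
  renT-ƛ r (con c) = refl
  renT-ƛ r (ext c) = refl
  renT-ƛ r (s · t) = cong₂ (λ a b → con S · a · b) (renT-ƛ r s) (renT-ƛ r t)

  infixl 20 _·≡_
  _·≡_ : {s s′ : Tm Sg Γ (σ ⟶ τ)} {t t′ : Tm Sg Γ σ} → s ≡ s′ → t ≡ t′ → s · t ≡ s′ · t′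
  refl ·≡ refl = refl

  Poly : Signature → Ty → Set
  Poly Sg σ = ∀ {Γ} → Tm Sg Γ σ

  -- A term such as `plus` is given separately in every context; the condition says that these
  -- instances are renamings of each other.
  Closed : Poly Sg σ → Set
  Closed {Sg} c = ∀ {Δ Γ} (r : Ren Δ Γ) → D.renT {Sg = Sg} r c ≡ c

  -- Open λ-terms over closed constants: renaming is computed on them without unfolding the
  -- abstractions of Defs.
  data Lam (Sg : Signature) (Γ : Ctx) : Ty → Set where
    var : σ ∈ Γ → Lam Sg Γ σ
    con : Const σ → Lam Sg Γ σ
    cl  : (c : Poly Sg σ) → Closed c → Lam Sg Γ σ
    _·_ : Lam Sg Γ (σ ⟶ τ) → Lam Sg Γ σ → Lam Sg Γ τ
    lam : Lam Sg (σ ∷ Γ) τ → Lam Sg Γ (σ ⟶ τ)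

  ⟪_⟫ : Lam Sg Γ σ → Tm Sg Γ σ
  ⟪ var x ⟫  = var x
  ⟪ con c ⟫  = con c
  ⟪ cl c _ ⟫ = c
  ⟪ s · t ⟫  = ⟪ s ⟫ · ⟪ t ⟫
  ⟪ lam t ⟫  = ƛ ⟪ t ⟫

  renL : Ren Δ Γ → Lam Sg Δ σ → Lam Sg Γ σ
  renL r (var x)  = var (r x)
  renL r (con c)  = con c
  renL r (cl c e) = cl c e
  renL r (s · t)  = renL r s · renL r t
  renL r (lam t)  = lam (renL (liftR r) t)

  ren-⟪⟫ : (r : Ren Δ Γ) (t : Lam Sg Δ σ) → D.renT r ⟪ t ⟫ ≡ ⟪ renL r t ⟫
  ren-⟪⟫ r (var x)  = refl
  ren-⟪⟫ r (con c)  = refl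
  ren-⟪⟫ r (cl c e) = e r
  ren-⟪⟫ r (s · t)  = ren-⟪⟫ r s ·≡ ren-⟪⟫ r t
  ren-⟪⟫ r (lam t)  = trans (renT-ƛ r ⟪ t ⟫) (cong ƛ (ren-⟪⟫ (liftR r) t))

  private
    pattern x0 = var (here refl)
    pattern x1 = var (there (here refl))
    pattern x3 = var (there (there (there (here refl))))
    pattern o = con zer

  -- The recursive functions are restated over abstract constituents, so that a statement about one
  -- does not unfold those it is built from. At the actual constituents they are the original terms
  -- by definition, as `ren-monus` and its successors use.
  module _ {Sg : Signature} (p : Poly Sg (𝟎 ⟶ 𝟎)) (ren-p : Closed p) where
    mon : Poly Sg _
    mon = ƛ (ƛ (con R₀ · D.v0 · D.v1 · ƛ (ƛ (p · D.v1))))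

    ren-mon : Closed mon
    ren-mon r = ren-⟪⟫ r (lam (lam (con R₀ · x0 · x1 · lam (lam (cl p ren-p · x1)))))

  module _ {Sg : Signature} (p : Poly Sg (𝟎 ⟶ 𝟎 ⟶ 𝟎)) (ren-p : Closed p) where
    mul dbl trn : Poly Sg _
    mul = ƛ (ƛ (con R₀ · D.v0 · num 0 · ƛ (ƛ (p · D.v1 · D.wk (D.wk D.v1)))))
    dbl = ƛ (con R₀ · D.v0 · num 1 · ƛ (ƛ (p · D.v1 · D.v1)))
    trn = ƛ (con R₀ · D.v0 · num 0 · ƛ (ƛ (p · D.v1 · (con suc · D.v0))))

    ren-mul : Closed mul
    ren-mul r = ren-⟪⟫ r (lam (lam (con R₀ · x0 · o · lam (lam (cl p ren-p · x1 · x3)))))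
    ren-dbl : Closed dbl
    ren-dbl r = ren-⟪⟫ r (lam (con R₀ · x0 · (con suc · o) · lam (lam (cl p ren-p · x1 · x1))))
    ren-trn : Closed trn
    ren-trn r = ren-⟪⟫ r (lam (con R₀ · x0 · o · lam (lam (cl p ren-p · x1 · (con suc · x0)))))

  module _ {Sg : Signature} (p m : Poly Sg (𝟎 ⟶ 𝟎 ⟶ 𝟎)) (t o′ : Poly Sg (𝟎 ⟶ 𝟎))
           (ren-p : Closed p) (ren-m : Closed m) (ren-t : Closed t) (ren-o : Closed o′) where
      roo pai pr₁ pr₂ : Poly Sg _
      roo = ƛ (con R₀ · D.v0 · num 0 · ƛ (ƛ (p · D.v1 · (m · num 1 · (m · (t · (con suc · D.v1)) · (con suc · D.v0))))))
      pai = ƛ (ƛ (p · (t · (p · D.v1 · D.v0)) · D.v1))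
      pr₁ = ƛ (m · D.v0 · (t · (o′ · D.v0)))
      pr₂ = ƛ (m · (t · D.v0) · (o′ · D.v0))

      ren-roo : Closed roo
      ren-roo r = ren-⟪⟫ r (lam (con R₀ · x0 · o · lam (lam (cl p ren-p · x1 · (cl m ren-m · (con suc · o) ·
                   (cl m ren-m · (cl t ren-t · (con suc · x1)) · (con suc · x0)))))))
      ren-pai : Closed pai
      ren-pai r = ren-⟪⟫ r (lam (lam (cl p ren-p · (cl t ren-t · (cl p ren-p · x1 · x0)) · x1)))
      ren-pr₁ : Closed pr₁
      ren-pr₁ r = ren-⟪⟫ r (lam (cl m ren-m · x0 · (cl t ren-t · (cl o′ ren-o · x0))))
      ren-pr₂ : Closed pr₂
      ren-pr₂ r = ren-⟪⟫ r (lam (cl m ren-m · (cl t ren-t · x0) · (cl o′ ren-o · x0)))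

  ren-pred : Closed {Sg} pred
  ren-pred r = refl

  ren-plus : Closed {Sg} plus
  ren-plus r = refl

  ren-monus : Closed {Sg} monus
  ren-monus = ren-mon pred ren-pred

  ren-times : Closed {Sg} times
  ren-times = ren-mul plus ren-plus

  ren-2^ : Closed {Sg} 2^
  ren-2^ = ren-dbl plus ren-plus

  ren-tri : Closed {Sg} tri
  ren-tri = ren-trn plus ren-plus

  ren-root : Closed {Sg} root
  ren-root = ren-roo plus monus tri tri ren-plus ren-monus ren-tri ren-tri

  ren-pair : Closed {Sg} pair
  ren-pair = ren-pai plus monus tri tri ren-plus ren-monus ren-tri ren-tri

  ren-π₁ : Closed {Sg} π₁
  ren-π₁ = ren-pr₁ plus monus tri root ren-plus ren-monus ren-tri ren-root

  ren-π₂ : Closed {Sg} π₂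
  ren-π₂ = ren-pr₂ plus monus root π₁ ren-plus ren-monus ren-root ren-π₁

  -- Every instance is a renaming of the one in the empty context, from which there is only one
  -- substitution up to pointwise equality.
  sub-closed : (c : Poly Sg σ) → Closed c → (s : D.Sub Sg Δ Γ) → D.subT s c ≡ c
  sub-closed c e s = trans (cong (D.subT s) (sym (e (λ ())))) (trans (subT-renT (λ ()) s (c {[]}))
    (trans (trans (subT-cong (λ ()) (c {[]})) (sym (renT-as-subT (λ ()) (c {[]})))) (e (λ ()))))

  ren-≐ : (r : Ren Δ Γ) (s t : Tm Sg Δ σ) → D.ren r (s ≐ t) ≡ (D.renT r s ≐ D.renT r t)
  ren-≐ {σ = 𝟎} r s t = refl
  ren-≐ {σ = σ ⟶ τ} r s t =
    cong (∀′ σ) (trans (ren-≐ (liftR r) (D.wk s · D.v0) (D.wk t · D.v0))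
      (cong₂ (λ a b → a · D.v0 ≐ b · D.v0) (renT-liftR-wk r s) (renT-liftR-wk r t)))
  ren-≐ {σ = σ ⋆} r s t = cong₂ _∧_ refl (cong (∀′ 𝟎) (cong₂ _⊃_
    (cong (_≈ num 0) (ren-monus (liftR r) ·≡ refl ·≡ (refl ·≡ renT-liftR-wk r s)))
    (trans (ren-≐ (liftR r) (con at · D.wk s · D.v0) (con at · D.wk t · D.v0))
      (cong₂ (λ a b → con at · a · D.v0 ≐ con at · b · D.v0) (renT-liftR-wk r s) (renT-liftR-wk r t)))))

  sub-≐ : (r : D.Sub Sg Δ Γ) (s t : Tm Sg Δ σ) → D.sub r (s ≐ t) ≡ (D.subT r s ≐ D.subT r t)
  sub-≐ {σ = 𝟎} r s t = refl
  sub-≐ {σ = σ ⟶ τ} r s t =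
    cong (∀′ σ) (trans (sub-≐ (liftS r) (D.wk s · D.v0) (D.wk t · D.v0))
      (cong₂ (λ a b → a · D.v0 ≐ b · D.v0) (subT-liftS-wk r s) (subT-liftS-wk r t)))
  sub-≐ {σ = σ ⋆} r s t = cong₂ _∧_ refl (cong (∀′ 𝟎) (cong₂ _⊃_
    (cong (_≈ num 0) (sub-closed monus ren-monus (liftS r) ·≡ refl ·≡ (refl ·≡ subT-liftS-wk r s)))
    (trans (sub-≐ (liftS r) (con at · D.wk s · D.v0) (con at · D.wk t · D.v0))
      (cong₂ (λ a b → con at · a · D.v0 ≐ con at · b · D.v0) (subT-liftS-wk r s) (subT-liftS-wk r t)))))

  infixr 4 _◃_

  εᴰ : D.Sub Sg [] Γ
  εᴰ ()

  _◃_ : Tm Sg Γ σ → D.Sub Sg Δ Γ → D.Sub Sg (σ ∷ Δ) Γ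
  (t ◃ s) (here refl) = t
  (t ◃ s) (there x)   = s x

  -- Substitution is left standing at an abstraction, since it does not commute with `ƛ`; the
  -- abstraction is opened only when `β-lam` supplies its argument.
  eval : D.Sub Sg Δ Γ → Lam Sg Δ σ → Tm Sg Γ σ
  eval s (var x)  = s x
  eval s (con c)  = con c
  eval s (cl c _) = c
  eval s (t · u)  = eval s t · eval s u
  eval s (lam t)  = D.subT s (ƛ ⟪ t ⟫)

  subT-⟪⟫ : (s : D.Sub Sg Δ Γ) (t : Lam Sg Δ σ) → D.subT s ⟪ t ⟫ ≡ eval s t
  subT-⟪⟫ s (var x)  = refl
  subT-⟪⟫ s (con c)  = refl
  subT-⟪⟫ s (cl c e) = sub-closed c e s
  subT-⟪⟫ s (t · u)  = subT-⟪⟫ s t ·≡ subT-⟪⟫ s u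
  subT-⟪⟫ s (lam t)  = refl

-- Deductions in the base theory: equality at all types and the recursion equations.

module Deductions (Lg : D.Signature) (Th : D.Theory Lg)
              (arith : ∀ {Γ} {A : D.Formula Lg Γ} → D.RCA₀ω Γ A → Th Γ A) where

  open D hiding (sub; ren; renT; subT; wk; closed; v0; v1; v2; Sub; wkH; ∀ˢᵗ; ∃ˢᵗ; Internal; QuantifierFree; _⊢_; _·_; _⇔_)
  open D using (_·_)
  open Substitution

  private variable
    Γ Δ Θ : Ctx
    ρ σ τ : Ty
    H : List (Formula Lg Γ)

  infix 3 _⊢_
  _⊢_ : List (Formula Lg Γ) → Formula Lg Γ → Set
  H ⊢ A = Th ∣ H ⊢ A

  Term : Ctx → Ty → Set
  Term = Tm Lg

  axiom : ∀ {A} → RCA₀ω Γ A → H ⊢ A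
  axiom a = ax (arith a)

  conv : ∀ {A B} → A ≡ B → H ⊢ A → H ⊢ B
  conv refl d = d

  mp² : ∀ {A B C} → H ⊢ A ⊃ B ⊃ C → H ⊢ A → H ⊢ B → H ⊢ C
  mp² d a b = ⊃E (⊃E d a) b

  ≐-app : {s t : Term Γ (σ ⟶ τ)} → H ⊢ s ≐ t → (u : Term Γ σ) → H ⊢ s · u ≐ t · u
  ≐-app {s = s} {t} d u = conv
    (trans (sub-≐ (single u) (D.wk s · D.v0) (D.wk t · D.v0))
      (cong₂ (λ a b → a · u ≐ b · u) (subT-single-wk u s) (subT-single-wk u t))) (∀E d u)

  ≐-arg : (f : Term Γ (σ ⟶ τ)) {s t : Term Γ σ} → H ⊢ s ≐ t → H ⊢ f · s ≐ f · t
  ≐-arg f d = ⊃E (axiom (extensionality f _ _)) d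

  ≐-reflexive : {s : Term Γ σ} → H ⊢ s ≐ s
  ≐-reflexive {σ = 𝟎}     = axiom (≈-refl _)
  ≐-reflexive {σ = σ ⟶ τ} = ∀I ≐-reflexive
  ≐-reflexive {σ = σ ⋆}   = ∧I (axiom (≈-refl _)) (∀I (⊃I ≐-reflexive))

  ≡→≐ : {s t : Term Γ σ} → s ≡ t → H ⊢ s ≐ t
  ≡→≐ refl = ≐-reflexive

  ≈sym : {s t : Term Γ 𝟎} → H ⊢ s ≈ t → H ⊢ t ≈ s
  ≈sym = ⊃E (axiom (≈-sym _ _))

  ≈tr : {s t u : Term Γ 𝟎} → H ⊢ s ≈ t → H ⊢ t ≈ u → H ⊢ s ≈ u
  ≈tr = mp² (axiom (≈-trans _ _ _))

  <-resp : (i s t : Term Γ 𝟎) → H ⊢ s ≈ t → H ⊢ i <′ s → H ⊢ i <′ t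
  <-resp i s t e d = ≈tr (≈sym (≐-arg (monus · (con suc · i)) e)) d

  ⋆-len : {s t : Term Γ (σ ⋆)} → H ⊢ s ≐ t → H ⊢ con len · s ≈ con len · t
  ⋆-len = ∧E₁

  ⋆-at : {s t : Term Γ (σ ⋆)} → H ⊢ s ≐ t → (i : Term Γ 𝟎) → H ⊢ i <′ con len · s →
         H ⊢ con at · s · i ≐ con at · t · i
  ⋆-at {s = s} {t} d i = ⊃E (conv
    (cong₂ _⊃_ (cong (_≈ num 0) (sub-closed monus ren-monus (single i) ·≡ refl ·≡
                  (refl ·≡ subT-single-wk i s)))
      (trans (sub-≐ (single i) (con at · D.wk s · D.v0) (con at · D.wk t · D.v0))
        (cong₂ (λ a b → con at · a · i ≐ con at · b · i) (subT-single-wk i s) (subT-single-wk i t))))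
    (∀E (∧E₂ d) i))

  hyp-≐ : {s t : Term Γ σ} → D.ren (there {x = τ}) (s ≐ t) ∷ H ⊢ D.wk s ≐ D.wk t
  hyp-≐ {s = s} {t} = conv (ren-≐ there s t) (hyp (here refl))

  -- By induction on the type. Being an implication rather than a rule, it can keep its premise
  -- among the hypotheses when `∀I` renames them; a derivation of the premise would first have to be
  -- weakened.
  ≐-symm : {s t : Term Γ σ} → H ⊢ s ≐ t ⊃ t ≐ s
  ≐-symm {σ = 𝟎}     = axiom (≈-sym _ _)
  ≐-symm {σ = σ ⟶ τ} {s = s} {t} = ⊃I (∀I (⊃E ≐-symm (≐-app (hyp-≐ {s = s} {t}) D.v0)))
  ≐-symm {σ = σ ⋆} {s = s} {t} = ⊃I (∧I (≈sym (∧E₁ (hyp (here refl))))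
    -- The renamed hypothesis is turned into an equation between the weakened terms and cut in,
    -- after which `⋆-at` applies to it.
    (∀I (⊃E (⊃I (⊃I (⊃E ≐-symm (⋆-at (hyp (there (here refl))) D.v0
        (<-resp D.v0 _ _ (≈sym (⋆-len {s = D.wk s} {D.wk t} (hyp (there (here refl))))) (hyp (here refl)))))))
      (hyp-≐ {s = s} {t}))))

  ≐-tran : {s t u : Term Γ σ} → H ⊢ s ≐ t ⊃ t ≐ u ⊃ s ≐ u
  ≐-tran {σ = 𝟎}     = axiom (≈-trans _ _ _)
  ≐-tran {σ = σ ⟶ τ} {s = s} {t} {u} = ⊃I (⊃I (∀I (mp² ≐-tran
    (≐-app (conv (ren-≐ there s t) (hyp (there (here refl)))) D.v0)
    (≐-app (conv (ren-≐ there t u) (hyp (here refl))) D.v0))))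
  ≐-tran {σ = σ ⋆} {s = s} {t} {u} = ⊃I (⊃I (∧I
    (≈tr (∧E₁ (hyp (there (here refl)))) (∧E₁ (hyp (here refl))))
    (∀I (mp² (⊃I (⊃I (⊃I (mp² ≐-tran
        (⋆-at (hyp (there (there (here refl)))) D.v0 (hyp (here refl)))
        (⋆-at (hyp (there (here refl))) D.v0
          (<-resp D.v0 _ _ (⋆-len {s = D.wk s} {D.wk t} (hyp (there (there (here refl))))) (hyp (here refl))))))))
      (conv (ren-≐ there s t) (hyp (there (here refl))))
      (conv (ren-≐ there t u) (hyp (here refl)))))))

  ≐sym : {s t : Term Γ σ} → H ⊢ s ≐ t → H ⊢ t ≐ s
  ≐sym = ⊃E ≐-symm

  infixr 2 _▸_
  _▸_ : {s t u : Term Γ σ} → H ⊢ s ≐ t → H ⊢ t ≐ u → H ⊢ s ≐ u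
  d ▸ e = mp² ≐-tran d e

  app-cong : {s s′ : Term Γ (σ ⟶ τ)} {t t′ : Term Γ σ} → H ⊢ s ≐ s′ → H ⊢ t ≐ t′ → H ⊢ s · t ≐ s′ · t′
  app-cong d e = ≐-app d _ ▸ ≐-arg _ e

  -- The substitution stands outside the abstraction, since moving it inside would change the
  -- combinators. The `S` and `K` axioms then follow the clauses of `ƛ`.
  β-ƛ : (s : D.Sub Lg Δ Γ) (t : Term (σ ∷ Δ) τ) (u : Term Γ σ) →
        H ⊢ D.subT s (ƛ t) · u ≐ D.subT (u ◃ s) t
  β-ƛ s (var (here refl)) u = axiom (S-ax _ _ _) ▸ axiom (K-ax _ _)
  β-ƛ s (var (there x)) u = axiom (K-ax _ _)
  β-ƛ s (con c) u = axiom (K-ax _ _)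
  β-ƛ s (ext c) u = axiom (K-ax _ _)
  β-ƛ s (t · t′) u = axiom (S-ax _ _ _) ▸ app-cong (β-ƛ s t u) (β-ƛ s t′ u)

  β-lam : (s : D.Sub Lg Δ Γ) (t : Lam Lg (σ ∷ Δ) τ) (u : Term Γ σ) →
          H ⊢ eval s (lam t) · u ≐ eval (u ◃ s) t
  β-lam s t u = β-ƛ s ⟪ t ⟫ u ▸ ≡→≐ (subT-⟪⟫ (u ◃ s) t)

  -- Primitive recursion with parameters Δ; the step has the argument and the value at it as
  -- innermost variables.
  recL : Lam Lg Δ 𝟎 → Lam Lg (𝟎 ∷ 𝟎 ∷ Δ) 𝟎 → Lam Lg (𝟎 ∷ Δ) 𝟎
  recL b q = con R₀ · var (here refl) · renL there b · renL there (lam (lam q))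

  eval-wk : (s : D.Sub Lg Δ Γ) (u : Term Γ τ) (t : Lam Lg Δ σ) → eval (u ◃ s) (renL there t) ≡ eval s t
  eval-wk s u t = trans (sym (subT-⟪⟫ (u ◃ s) (renL there t)))
    (trans (cong (D.subT (u ◃ s)) (sym (ren-⟪⟫ there t)))
    (trans (subT-renT there (u ◃ s) ⟪ t ⟫) (subT-⟪⟫ s t)))

  rec-unfold : (s : D.Sub Lg Δ Γ) (b : Lam Lg Δ 𝟎) (q : Lam Lg (𝟎 ∷ 𝟎 ∷ Δ) 𝟎) (n : Term Γ 𝟎) →
               eval (n ◃ s) (recL b q) ≡ con R₀ · n · eval s b · eval s (lam (lam q))
  rec-unfold s b q n = refl ·≡ eval-wk s n b ·≡ eval-wk s n (lam (lam q))

  rec-zer : (s : D.Sub Lg Δ Γ) (b : Lam Lg Δ 𝟎) (q : Lam Lg (𝟎 ∷ 𝟎 ∷ Δ) 𝟎) →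
            H ⊢ eval (con zer ◃ s) (recL b q) ≐ eval s b
  rec-zer s b q = ≡→≐ (rec-unfold s b q (con zer)) ▸ axiom (R₀-zer _ _)

  -- `v` is the previous value in the notation of the defined function, so that the recursion
  -- equation comes out free of its unfolded definition.
  rec-suc : (s : D.Sub Lg Δ Γ) (b : Lam Lg Δ 𝟎) (q : Lam Lg (𝟎 ∷ 𝟎 ∷ Δ) 𝟎) (n : Term Γ 𝟎) {v : Term Γ 𝟎} →
            H ⊢ eval (n ◃ s) (recL b q) ≐ v →
            H ⊢ eval (con suc · n ◃ s) (recL b q) ≐ eval (n ◃ v ◃ s) q
  rec-suc s b q n e = ≡→≐ (rec-unfold s b q (con suc · n)) ▸ axiom (R₀-suc _ _ _) ▸
    ≐-app (≐-arg (eval s (lam (lam q))) (≡→≐ (sym (rec-unfold s b q n)) ▸ e)) n ▸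
    ≐-app (β-lam s (lam q) _) n ▸ β-lam _ q n

  closed-eval : (c : Poly Lg σ) → Closed c → (t : Lam Lg [] σ) → c ≡ ⟪ t ⟫ → {Γ : Ctx} → c {Γ} ≡ eval εᴰ t
  closed-eval c cc t e = trans (sym (sub-closed c cc εᴰ)) (trans (cong (D.subT εᴰ) e) (subT-⟪⟫ εᴰ t))

  module Unary (c : Poly Lg (𝟎 ⟶ 𝟎)) (cc : Closed c) (t : Lam Lg (𝟎 ∷ []) 𝟎) (e : c ≡ ⟪ lam t ⟫) where
    unary : (n : Term Γ 𝟎) → H ⊢ c · n ≐ eval (n ◃ εᴰ) t
    unary n = ≐-app (≡→≐ (closed-eval c cc (lam t) e)) n ▸ β-lam εᴰ t n

  module Binary (c : Poly Lg (𝟎 ⟶ 𝟎 ⟶ 𝟎)) (cc : Closed c) (t : Lam Lg (𝟎 ∷ 𝟎 ∷ []) 𝟎) (e : c ≡ ⟪ lam (lam t) ⟫) where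
    binary : (m n : Term Γ 𝟎) → H ⊢ c · m · n ≐ eval (n ◃ m ◃ εᴰ) t
    binary m n = ≐-app (≐-app (≡→≐ (closed-eval c cc (lam (lam t)) e)) m ▸ β-lam εᴰ (lam t) m) n ▸ β-lam _ t n

  private
    pattern x0 = var (here refl)
    pattern x1 = var (there (here refl))
    pattern x2 = var (there (there (here refl)))
    pattern o = con zer

  -- The closed terms of Defs enter as variables, so that their normal forms stay small.
  module _ (p : Poly Lg (𝟎 ⟶ 𝟎)) (ren-p : Closed p) where
    private
      open module M = Binary (mon p ren-p) (ren-mon p ren-p) (recL x0 (cl p ren-p · x1)) refl

    mon-zer : (a : Term Γ 𝟎) → H ⊢ mon p ren-p · a · con zer ≐ a
    mon-zer a = binary a _ ▸ rec-zer (a ◃ εᴰ) x0 (cl p ren-p · x1)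

    mon-suc : (a b : Term Γ 𝟎) → H ⊢ mon p ren-p · a · (con suc · b) ≐ p · (mon p ren-p · a · b)
    mon-suc a b = binary a _ ▸ rec-suc (a ◃ εᴰ) x0 (cl p ren-p · x1) b (≐sym (binary a b))

  module _ (p : Poly Lg (𝟎 ⟶ 𝟎 ⟶ 𝟎)) (ren-p : Closed p) where
    private
      module M = Binary (mul p ren-p) (ren-mul p ren-p) (recL o (cl p ren-p · x1 · x2)) refl
      module P = Unary (dbl p ren-p) (ren-dbl p ren-p) (recL (con suc · o) (cl p ren-p · x1 · x1)) refl
      module T = Unary (trn p ren-p) (ren-trn p ren-p) (recL o (cl p ren-p · x1 · (con suc · x0))) refl

    mul-zer : (a : Term Γ 𝟎) → H ⊢ mul p ren-p · a · con zer ≐ con zer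
    mul-zer a = M.binary a _ ▸ rec-zer (a ◃ εᴰ) o (cl p ren-p · x1 · x2)
    mul-suc : (a b : Term Γ 𝟎) → H ⊢ mul p ren-p · a · (con suc · b) ≐ p · (mul p ren-p · a · b) · a
    mul-suc a b = M.binary a _ ▸ rec-suc (a ◃ εᴰ) o (cl p ren-p · x1 · x2) b (≐sym (M.binary a b))

    dbl-zer : H ⊢ dbl p ren-p {Γ} · con zer ≐ con suc · con zer
    dbl-zer = P.unary _ ▸ rec-zer εᴰ (con suc · o) (cl p ren-p · x1 · x1)
    dbl-suc : (b : Term Γ 𝟎) → H ⊢ dbl p ren-p · (con suc · b) ≐ p · (dbl p ren-p · b) · (dbl p ren-p · b)
    dbl-suc b = P.unary _ ▸ rec-suc εᴰ (con suc · o) (cl p ren-p · x1 · x1) b (≐sym (P.unary b))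

    trn-zer : H ⊢ trn p ren-p {Γ} · con zer ≐ con zer
    trn-zer = T.unary _ ▸ rec-zer εᴰ o (cl p ren-p · x1 · (con suc · x0))
    trn-suc : (b : Term Γ 𝟎) → H ⊢ trn p ren-p · (con suc · b) ≐ p · (trn p ren-p · b) · (con suc · b)
    trn-suc b = T.unary _ ▸ rec-suc εᴰ o (cl p ren-p · x1 · (con suc · x0)) b (≐sym (T.unary b))

  module _ (p m : Poly Lg (𝟎 ⟶ 𝟎 ⟶ 𝟎)) (t o′ : Poly Lg (𝟎 ⟶ 𝟎))
           (ren-p : Closed p) (ren-m : Closed m) (ren-t : Closed t) (ren-o : Closed o′) where
    private
      step : Lam Lg (𝟎 ∷ 𝟎 ∷ []) 𝟎
      step = cl p ren-p · x1 · (cl m ren-m · (con suc · o) ·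
               (cl m ren-m · (cl t ren-t · (con suc · x1)) · (con suc · x0)))
      roo′ : Poly Lg (𝟎 ⟶ 𝟎)
      roo′ = roo p m t o′ ren-p ren-m ren-t ren-o
      module R = Unary roo′ (ren-roo p m t o′ ren-p ren-m ren-t ren-o) (recL o step) refl

    roo-zer : H ⊢ roo′ {Γ} · con zer ≐ con zer
    roo-zer = R.unary _ ▸ rec-zer εᴰ o step
    roo-suc : (b : Term Γ 𝟎) → H ⊢ roo′ · (con suc · b) ≐
              p · (roo′ · b) · (m · num 1 · (m · (t · (con suc · (roo′ · b))) · (con suc · b)))
    roo-suc b = R.unary _ ▸ rec-suc εᴰ o step b (≐sym (R.unary b))

    pai-eq : (a b : Term Γ 𝟎) → H ⊢ pai p m t o′ ren-p ren-m ren-t ren-o · a · b ≐ p · (t · (p · a · b)) · a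
    pai-eq = Binary.binary (pai p m t o′ ren-p ren-m ren-t ren-o) (ren-pai p m t o′ ren-p ren-m ren-t ren-o)
      (cl p ren-p · (cl t ren-t · (cl p ren-p · x1 · x0)) · x1) refl

    pr₁-eq : (a : Term Γ 𝟎) → H ⊢ pr₁ p m t o′ ren-p ren-m ren-t ren-o · a ≐ m · a · (t · (o′ · a))
    pr₁-eq = Unary.unary (pr₁ p m t o′ ren-p ren-m ren-t ren-o) (ren-pr₁ p m t o′ ren-p ren-m ren-t ren-o)
      (cl m ren-m · x0 · (cl t ren-t · (cl o′ ren-o · x0))) refl

    pr₂-eq : (a : Term Γ 𝟎) → H ⊢ pr₂ p m t o′ ren-p ren-m ren-t ren-o · a ≐ m · (t · a) · (o′ · a)
    pr₂-eq = Unary.unary (pr₂ p m t o′ ren-p ren-m ren-t ren-o) (ren-pr₂ p m t o′ ren-p ren-m ren-t ren-o)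
      (cl m ren-m · (cl t ren-t · x0) · (cl o′ ren-o · x0)) refl

  private
    module PredEq = Unary pred ren-pred (recL o x0) refl
    module PlusEq = Binary plus ren-plus (recL x0 (con suc · x1)) refl

  pred-zer : H ⊢ pred {Γ = Γ} · con zer ≐ con zer
  pred-zer = PredEq.unary _ ▸ rec-zer εᴰ o x0
  pred-suc : (b : Term Γ 𝟎) → H ⊢ pred · (con suc · b) ≐ b
  pred-suc b = PredEq.unary _ ▸ rec-suc εᴰ o x0 b ≐-reflexive

  plus-zer : (a : Term Γ 𝟎) → H ⊢ a ⊕ con zer ≐ a
  plus-zer a = PlusEq.binary a _ ▸ rec-zer (a ◃ εᴰ) x0 (con suc · x1)
  plus-suc : (a b : Term Γ 𝟎) → H ⊢ a ⊕ con suc · b ≐ con suc · (a ⊕ b)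
  plus-suc a b = PlusEq.binary a _ ▸ rec-suc (a ◃ εᴰ) x0 (con suc · x1) b (≐sym (PlusEq.binary a b))

  times-zer : (a : Term Γ 𝟎) → H ⊢ a ⊗ con zer ≐ con zer
  times-zer = mul-zer plus ren-plus
  times-suc : (a b : Term Γ 𝟎) → H ⊢ a ⊗ (con suc · b) ≐ a ⊗ b ⊕ a
  times-suc = mul-suc plus ren-plus
  monus-zer : (a : Term Γ 𝟎) → H ⊢ a ∸ con zer ≐ a
  monus-zer = mon-zer pred ren-pred
  monus-suc : (a b : Term Γ 𝟎) → H ⊢ a ∸ con suc · b ≐ pred · (a ∸ b)
  monus-suc = mon-suc pred ren-pred
  pow-zer : H ⊢ 2^ {Γ = Γ} · con zer ≐ num 1
  pow-zer = dbl-zer plus ren-plus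
  pow-suc : (a : Term Γ 𝟎) → H ⊢ 2^ · (con suc · a) ≐ 2^ · a ⊕ 2^ · a
  pow-suc = dbl-suc plus ren-plus
  tri-zer : H ⊢ tri {Γ = Γ} · con zer ≐ con zer
  tri-zer = trn-zer plus ren-plus
  tri-suc : (a : Term Γ 𝟎) → H ⊢ tri · (con suc · a) ≐ tri · a ⊕ con suc · a
  tri-suc = trn-suc plus ren-plus
  root-zer : H ⊢ root {Γ = Γ} · con zer ≐ con zer
  root-zer = roo-zer plus monus tri tri ren-plus ren-monus ren-tri ren-tri
  root-suc : (a : Term Γ 𝟎) → H ⊢ root · (con suc · a) ≐
             root · a ⊕ (num 1 ∸ (tri · (con suc · (root · a)) ∸ con suc · a))
  root-suc = roo-suc plus monus tri tri ren-plus ren-monus ren-tri ren-tri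
  pair-eq : (a b : Term Γ 𝟎) → H ⊢ pair · a · b ≐ tri · (a ⊕ b) ⊕ a
  pair-eq = pai-eq plus monus tri tri ren-plus ren-monus ren-tri ren-tri
  π₁-eq : (a : Term Γ 𝟎) → H ⊢ π₁ · a ≐ a ∸ tri · (root · a)
  π₁-eq = pr₁-eq plus monus tri root ren-plus ren-monus ren-tri ren-root
  π₂-eq : (a : Term Γ 𝟎) → H ⊢ π₂ · a ≐ root · a ∸ π₁ · a
  π₂-eq = pr₂-eq plus monus root π₁ ren-plus ren-monus ren-root ren-π₁

-- Interpretation of the calculus in the combinatory language.

module Interpretation (Lg : D.Signature) (X : Substitution.Poly Lg D.𝟐) (ren-X : Substitution.Closed X) where

  open D using (Ty; 𝟎; 𝟏; 𝟐; _⟶_; _⋆; Ctx; Const; Tm; liftS; liftR; single; Ren)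
  open Substitution
  open Const
  open Calculus

  private variable
    Θ : Ctx

  Term : Ctx → Ty → Set
  Term = Tm Lg

  ƛ* : (Θ : Ctx) → Term Θ τ → Term [] (Θ ⇒ τ)
  ƛ* []      t = t
  ƛ* (σ ∷ Θ) t = ƛ* Θ (D.ƛ t)

  fn₁ : Fn₁ → Term Γ 𝟎 → Term Γ 𝟎
  fn₁ pred t = D.pred D.· t
  fn₁ pow  t = D.2^ D.· t
  fn₁ tri  t = D.tri D.· t
  fn₁ root t = D.root D.· t
  fn₁ π₁   t = D.π₁ D.· t
  fn₁ π₂   t = D.π₂ D.· t
  fn₁ pos  t = D.pos t
  fn₁ neg  t = D.neg t
  fn₁ den  t = D.den t
  fn₁ abs  t = D.∣ t ∣ℚ
  fn₁ inv  t = D.2^- t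

  fn₂ : Fn₂ → Term Γ 𝟎 → Term Γ 𝟎 → Term Γ 𝟎
  fn₂ plus   s t = s D.⊕ t
  fn₂ times  s t = s D.⊗ t
  fn₂ monus  s t = s D.∸ t
  fn₂ pair   s t = D.pair D.· s D.· t
  fn₂ plusℚ  s t = s D.+ℚ t
  fn₂ minusℚ s t = s D.-ℚ t

  -- Interpreting in an environment turns substitution in the calculus into a change of environment.
  -- A supercombinator is closed and disregards the environment, so the obstacle posed by `ƛ` does
  -- not arise.
  ⟦_⟧ : Trm Δ σ → D.Sub Lg Δ Γ → Term Γ σ
  ⟦ var x ⟧ ρ     = ρ x
  ⟦ con c ⟧ ρ     = Tm.con c
  ⟦ Ξ ⟧ ρ         = X
  ⟦ comb Θ t ⟧ ρ  = D.closed (ƛ* Θ (⟦ t ⟧ Tm.var))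
  ⟦ s · t ⟧ ρ     = ⟦ s ⟧ ρ D.· ⟦ t ⟧ ρ
  ⟦ ap₁ f t ⟧ ρ   = fn₁ f (⟦ t ⟧ ρ)
  ⟦ ap₂ f s t ⟧ ρ = fn₂ f (⟦ s ⟧ ρ) (⟦ t ⟧ ρ)

  within : Range → Term Γ σ → D.Formula Lg Γ
  within full t = D.num 0 D.≈ D.num 0
  within std  t = D.Formula.st t

  all some : Range → (σ : Ty) → D.Formula Lg (σ ∷ Γ) → D.Formula Lg Γ
  all full = D.Formula.∀′
  all std  = D.∀ˢᵗ
  some full = D.Formula.∃′
  some std  = D.∃ˢᵗ

  ⟦_⟧ᶠ : Fml Δ → D.Sub Lg Δ Γ → D.Formula Lg Γ
  ⟦ s ≐ t ⟧ᶠ ρ  = ⟦ s ⟧ ρ D.≐ ⟦ t ⟧ ρ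
  ⟦ g ∋ t ⟧ᶠ ρ  = within g (⟦ t ⟧ ρ)
  ⟦ s ≤ t ⟧ᶠ ρ  = ⟦ s ⟧ ρ D.≤′ ⟦ t ⟧ ρ
  ⟦ s ≤ℚ t ⟧ᶠ ρ = ⟦ s ⟧ ρ D.≤ℚ ⟦ t ⟧ ρ
  ⟦ s <ℚ t ⟧ᶠ ρ = ⟦ s ⟧ ρ D.<ℚ ⟦ t ⟧ ρ
  ⟦ ⊥′ ⟧ᶠ ρ     = D.Formula.⊥′
  ⟦ A ∧ B ⟧ᶠ ρ  = ⟦ A ⟧ᶠ ρ D.∧ ⟦ B ⟧ᶠ ρ
  ⟦ A ∨ B ⟧ᶠ ρ  = ⟦ A ⟧ᶠ ρ D.∨ ⟦ B ⟧ᶠ ρ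
  ⟦ A ⊃ B ⟧ᶠ ρ  = ⟦ A ⟧ᶠ ρ D.⊃ ⟦ B ⟧ᶠ ρ
  ⟦ ∀[ g ] σ A ⟧ᶠ ρ = all g σ (⟦ A ⟧ᶠ (liftS ρ))
  ⟦ ∃[ g ] σ A ⟧ᶠ ρ = some g σ (⟦ A ⟧ᶠ (liftS ρ))

  infix 4 _≗ˢ_
  _≗ˢ_ : D.Sub Lg Δ Γ → D.Sub Lg Δ Γ → Set
  ρ ≗ˢ ρ′ = ∀ {τ} (x : τ ∈ _) → ρ x ≡ ρ′ x

  ⟦⟧-cong : {ρ ρ′ : D.Sub Lg Δ Γ} → ρ ≗ˢ ρ′ → (t : Trm Δ σ) → ⟦ t ⟧ ρ ≡ ⟦ t ⟧ ρ′
  ⟦⟧-cong e (var x)     = e x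
  ⟦⟧-cong e (con c)     = refl
  ⟦⟧-cong e Ξ           = refl
  ⟦⟧-cong e (comb Θ t)  = refl
  ⟦⟧-cong e (s · t)     = cong₂ D._·_ (⟦⟧-cong e s) (⟦⟧-cong e t)
  ⟦⟧-cong e (ap₁ f t)   = cong (fn₁ f) (⟦⟧-cong e t)
  ⟦⟧-cong e (ap₂ f s t) = cong₂ (fn₂ f) (⟦⟧-cong e s) (⟦⟧-cong e t)

  liftS-cong : {ρ ρ′ : D.Sub Lg Δ Γ} → ρ ≗ˢ ρ′ → liftS {τ = τ} ρ ≗ˢ liftS ρ′
  liftS-cong e (here p)  = refl
  liftS-cong e (there x) = cong D.wk (e x)

  ⟦⟧ᶠ-cong : {ρ ρ′ : D.Sub Lg Δ Γ} → ρ ≗ˢ ρ′ → (A : Fml Δ) → ⟦ A ⟧ᶠ ρ ≡ ⟦ A ⟧ᶠ ρ′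
  ⟦⟧ᶠ-cong e (s ≐ t)  = cong₂ D._≐_ (⟦⟧-cong e s) (⟦⟧-cong e t)
  ⟦⟧ᶠ-cong e (g ∋ t)  = cong (within g) (⟦⟧-cong e t)
  ⟦⟧ᶠ-cong e (s ≤ t)  = cong₂ D._≤′_ (⟦⟧-cong e s) (⟦⟧-cong e t)
  ⟦⟧ᶠ-cong e (s ≤ℚ t) = cong₂ D._≤ℚ_ (⟦⟧-cong e s) (⟦⟧-cong e t)
  ⟦⟧ᶠ-cong e (s <ℚ t) = cong₂ D._<ℚ_ (⟦⟧-cong e s) (⟦⟧-cong e t)
  ⟦⟧ᶠ-cong e ⊥′       = refl
  ⟦⟧ᶠ-cong e (A ∧ B)  = cong₂ D._∧_ (⟦⟧ᶠ-cong e A) (⟦⟧ᶠ-cong e B)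
  ⟦⟧ᶠ-cong e (A ∨ B)  = cong₂ D._∨_ (⟦⟧ᶠ-cong e A) (⟦⟧ᶠ-cong e B)
  ⟦⟧ᶠ-cong e (A ⊃ B)  = cong₂ D._⊃_ (⟦⟧ᶠ-cong e A) (⟦⟧ᶠ-cong e B)
  ⟦⟧ᶠ-cong e (∀[ g ] σ A) = cong (all g σ) (⟦⟧ᶠ-cong (liftS-cong e) A)
  ⟦⟧ᶠ-cong e (∃[ g ] σ A) = cong (some g σ) (⟦⟧ᶠ-cong (liftS-cong e) A)

  ⟦renT⟧ : (r : Ren Δ Θ) (ρ : D.Sub Lg Θ Γ) (t : Trm Δ σ) → ⟦ renT r t ⟧ ρ ≡ ⟦ t ⟧ (ρ ∘ r)
  ⟦renT⟧ r ρ (var x)     = refl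
  ⟦renT⟧ r ρ (con c)     = refl
  ⟦renT⟧ r ρ Ξ           = refl
  ⟦renT⟧ r ρ (comb _ t)  = refl
  ⟦renT⟧ r ρ (s · t)     = cong₂ D._·_ (⟦renT⟧ r ρ s) (⟦renT⟧ r ρ t)
  ⟦renT⟧ r ρ (ap₁ f t)   = cong (fn₁ f) (⟦renT⟧ r ρ t)
  ⟦renT⟧ r ρ (ap₂ f s t) = cong₂ (fn₂ f) (⟦renT⟧ r ρ s) (⟦renT⟧ r ρ t)

  ⟦subT⟧ : (s : Subst Δ Θ) (ρ : D.Sub Lg Θ Γ) (t : Trm Δ σ) → ⟦ subT s t ⟧ ρ ≡ ⟦ t ⟧ (λ x → ⟦ s x ⟧ ρ)
  ⟦subT⟧ s ρ (var x)     = refl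
  ⟦subT⟧ s ρ (con c)     = refl
  ⟦subT⟧ s ρ Ξ           = refl
  ⟦subT⟧ s ρ (comb _ t)  = refl
  ⟦subT⟧ s ρ (t · u)     = cong₂ D._·_ (⟦subT⟧ s ρ t) (⟦subT⟧ s ρ u)
  ⟦subT⟧ s ρ (ap₁ f t)   = cong (fn₁ f) (⟦subT⟧ s ρ t)
  ⟦subT⟧ s ρ (ap₂ f t u) = cong₂ (fn₂ f) (⟦subT⟧ s ρ t) (⟦subT⟧ s ρ u)

  -- What renaming and substitution in the language of Defs have in common.
  record Hom (Γ Γ′ : Ctx) : Set where
    field
      map-tm  : Term Γ σ → Term Γ′ σ
      map-fm  : D.Formula Lg Γ → D.Formula Lg Γ′
      map-con : (c : Const σ) → map-tm (Tm.con c) ≡ Tm.con c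
      map-cl  : (c : Poly Lg σ) → Closed c → map-tm c ≡ c
      map-≈   : (s t : Term Γ 𝟎) → map-fm (s D.≈ t) ≡ (map-tm s D.≈ map-tm t)
      map-·   : (s : Term Γ (σ ⟶ τ)) (t : Term Γ σ) → map-tm (s D.· t) ≡ map-tm s D.· map-tm t

    infix 4 _↦_
    _↦_ : Term Γ σ → Term Γ′ σ → Set
    t ↦ t′ = map-tm t ≡ t′

    infixl 20 _↦·_
    _↦·_ : {s : Term Γ (σ ⟶ τ)} {s′ : Term Γ′ (σ ⟶ τ)} {t : Term Γ σ} {t′ : Term Γ′ σ} →
           s ↦ s′ → t ↦ t′ → s D.· t ↦ s′ D.· t′
    refl ↦· refl = map-· _ _

    -- Abstracting over the closed terms keeps them from being unfolded.
    map-app : (c : Poly Lg (σ ⟶ τ)) → Closed c → ∀ t → c D.· t ↦ c D.· map-tm t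
    map-app c e t = map-cl c e ↦· refl
    map-app₂ : (c : Poly Lg (ρ ⟶ σ ⟶ τ)) → Closed c → ∀ s t → c D.· s D.· t ↦ c D.· map-tm s D.· map-tm t
    map-app₂ c e s t = map-app c e s ↦· refl
    map-app∘ : (c : Poly Lg (σ ⟶ τ)) (d : Poly Lg (ρ ⟶ σ)) → Closed c → Closed d → ∀ t →
               c D.· (d D.· t) ↦ c D.· (d D.· map-tm t)
    map-app∘ c d e e′ t = map-cl c e ↦· map-app d e′ t
    map-triple : (c : Poly Lg (𝟎 ⟶ 𝟎 ⟶ 𝟎)) (d : Poly Lg (𝟎 ⟶ 𝟎)) → Closed c → Closed d →
                 ∀ {s t u s′ t′ u′} → s ↦ s′ → t ↦ t′ → u ↦ u′ →
                 c D.· (c D.· s D.· t) D.· (d D.· u) ↦ c D.· (c D.· s′ D.· t′) D.· (d D.· u′)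
    map-triple c d e e′ p q r = map-cl c e ↦· (map-cl c e ↦· p ↦· q) ↦· (map-cl d e′ ↦· r)

    map-⊕ : ∀ s t → s D.⊕ t ↦ map-tm s D.⊕ map-tm t
    map-⊕ = map-app₂ D.plus ren-plus
    map-⊗ : ∀ s t → s D.⊗ t ↦ map-tm s D.⊗ map-tm t
    map-⊗ = map-app₂ D.times ren-times
    map-∸ : ∀ s t → s D.∸ t ↦ map-tm s D.∸ map-tm t
    map-∸ = map-app₂ D.monus ren-monus
    map-pos : ∀ q → D.pos q ↦ D.pos (map-tm q)
    map-pos = map-app∘ D.π₁ D.π₁ ren-π₁ ren-π₁
    map-neg : ∀ q → D.neg q ↦ D.neg (map-tm q)
    map-neg = map-app∘ D.π₂ D.π₁ ren-π₂ ren-π₁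
    map-den : ∀ q → D.den q ↦ D.den (map-tm q)
    map-den = map-app∘ (Tm.con suc) D.π₂ (λ _ → refl) ren-π₂
    map-mkℚ : ∀ {a b d a′ b′ d′} → a ↦ a′ → b ↦ b′ → d ↦ d′ → D.mkℚ a b d ↦ D.mkℚ a′ b′ d′
    map-mkℚ = map-triple D.pair D.pred ren-pair ren-pred
    map-cross : ∀ {a b c d a′ b′ c′ d′} → a ↦ a′ → b ↦ b′ → c ↦ c′ → d ↦ d′ →
                a D.⊗ b D.⊕ c D.⊗ d ↦ a′ D.⊗ b′ D.⊕ c′ D.⊗ d′
    map-cross refl refl refl refl = trans (map-⊕ _ _) (cong₂ D._⊕_ (map-⊗ _ _) (map-⊗ _ _))

    map-fn₁ : ∀ f t → fn₁ f t ↦ fn₁ f (map-tm t)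
    map-fn₁ pred t = map-app D.pred ren-pred t
    map-fn₁ pow t = map-app D.2^ ren-2^ t
    map-fn₁ tri t = map-app D.tri ren-tri t
    map-fn₁ root t = map-app D.root ren-root t
    map-fn₁ π₁ t = map-app D.π₁ ren-π₁ t
    map-fn₁ π₂ t = map-app D.π₂ ren-π₂ t
    map-fn₁ pos  t = map-pos t
    map-fn₁ neg  t = map-neg t
    map-fn₁ den  t = map-den t
    map-fn₁ abs  t = map-mkℚ
      (trans (map-⊕ _ _) (cong₂ D._⊕_
        (trans (map-∸ _ _) (cong₂ D._∸_ (map-pos t) (map-neg t)))
        (trans (map-∸ _ _) (cong₂ D._∸_ (map-neg t) (map-pos t)))))
      (map-con zer) (map-den t)
    map-fn₁ inv  t = map-mkℚ (map-con suc ↦· map-con zer) (map-con zer) (map-app D.2^ ren-2^ t)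

    map-fn₂ : ∀ f s t → fn₂ f s t ↦ fn₂ f (map-tm s) (map-tm t)
    map-fn₂ plus   s t = map-⊕ s t
    map-fn₂ times  s t = map-⊗ s t
    map-fn₂ monus  s t = map-∸ s t
    map-fn₂ pair   s t = map-app₂ D.pair ren-pair s t
    map-fn₂ plusℚ  s t = map-mkℚ (map-cross (map-pos s) (map-den t) (map-pos t) (map-den s))
      (map-cross (map-neg s) (map-den t) (map-neg t) (map-den s))
      (trans (map-⊗ _ _) (cong₂ D._⊗_ (map-den s) (map-den t)))
    map-fn₂ minusℚ s t = map-mkℚ (map-cross (map-pos s) (map-den t) (map-neg t) (map-den s))
      (map-cross (map-neg s) (map-den t) (map-pos t) (map-den s))
      (trans (map-⊗ _ _) (cong₂ D._⊗_ (map-den s) (map-den t)))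

    map-⟦⟧ : (ρ : D.Sub Lg Δ Γ) (t : Trm Δ σ) → ⟦ t ⟧ ρ ↦ ⟦ t ⟧ (map-tm ∘ ρ)
    map-⟦⟧ ρ (var x)     = refl
    map-⟦⟧ ρ (con c)     = map-con c
    map-⟦⟧ ρ Ξ           = map-cl X ren-X
    map-⟦⟧ ρ (comb Θ t)  = map-cl (D.closed (ƛ* Θ (⟦ t ⟧ Tm.var)))
      (λ r → trans (renT-renT (λ ()) r (ƛ* Θ (⟦ t ⟧ Tm.var))) (renT-cong (λ ()) (ƛ* Θ (⟦ t ⟧ Tm.var))))
    map-⟦⟧ ρ (s · t)     = map-⟦⟧ ρ s ↦· map-⟦⟧ ρ t
    map-⟦⟧ ρ (ap₁ f t)   = trans (map-fn₁ f _) (cong (fn₁ f) (map-⟦⟧ ρ t))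
    map-⟦⟧ ρ (ap₂ f s t) = trans (map-fn₂ f _ _) (cong₂ (fn₂ f) (map-⟦⟧ ρ s) (map-⟦⟧ ρ t))

    map-≤ : ∀ s t {s′ t′} → s ↦ s′ → t ↦ t′ → map-fm (s D.≤′ t) ≡ (s′ D.≤′ t′)
    map-≤ s t refl refl = trans (map-≈ _ _) (cong₂ D._≈_ (map-∸ s t) (map-con zer))

    map-≤ℚ : ∀ q r {q′ r′} → q ↦ q′ → r ↦ r′ → map-fm (q D.≤ℚ r) ≡ (q′ D.≤ℚ r′)
    map-≤ℚ q r refl refl = map-≤ _ _ (map-cross (map-pos q) (map-den r) (map-neg r) (map-den q))
                                     (map-cross (map-pos r) (map-den q) (map-neg q) (map-den r))

    map-<ℚ : ∀ q r {q′ r′} → q ↦ q′ → r ↦ r′ → map-fm (q D.<ℚ r) ≡ (q′ D.<ℚ r′)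
    map-<ℚ q r refl refl = map-≤ _ _
      (map-con suc ↦· map-cross (map-pos q) (map-den r) (map-neg r) (map-den q))
      (map-cross (map-pos r) (map-den q) (map-neg q) (map-den r))

  open Hom

  renHom : Ren Γ Δ → Hom Γ Δ
  renHom r = record { map-tm = D.renT r ; map-fm = D.ren r ; map-≈ = λ _ _ → refl ; map-con = λ _ → refl
                    ; map-cl = λ c e → e r ; map-· = λ _ _ → refl }

  subHom : D.Sub Lg Γ Δ → Hom Γ Δ
  subHom s = record { map-tm = D.subT s ; map-fm = D.sub s ; map-≈ = λ _ _ → refl ; map-con = λ _ → refl
                    ; map-cl = λ c e → sub-closed c e s ; map-· = λ _ _ → refl }

  -- A family of such maps that can be taken beneath a quantifier. Renamings and substitutions are
  -- both of this kind, so that their commutation with the interpretation of formulas is proved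
  -- once, as `map⟦⟧ᶠ`.
  record Homs (M : Ctx → Ctx → Set) : Set where
    field
      hom   : M Γ Δ → Hom Γ Δ
      up    : M Γ Δ → M (τ ∷ Γ) (τ ∷ Δ)
      up-v0 : (m : M Γ Δ) (p : σ ≡ τ) → map-tm (hom (up m)) (Tm.var (here p)) ≡ Tm.var (here p)
      up-wk : (m : M Γ Δ) (t : Term Γ σ) → map-tm (hom (up {τ = τ} m)) (D.wk t) ≡ D.wk (map-tm (hom m) t)
      on-≐  : (m : M Γ Δ) (s t : Term Γ σ) → map-fm (hom m) (s D.≐ t) ≡ (map-tm (hom m) s D.≐ map-tm (hom m) t)
      on-st : (m : M Γ Δ) (t : Term Γ σ) → map-fm (hom m) (D.Formula.st t) ≡ D.Formula.st (map-tm (hom m) t)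
      on-⊥  : (m : M Γ Δ) → map-fm (hom m) D.Formula.⊥′ ≡ D.Formula.⊥′
      on-∧  : (m : M Γ Δ) → ∀ A B → map-fm (hom m) (A D.∧ B) ≡ (map-fm (hom m) A D.∧ map-fm (hom m) B)
      on-∨  : (m : M Γ Δ) → ∀ A B → map-fm (hom m) (A D.∨ B) ≡ (map-fm (hom m) A D.∨ map-fm (hom m) B)
      on-⊃  : (m : M Γ Δ) → ∀ A B → map-fm (hom m) (A D.⊃ B) ≡ (map-fm (hom m) A D.⊃ map-fm (hom m) B)
      on-∀  : (m : M Γ Δ) → ∀ σ A → map-fm (hom m) (D.Formula.∀′ σ A) ≡ D.Formula.∀′ σ (map-fm (hom (up m)) A)
      on-∃  : (m : M Γ Δ) → ∀ σ A → map-fm (hom m) (D.Formula.∃′ σ A) ≡ D.Formula.∃′ σ (map-fm (hom (up m)) A)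

    up-liftS : (m : M Θ Γ) (ρ : D.Sub Lg Δ Θ) →
               (λ {τ} (x : τ ∈ (σ ∷ Δ)) → map-tm (hom (up m)) (liftS ρ x)) ≗ˢ liftS (map-tm (hom m) ∘ ρ)
    up-liftS m ρ (here p)  = up-v0 m p
    up-liftS m ρ (there x) = up-wk m (ρ x)

    on-within : (m : M Γ Δ) → ∀ g (t : Term Γ σ) → map-fm (hom m) (within g t) ≡ within g (map-tm (hom m) t)
    on-within m full t = trans (map-≈ (hom m) _ _) (cong₂ D._≈_ (map-con (hom m) zer) (map-con (hom m) zer))
    on-within m std  t = on-st m t

    on-st-v0 : (m : M Γ Δ) → map-fm (hom (up {τ = σ} m)) (D.Formula.st (D.v0 {σ = σ})) ≡ D.Formula.st D.v0
    on-st-v0 m = trans (on-st (up m) D.v0) (cong D.Formula.st (up-v0 m refl))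

    on-all : (m : M Γ Δ) → ∀ g σ A → map-fm (hom m) (all g σ A) ≡ all g σ (map-fm (hom (up m)) A)
    on-all m full σ A = on-∀ m σ A
    on-all m std  σ A = trans (on-∀ m σ _) (cong (D.Formula.∀′ σ) (trans (on-⊃ (up m) _ A) (cong (λ B → B D.⊃ map-fm (hom (up m)) A) (on-st-v0 m))))

    on-some : (m : M Γ Δ) → ∀ g σ A → map-fm (hom m) (some g σ A) ≡ some g σ (map-fm (hom (up m)) A)
    on-some m full σ A = on-∃ m σ A
    on-some m std  σ A = trans (on-∃ m σ _) (cong (D.Formula.∃′ σ) (trans (on-∧ (up m) _ A) (cong (λ B → B D.∧ map-fm (hom (up m)) A) (on-st-v0 m))))

    map⟦⟧ᶠ : (m : M Θ Γ) (ρ : D.Sub Lg Δ Θ) (A : Fml Δ) → map-fm (hom m) (⟦ A ⟧ᶠ ρ) ≡ ⟦ A ⟧ᶠ (map-tm (hom m) ∘ ρ)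
    map⟦⟧ᶠ m ρ (s ≐ t)  = trans (on-≐ m _ _) (cong₂ D._≐_ (map-⟦⟧ (hom m) ρ s) (map-⟦⟧ (hom m) ρ t))
    map⟦⟧ᶠ m ρ (g ∋ t)  = trans (on-within m g _) (cong (within g) (map-⟦⟧ (hom m) ρ t))
    map⟦⟧ᶠ m ρ (s ≤ t)  = map-≤ (hom m) _ _ (map-⟦⟧ (hom m) ρ s) (map-⟦⟧ (hom m) ρ t)
    map⟦⟧ᶠ m ρ (s ≤ℚ t) = map-≤ℚ (hom m) _ _ (map-⟦⟧ (hom m) ρ s) (map-⟦⟧ (hom m) ρ t)
    map⟦⟧ᶠ m ρ (s <ℚ t) = map-<ℚ (hom m) _ _ (map-⟦⟧ (hom m) ρ s) (map-⟦⟧ (hom m) ρ t)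
    map⟦⟧ᶠ m ρ ⊥′       = on-⊥ m
    map⟦⟧ᶠ m ρ (A ∧ B)  = trans (on-∧ m _ _) (cong₂ D._∧_ (map⟦⟧ᶠ m ρ A) (map⟦⟧ᶠ m ρ B))
    map⟦⟧ᶠ m ρ (A ∨ B)  = trans (on-∨ m _ _) (cong₂ D._∨_ (map⟦⟧ᶠ m ρ A) (map⟦⟧ᶠ m ρ B))
    map⟦⟧ᶠ m ρ (A ⊃ B)  = trans (on-⊃ m _ _) (cong₂ D._⊃_ (map⟦⟧ᶠ m ρ A) (map⟦⟧ᶠ m ρ B))
    map⟦⟧ᶠ m ρ (∀[ g ] σ A) = trans (on-all m g σ _) (cong (all g σ)
      (trans (map⟦⟧ᶠ (up m) (liftS ρ) A) (⟦⟧ᶠ-cong (up-liftS m ρ) A)))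
    map⟦⟧ᶠ m ρ (∃[ g ] σ A) = trans (on-some m g σ _) (cong (some g σ)
      (trans (map⟦⟧ᶠ (up m) (liftS ρ) A) (⟦⟧ᶠ-cong (up-liftS m ρ) A)))

  renHoms : Homs (λ Δ Γ → ∀ {σ} → σ ∈ Δ → σ ∈ Γ)
  renHoms = record { hom = λ r → renHom r ; up = λ r → liftR r ; up-v0 = λ _ _ → refl ; up-wk = λ r t → renT-liftR-wk r t
    ; on-≐ = λ r → ren-≐ r ; on-st = λ _ _ → refl ; on-⊥ = λ _ → refl ; on-∧ = λ _ _ _ → refl ; on-∨ = λ _ _ _ → refl
    ; on-⊃ = λ _ _ _ → refl ; on-∀ = λ _ _ _ → refl ; on-∃ = λ _ _ _ → refl }

  subHoms : Homs (λ Δ Γ → ∀ {σ} → σ ∈ Δ → Term Γ σ)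
  subHoms = record { hom = λ s → subHom s ; up = λ s → liftS s ; up-v0 = λ _ _ → refl ; up-wk = λ s t → subT-liftS-wk s t
    ; on-≐ = λ s → sub-≐ s ; on-st = λ _ _ → refl ; on-⊥ = λ _ → refl ; on-∧ = λ _ _ _ → refl ; on-∨ = λ _ _ _ → refl
    ; on-⊃ = λ _ _ _ → refl ; on-∀ = λ _ _ _ → refl ; on-∃ = λ _ _ _ → refl }

  ren⟦⟧ᶠ : (r : Ren Θ Γ) (ρ : D.Sub Lg Δ Θ) (A : Fml Δ) → D.ren r (⟦ A ⟧ᶠ ρ) ≡ ⟦ A ⟧ᶠ (D.renT r ∘ ρ)
  ren⟦⟧ᶠ r ρ A = Homs.map⟦⟧ᶠ renHoms (λ {σ} → r {σ}) ρ A

  sub⟦⟧ᶠ : (s : D.Sub Lg Θ Γ) (ρ : D.Sub Lg Δ Θ) (A : Fml Δ) → D.sub s (⟦ A ⟧ᶠ ρ) ≡ ⟦ A ⟧ᶠ (D.subT s ∘ ρ)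
  sub⟦⟧ᶠ s ρ A = Homs.map⟦⟧ᶠ subHoms (λ {σ} → s {σ}) ρ A

  ⟦ren⟧ᶠ : (r : Ren Δ Θ) (ρ : D.Sub Lg Θ Γ) (A : Fml Δ) → ⟦ ren r A ⟧ᶠ ρ ≡ ⟦ A ⟧ᶠ (ρ ∘ r)
  ⟦ren⟧ᶠ r ρ (s ≐ t)  = cong₂ D._≐_ (⟦renT⟧ r ρ s) (⟦renT⟧ r ρ t)
  ⟦ren⟧ᶠ r ρ (g ∋ t)  = cong (within g) (⟦renT⟧ r ρ t)
  ⟦ren⟧ᶠ r ρ (s ≤ t)  = cong₂ D._≤′_ (⟦renT⟧ r ρ s) (⟦renT⟧ r ρ t)
  ⟦ren⟧ᶠ r ρ (s ≤ℚ t) = cong₂ D._≤ℚ_ (⟦renT⟧ r ρ s) (⟦renT⟧ r ρ t)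
  ⟦ren⟧ᶠ r ρ (s <ℚ t) = cong₂ D._<ℚ_ (⟦renT⟧ r ρ s) (⟦renT⟧ r ρ t)
  ⟦ren⟧ᶠ r ρ ⊥′       = refl
  ⟦ren⟧ᶠ r ρ (A ∧ B)  = cong₂ D._∧_ (⟦ren⟧ᶠ r ρ A) (⟦ren⟧ᶠ r ρ B)
  ⟦ren⟧ᶠ r ρ (A ∨ B)  = cong₂ D._∨_ (⟦ren⟧ᶠ r ρ A) (⟦ren⟧ᶠ r ρ B)
  ⟦ren⟧ᶠ r ρ (A ⊃ B)  = cong₂ D._⊃_ (⟦ren⟧ᶠ r ρ A) (⟦ren⟧ᶠ r ρ B)
  ⟦ren⟧ᶠ r ρ (∀[ g ] σ A) = cong (all g σ) (trans (⟦ren⟧ᶠ (liftR r) (liftS ρ) A)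
    (⟦⟧ᶠ-cong (λ { (here p) → refl ; (there x) → refl }) A))
  ⟦ren⟧ᶠ r ρ (∃[ g ] σ A) = cong (some g σ) (trans (⟦ren⟧ᶠ (liftR r) (liftS ρ) A)
    (⟦⟧ᶠ-cong (λ { (here p) → refl ; (there x) → refl }) A))

  wk-⟦⟧ : (ρ : D.Sub Lg Δ Γ) (t : Trm Δ σ) → ⟦ wk {τ = τ} t ⟧ (liftS ρ) ≡ D.wk (⟦ t ⟧ ρ)
  wk-⟦⟧ ρ t = trans (⟦renT⟧ there (liftS ρ) t) (sym (map-⟦⟧ (renHom there) ρ t))

  ⟦sub⟧ᶠ : (s : Subst Δ Θ) (ρ : D.Sub Lg Θ Γ) (A : Fml Δ) → ⟦ sub s A ⟧ᶠ ρ ≡ ⟦ A ⟧ᶠ (λ x → ⟦ s x ⟧ ρ)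
  ⟦sub⟧ᶠ s ρ (t ≐ u)  = cong₂ D._≐_ (⟦subT⟧ s ρ t) (⟦subT⟧ s ρ u)
  ⟦sub⟧ᶠ s ρ (g ∋ t)  = cong (within g) (⟦subT⟧ s ρ t)
  ⟦sub⟧ᶠ s ρ (t ≤ u)  = cong₂ D._≤′_ (⟦subT⟧ s ρ t) (⟦subT⟧ s ρ u)
  ⟦sub⟧ᶠ s ρ (t ≤ℚ u) = cong₂ D._≤ℚ_ (⟦subT⟧ s ρ t) (⟦subT⟧ s ρ u)
  ⟦sub⟧ᶠ s ρ (t <ℚ u) = cong₂ D._<ℚ_ (⟦subT⟧ s ρ t) (⟦subT⟧ s ρ u)
  ⟦sub⟧ᶠ s ρ ⊥′       = refl
  ⟦sub⟧ᶠ s ρ (A ∧ B)  = cong₂ D._∧_ (⟦sub⟧ᶠ s ρ A) (⟦sub⟧ᶠ s ρ B)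
  ⟦sub⟧ᶠ s ρ (A ∨ B)  = cong₂ D._∨_ (⟦sub⟧ᶠ s ρ A) (⟦sub⟧ᶠ s ρ B)
  ⟦sub⟧ᶠ s ρ (A ⊃ B)  = cong₂ D._⊃_ (⟦sub⟧ᶠ s ρ A) (⟦sub⟧ᶠ s ρ B)
  ⟦sub⟧ᶠ s ρ (∀[ g ] σ A) = cong (all g σ) (trans (⟦sub⟧ᶠ (lift s) (liftS ρ) A)
    (⟦⟧ᶠ-cong (λ { (here p) → refl ; (there x) → wk-⟦⟧ ρ (s x) }) A))
  ⟦sub⟧ᶠ s ρ (∃[ g ] σ A) = cong (some g σ) (trans (⟦sub⟧ᶠ (lift s) (liftS ρ) A)
    (⟦⟧ᶠ-cong (λ { (here p) → refl ; (there x) → wk-⟦⟧ ρ (s x) }) A))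

-- Soundness of the calculus.

module Soundness (Lg : D.Signature) (Th : D.Theory Lg)
  (arith : ∀ {Γ} {A : D.Formula Lg Γ} → D.RCA₀ω Γ A → Th Γ A)
  (X : Substitution.Poly Lg D.𝟐) (ren-X : Substitution.Closed X) where

  open Substitution
  open D using (Ctx; Ty; 𝟎; 𝟏; 𝟐; _⟶_; _⋆; Const; Tm; liftS; liftR; single; Ren; ax; hyp)
  open Const
  open Deductions Lg Th arith using (_⊢_; conv; axiom; ≐sym; _▸_; app-cong; ≡→≐)
  module A = Deductions Lg Th arith
  open Interpretation Lg X ren-X
  open Calculus

  private variable
    Θ : Ctx
    H : List (D.Formula Lg Γ)

  -- Soundness is proved under all substitutions and in all larger contexts of hypotheses, which
  -- makes weakening and instantiation of derivations free.

  ⟦⟧-QF : (A : Fml Δ) (ρ : D.Sub Lg Δ Γ) → QF A → D.QuantifierFree (⟦ A ⟧ᶠ ρ)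
  ⟦⟧-QF (_≐_ {𝟎} s t) ρ q = tt
  ⟦⟧-QF (s ≤ t) ρ q  = tt
  ⟦⟧-QF (s ≤ℚ t) ρ q = tt
  ⟦⟧-QF (s <ℚ t) ρ q = tt
  ⟦⟧-QF ⊥′ ρ q       = tt
  ⟦⟧-QF (A ∧ B) ρ (p , q) = ⟦⟧-QF A ρ p , ⟦⟧-QF B ρ q
  ⟦⟧-QF (A ∨ B) ρ (p , q) = ⟦⟧-QF A ρ p , ⟦⟧-QF B ρ q
  ⟦⟧-QF (A ⊃ B) ρ (p , q) = ⟦⟧-QF A ρ p , ⟦⟧-QF B ρ q

  ≐-internal : (s t : Term Γ σ) → D.Internal (s D.≐ t)
  ≐-internal {σ = 𝟎} s t     = tt
  ≐-internal {σ = σ ⟶ τ} s t = ≐-internal (D.wk s D.· D.v0) (D.wk t D.· D.v0)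
  ≐-internal {σ = σ ⋆} s t   = tt , tt , ≐-internal (Tm.con at D.· D.wk s D.· D.v0) (Tm.con at D.· D.wk t D.· D.v0)

  ⟦⟧-internal : (A : Fml Δ) (ρ : D.Sub Lg Δ Γ) → Internal A → D.Internal (⟦ A ⟧ᶠ ρ)
  ⟦⟧-internal (s ≐ t) ρ q  = ≐-internal (⟦ s ⟧ ρ) (⟦ t ⟧ ρ)
  ⟦⟧-internal (s ≤ t) ρ q  = tt
  ⟦⟧-internal (s ≤ℚ t) ρ q = tt
  ⟦⟧-internal (s <ℚ t) ρ q = tt
  ⟦⟧-internal ⊥′ ρ q       = tt
  ⟦⟧-internal (A ∧ B) ρ (p , q) = ⟦⟧-internal A ρ p , ⟦⟧-internal B ρ q
  ⟦⟧-internal (A ∨ B) ρ (p , q) = ⟦⟧-internal A ρ p , ⟦⟧-internal B ρ q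
  ⟦⟧-internal (A ⊃ B) ρ (p , q) = ⟦⟧-internal A ρ p , ⟦⟧-internal B ρ q
  ⟦⟧-internal (∀[ full ] σ A) ρ q = ⟦⟧-internal A (liftS ρ) q
  ⟦⟧-internal (∃[ full ] σ A) ρ q = ⟦⟧-internal A (liftS ρ) q

  ⟦_⟧ᴴ : List (Fml Δ) → D.Sub Lg Δ Γ → List (D.Formula Lg Γ)
  ⟦ As ⟧ᴴ ρ = map (λ A → ⟦ A ⟧ᶠ ρ) As

  module _ {H : List (D.Formula Lg Γ)} where
    infixr 5 _∷ᵈ_
    data Derivations : List (D.Formula Lg Γ) → Set where
      []ᵈ  : Derivations []
      _∷ᵈ_ : ∀ {B Bs} → H ⊢ B → Derivations Bs → Derivations (B ∷ Bs)

    -- The first hypotheses are discharged one after the other by way of implications; those of `H`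
    -- remain available throughout.
    cut : ∀ {Bs C} → Derivations Bs → Bs ++ H ⊢ C → H ⊢ C
    cut []ᵈ       d = d
    cut (e ∷ᵈ es) d = D.⊃E (cut es (D.⊃I d)) e

  wk-hyps : (As : List (Fml Δ)) (ρ : D.Sub Lg Δ Γ) →
            (∀ {A} → A ∈ As → ⟦ A ⟧ᶠ ρ ∈ H) → ∀ {B} → B ∈ wkH {σ = σ} As → ⟦ B ⟧ᶠ (liftS ρ) ∈ D.wkH H
  wk-hyps As ρ h {B} b with ∈-map⁻ (ren there) b
  ... | A , a , refl = subst-∈ (trans (ren⟦⟧ᶠ there ρ A) (sym (⟦ren⟧ᶠ there (liftS ρ) A))) (∈-map⁺ (D.ren there) (h a))
    where
    subst-∈ : ∀ {A B : D.Formula Lg Γ} {K} → A ≡ B → A ∈ K → B ∈ K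
    subst-∈ refl x = x

  cons-hyps : {As : List (Fml Δ)} {ρ : D.Sub Lg Δ Γ} {B : Fml Δ} →
              (∀ {A} → A ∈ As → ⟦ A ⟧ᶠ ρ ∈ H) → ∀ {A} → A ∈ B ∷ As → ⟦ A ⟧ᶠ ρ ∈ ⟦ B ⟧ᶠ ρ ∷ H
  cons-hyps h (here refl) = here refl
  cons-hyps h (there a)   = there (h a)

  ⟦[]⟧ : (A : Fml (σ ∷ Δ)) (t : Trm Δ σ) (ρ : D.Sub Lg Δ Γ) →
         D.sub (single (⟦ t ⟧ ρ)) (⟦ A ⟧ᶠ (liftS ρ)) ≡ ⟦ A [ t ] ⟧ᶠ ρ
  ⟦[]⟧ A t ρ = trans (sub⟦⟧ᶠ _ _ A) (trans
    (⟦⟧ᶠ-cong (λ { (here refl) → refl ; (there x) → subT-single-wk (⟦ t ⟧ ρ) (ρ x) }) A)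
    (sym (⟦sub⟧ᶠ _ ρ A)))

  apply′ : (Θ : Ctx) → Term Γ (Θ ⇒ τ) → D.Sub Lg Θ Γ → Term Γ τ
  apply′ []      t s = t
  apply′ (σ ∷ Θ) t s = apply′ Θ t (s ∘ there) D.· s (here refl)

  ⟦apply⟧ : (Θ : Ctx) (t : Trm Δ (Θ ⇒ τ)) (s : Subst Θ Δ) (ρ : D.Sub Lg Δ Γ) →
            ⟦ apply Θ t s ⟧ ρ ≡ apply′ Θ (⟦ t ⟧ ρ) (λ x → ⟦ s x ⟧ ρ)
  ⟦apply⟧ []      t s ρ = refl
  ⟦apply⟧ (σ ∷ Θ) t s ρ = cong (D._· _) (⟦apply⟧ Θ t (s ∘ there) ρ)

  β-ƛ* : (Θ : Ctx) (t : Term Θ τ) (s : D.Sub Lg Θ Γ) → H ⊢ apply′ Θ (D.closed (ƛ* Θ t)) s D.≐ D.subT s t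
  β-ƛ* []      t s = ≡→≐ (trans (renT-as-subT (λ ()) t) (subT-cong (λ ()) t))
  β-ƛ* (σ ∷ Θ) t s = A.≐-app (β-ƛ* Θ (D.ƛ t) (s ∘ there)) _ ▸ A.β-ƛ (s ∘ there) t _ ▸
    ≡→≐ (subT-cong (λ { (here refl) → refl ; (there x) → refl }) t)

  -- As in Hom, the closed terms of Defs are abstracted over before they are used.
  cong₁ : (c : Poly Lg (𝟎 ⟶ 𝟎)) → ∀ {a a′ : Term Γ 𝟎} → H ⊢ a D.≈ a′ → H ⊢ c D.· a D.≈ c D.· a′
  cong₁ c p = A.≐-arg c p

  cong∘ : (c d : Poly Lg (𝟎 ⟶ 𝟎)) → ∀ {a a′ : Term Γ 𝟎} → H ⊢ a D.≈ a′ → H ⊢ c D.· (d D.· a) D.≈ c D.· (d D.· a′)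
  cong∘ c d p = A.≐-arg c (A.≐-arg d p)

  cong-bin : (c : Poly Lg (𝟎 ⟶ 𝟎 ⟶ 𝟎)) → ∀ {a a′ b b′ : Term Γ 𝟎} → H ⊢ a D.≈ a′ → H ⊢ b D.≈ b′ →
             H ⊢ c D.· a D.· b D.≈ c D.· a′ D.· b′
  cong-bin c p q = app-cong (A.≐-arg c p) q

  cong-triple : (c : Poly Lg (𝟎 ⟶ 𝟎 ⟶ 𝟎)) (d : Poly Lg (𝟎 ⟶ 𝟎)) → ∀ {x y z x′ y′ z′ : Term Γ 𝟎} →
                H ⊢ x D.≈ x′ → H ⊢ y D.≈ y′ → H ⊢ z D.≈ z′ →
                H ⊢ c D.· (c D.· x D.· y) D.· (d D.· z) D.≈ c D.· (c D.· x′ D.· y′) D.· (d D.· z′)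
  cong-triple c d p q r = cong-bin c (cong-bin c p q) (cong₁ d r)

  mkℚ-cong : ∀ {a b d a′ b′ d′ : Term Γ 𝟎} → H ⊢ a D.≈ a′ → H ⊢ b D.≈ b′ → H ⊢ d D.≈ d′ →
             H ⊢ D.mkℚ a b d D.≈ D.mkℚ a′ b′ d′
  mkℚ-cong = cong-triple D.pair D.pred

  ⊕-cong : ∀ {a a′ b b′ : Term Γ 𝟎} → H ⊢ a D.≈ a′ → H ⊢ b D.≈ b′ → H ⊢ a D.⊕ b D.≈ a′ D.⊕ b′
  ⊕-cong = cong-bin D.plus
  ⊗-cong : ∀ {a a′ b b′ : Term Γ 𝟎} → H ⊢ a D.≈ a′ → H ⊢ b D.≈ b′ → H ⊢ a D.⊗ b D.≈ a′ D.⊗ b′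
  ⊗-cong = cong-bin D.times
  ∸-cong : ∀ {a a′ b b′ : Term Γ 𝟎} → H ⊢ a D.≈ a′ → H ⊢ b D.≈ b′ → H ⊢ a D.∸ b D.≈ a′ D.∸ b′
  ∸-cong = cong-bin D.monus
  pos-cong : ∀ {a a′ : Term Γ 𝟎} → H ⊢ a D.≈ a′ → H ⊢ D.pos a D.≈ D.pos a′
  pos-cong = cong∘ D.π₁ D.π₁
  neg-cong : ∀ {a a′ : Term Γ 𝟎} → H ⊢ a D.≈ a′ → H ⊢ D.neg a D.≈ D.neg a′
  neg-cong = cong∘ D.π₂ D.π₁
  den-cong : ∀ {a a′ : Term Γ 𝟎} → H ⊢ a D.≈ a′ → H ⊢ D.den a D.≈ D.den a′
  den-cong = cong∘ (Tm.con suc) D.π₂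
  cross-cong : ∀ {a b c d a′ b′ c′ d′ : Term Γ 𝟎} → H ⊢ a D.≈ a′ → H ⊢ b D.≈ b′ → H ⊢ c D.≈ c′ →
               H ⊢ d D.≈ d′ → H ⊢ a D.⊗ b D.⊕ c D.⊗ d D.≈ a′ D.⊗ b′ D.⊕ c′ D.⊗ d′
  cross-cong p q r s = ⊕-cong (⊗-cong p q) (⊗-cong r s)

  fn₁-cong : ∀ f {s t : Term Γ 𝟎} → H ⊢ s D.≈ t → H ⊢ fn₁ f s D.≈ fn₁ f t
  fn₁-cong pred d = cong₁ D.pred d
  fn₁-cong pow d = cong₁ D.2^ d
  fn₁-cong tri d = cong₁ D.tri d
  fn₁-cong root d = cong₁ D.root d
  fn₁-cong π₁ d = cong₁ D.π₁ d
  fn₁-cong π₂ d = cong₁ D.π₂ d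
  fn₁-cong pos d = pos-cong d
  fn₁-cong neg d = neg-cong d
  fn₁-cong den d = den-cong d
  fn₁-cong abs  d = mkℚ-cong (⊕-cong (∸-cong (pos-cong d) (neg-cong d)) (∸-cong (neg-cong d) (pos-cong d)))
                      (axiom (D.≈-refl _)) (den-cong d)
  fn₁-cong inv  d = mkℚ-cong (axiom (D.≈-refl _)) (axiom (D.≈-refl _)) (cong₁ D.2^ d)

  fn₂-cong : ∀ f {s t s′ t′ : Term Γ 𝟎} → H ⊢ s D.≈ s′ → H ⊢ t D.≈ t′ → H ⊢ fn₂ f s t D.≈ fn₂ f s′ t′
  fn₂-cong plus  d e = ⊕-cong d e
  fn₂-cong times d e = ⊗-cong d e
  fn₂-cong monus d e = ∸-cong d e
  fn₂-cong pair  d e = cong-bin D.pair d e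
  fn₂-cong plusℚ d e = mkℚ-cong
    (cross-cong (pos-cong d) (den-cong e) (pos-cong e) (den-cong d))
    (cross-cong (neg-cong d) (den-cong e) (neg-cong e) (den-cong d))
    (⊗-cong (den-cong d) (den-cong e))
  fn₂-cong minusℚ d e = mkℚ-cong
    (cross-cong (pos-cong d) (den-cong e) (neg-cong e) (den-cong d))
    (cross-cong (neg-cong d) (den-cong e) (pos-cong e) (den-cong d))
    (⊗-cong (den-cong d) (den-cong e))

  lookup : (As : List (Fml Δ)) (n : ℕ) {ρ : D.Sub Lg Δ Γ} → (∀ {A} → A ∈ As → ⟦ A ⟧ᶠ ρ ∈ H) → H ⊢ ⟦ As ‼ n ⟧ᶠ ρ
  lookup []       n       h = axiom (D.≈-refl _)
  lookup (A ∷ As) zero    h = hyp (h (here refl))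
  lookup (A ∷ As) (suc n) h = lookup As n (h ∘ there)

  -- The axioms for standardness enter as parameters and Ξ₀ only as a closed term `X`, so that
  -- soundness makes no reference to the family of specifications.
  module Sound
    (th-≐ : ∀ {Γ σ} (s t : Term Γ σ) → Th Γ (D.Formula.st s D.∧ s D.≐ t D.⊃ D.Formula.st t))
    (th-closed : ∀ {Γ σ} (t : Term [] σ) → Th Γ (D.Formula.st (D.closed t)))
    (th-app : ∀ {Γ σ τ} (s : Term Γ (σ ⟶ τ)) (t : Term Γ σ) →
              Th Γ (D.Formula.st s D.∧ D.Formula.st t D.⊃ D.Formula.st (s D.· t)))
    (th-HAC : ∀ {Γ ρ τ} (φ : D.Formula Lg (τ ∷ ρ ∷ Γ)) → D.Internal φ →
      Th Γ (D.∀ˢᵗ ρ (D.∃ˢᵗ τ φ) D.⊃ D.∃ˢᵗ (ρ ⟶ τ ⋆) (D.∀ˢᵗ ρ (D.Formula.∃′ τ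
        (D.v0 D.∈′ D.v2 D.· D.v1 D.∧ D.ren (liftR (liftR there)) φ)))))
    (th-PF : ∀ {Γ τ} (φ : D.Formula Lg (τ ∷ [])) → D.Internal φ →
      Th Γ (D.∀ˢᵗ τ (φ D.⟨ D.v0 ⟩) D.⊃ D.Formula.∀′ τ (φ D.⟨ D.v0 ⟩)))
    (th-X : ∀ {Γ} {H : List (D.Formula Lg Γ)} → H ⊢ D.Formula.st (X {Γ}))
    (th-Ξ : ∀ {Γ Δ} {H : List (D.Formula Lg Γ)} (ρ : D.Sub Lg Δ Γ) → H ⊢
      ⟦ ∀ˢᵗ 𝟐 (∀ˢᵗ 𝟏 ((∃ˢᵗ 𝟎 (v1 · v0 ≐ O) ⇔ v1 · v0 ≐ O) ∧ v1 · v0 ≤ one) ⊃ ∀ˢᵗ 𝟏 (Ξ · v0 ≐ v1 · v0)) ⟧ᶠ ρ)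
    where

    St : Term Γ σ → D.Formula Lg Γ
    St = D.Formula.st

    st-cl : (c : Poly Lg σ) → Closed c → {Γ : Ctx} {H : List (D.Formula Lg Γ)} → H ⊢ St c
    st-cl c e = conv (cong St (e (λ ()))) (ax (th-closed c))

    st-con : (c : Const σ) {Γ : Ctx} {H : List (D.Formula Lg Γ)} → H ⊢ St (Tm.con c)
    st-con c = st-cl (Tm.con c) (λ _ → refl)

    st· : {s : Term Γ (σ ⟶ τ)} {t : Term Γ σ} → H ⊢ St s → H ⊢ St t → H ⊢ St (s D.· t)
    st· d e = D.⊃E (ax (th-app _ _)) (D.∧I d e)

    st₁ : (c : Poly Lg (σ ⟶ τ)) → Closed c → {t : Term Γ σ} → H ⊢ St t → H ⊢ St (c D.· t)
    st₁ c e d = st· (st-cl c e) d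

    st₂ : (c : Poly Lg (ρ ⟶ σ ⟶ τ)) → Closed c → {s : Term Γ ρ} {t : Term Γ σ} →
          H ⊢ St s → H ⊢ St t → H ⊢ St (c D.· s D.· t)
    st₂ c e d d′ = st· (st₁ c e d) d′

    st∘ : (c d : Poly Lg (𝟎 ⟶ 𝟎)) → Closed c → Closed d → {t : Term Γ 𝟎} → H ⊢ St t → H ⊢ St (c D.· (d D.· t))
    st∘ c d e e′ x = st₁ c e (st₁ d e′ x)

    st-triple : (c : Poly Lg (𝟎 ⟶ 𝟎 ⟶ 𝟎)) (d : Poly Lg (𝟎 ⟶ 𝟎)) → Closed c → Closed d →
                {x y z : Term Γ 𝟎} → H ⊢ St x → H ⊢ St y → H ⊢ St z → H ⊢ St (c D.· (c D.· x D.· y) D.· (d D.· z))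
    st-triple c d e e′ x y z = st₂ c e (st₂ c e x y) (st₁ d e′ z)

    st-mkℚ : {a b d : Term Γ 𝟎} → H ⊢ St a → H ⊢ St b → H ⊢ St d → H ⊢ St (D.mkℚ a b d)
    st-mkℚ = st-triple D.pair D.pred ren-pair ren-pred
    st-pos : {a : Term Γ 𝟎} → H ⊢ St a → H ⊢ St (D.pos a)
    st-pos = st∘ D.π₁ D.π₁ ren-π₁ ren-π₁
    st-neg : {a : Term Γ 𝟎} → H ⊢ St a → H ⊢ St (D.neg a)
    st-neg = st∘ D.π₂ D.π₁ ren-π₂ ren-π₁
    st-den : {a : Term Γ 𝟎} → H ⊢ St a → H ⊢ St (D.den a)
    st-den = st∘ (Tm.con suc) D.π₂ (λ _ → refl) ren-π₂
    st-⊗ : {a b : Term Γ 𝟎} → H ⊢ St a → H ⊢ St b → H ⊢ St (a D.⊗ b)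
    st-⊗ = st₂ D.times ren-times
    st-∸ : {a b : Term Γ 𝟎} → H ⊢ St a → H ⊢ St b → H ⊢ St (a D.∸ b)
    st-∸ = st₂ D.monus ren-monus
    st-⊕ : {a b : Term Γ 𝟎} → H ⊢ St a → H ⊢ St b → H ⊢ St (a D.⊕ b)
    st-⊕ = st₂ D.plus ren-plus

    st-fn₁ : ∀ f {t : Term Γ 𝟎} → H ⊢ St t → H ⊢ St (fn₁ f t)
    st-fn₁ pred d = st₁ D.pred ren-pred d
    st-fn₁ pow  d = st₁ D.2^ ren-2^ d
    st-fn₁ tri  d = st₁ D.tri ren-tri d
    st-fn₁ root d = st₁ D.root ren-root d
    st-fn₁ π₁   d = st₁ D.π₁ ren-π₁ d
    st-fn₁ π₂   d = st₁ D.π₂ ren-π₂ d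
    st-fn₁ pos d = st-pos d
    st-fn₁ neg d = st-neg d
    st-fn₁ den d = st-den d
    st-fn₁ abs  d = st-mkℚ (st-⊕ (st-∸ (st-pos d) (st-neg d)) (st-∸ (st-neg d) (st-pos d)))
                      (st-con zer) (st-den d)
    st-fn₁ inv  d = st-mkℚ (st· (st-con suc) (st-con zer)) (st-con zer) (st₁ D.2^ ren-2^ d)

    st-fn₂ : ∀ f {s t : Term Γ 𝟎} → H ⊢ St s → H ⊢ St t → H ⊢ St (fn₂ f s t)
    st-fn₂ plus   d e = st-⊕ d e
    st-fn₂ times  d e = st-⊗ d e
    st-fn₂ monus  d e = st-∸ d e
    st-fn₂ pair   d e = st₂ D.pair ren-pair d e
    st-fn₂ plusℚ  d e = st-mkℚ
      (st-⊕ (st-⊗ (st-pos d) (st-den e)) (st-⊗ (st-pos e) (st-den d)))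
      (st-⊕ (st-⊗ (st-neg d) (st-den e)) (st-⊗ (st-neg e) (st-den d)))
      (st-⊗ (st-den d) (st-den e))
    st-fn₂ minusℚ d e = st-mkℚ
      (st-⊕ (st-⊗ (st-pos d) (st-den e)) (st-⊗ (st-neg e) (st-den d)))
      (st-⊕ (st-⊗ (st-neg d) (st-den e)) (st-⊗ (st-pos e) (st-den d)))
      (st-⊗ (st-den d) (st-den e))

    st⟦⟧ : (t : Trm Δ σ) (ρ : D.Sub Lg Δ Γ) → (∀ {τ} (x : τ ∈ Δ) → H ⊢ St (ρ x)) → H ⊢ St (⟦ t ⟧ ρ)
    st⟦⟧ (var x) ρ h     = h x
    st⟦⟧ (con c) ρ h     = st-con c
    st⟦⟧ Ξ ρ h           = th-X
    st⟦⟧ (comb Θ t) ρ h  = ax (th-closed (ƛ* Θ (⟦ t ⟧ Tm.var)))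
    st⟦⟧ (s · t) ρ h     = st· (st⟦⟧ s ρ h) (st⟦⟧ t ρ h)
    st⟦⟧ (ap₁ f t) ρ h   = st-fn₁ f (st⟦⟧ t ρ h)
    st⟦⟧ (ap₂ f s t) ρ h = st-fn₂ f (st⟦⟧ s ρ h) (st⟦⟧ t ρ h)

    sound : {As : List (Fml Δ)} {C : Fml Δ} → As ⊩ C → (ρ : D.Sub Lg Δ Γ) {H : List (D.Formula Lg Γ)} →
            (∀ {A} → A ∈ As → ⟦ A ⟧ᶠ ρ ∈ H) → H ⊢ ⟦ C ⟧ᶠ ρ
    sounds : {Bs : List (Fml Δ)} {As : List (Fml Θ)} {s : Subst Θ Δ} → All (λ A → Bs ⊩ sub s A) As →
             (ρ : D.Sub Lg Δ Γ) {H : List (D.Formula Lg Γ)} → (∀ {B} → B ∈ Bs → ⟦ B ⟧ᶠ ρ ∈ H) →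
             Derivations {H = H} (⟦ As ⟧ᴴ (λ x → ⟦ s x ⟧ ρ))

    entails : {Bs As : List (Fml Δ)} → All (Bs ⊩_) As → (ρ : D.Sub Lg Δ Γ) {H : List (D.Formula Lg Γ)} →
              (∀ {B} → B ∈ Bs → ⟦ B ⟧ᶠ ρ ∈ H) → Derivations {H = H} (⟦ As ⟧ᴴ ρ)

    entails [] ρ h = []ᵈ
    entails (d ∷ ds) ρ h = sound d ρ h ∷ᵈ entails ds ρ h

    sounds [] ρ h = []ᵈ
    sounds {As = A ∷ _} (d ∷ ds) ρ h = conv (⟦sub⟧ᶠ _ ρ A) (sound d ρ h) ∷ᵈ sounds ds ρ h

    sound {As = As} (hyp n) ρ h = lookup As n h
    sound (raa d) ρ h      = D.raa (sound d ρ (cons-hyps h))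
    sound (∧I d e) ρ h     = D.∧I (sound d ρ h) (sound e ρ h)
    sound (∧E₁ d) ρ h      = D.∧E₁ (sound d ρ h)
    sound (∧E₂ d) ρ h      = D.∧E₂ (sound d ρ h)
    sound (∨I₁ d) ρ h      = D.∨I₁ (sound d ρ h)
    sound (∨I₂ d) ρ h      = D.∨I₂ (sound d ρ h)
    sound (∨E d e f) ρ h   = D.∨E (sound d ρ h) (sound e ρ (cons-hyps h)) (sound f ρ (cons-hyps h))
    sound (⊃I d) ρ h       = D.⊃I (sound d ρ (cons-hyps h))
    sound (⊃E d e) ρ h     = D.⊃E (sound d ρ h) (sound e ρ h)
    sound {As = As} (∀I d) ρ h = D.∀I (sound d (liftS ρ) (wk-hyps As ρ h))
    sound (∀E {A = A} d t) ρ h = conv (⟦[]⟧ A t ρ) (D.∀E (sound d ρ h) (⟦ t ⟧ ρ))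
    sound (∃I {A = A} t d) ρ h = D.∃I (⟦ t ⟧ ρ) (conv (sym (⟦[]⟧ A t ρ)) (sound d ρ h))
    sound {As = As} (∃E {C = C} d e) ρ h = D.∃E (sound d ρ h)
      (conv (trans (⟦ren⟧ᶠ there (liftS ρ) C) (sym (ren⟦⟧ᶠ there ρ C)))
        (sound e (liftS ρ) (cons-hyps (wk-hyps As ρ h))))
    -- At `full` the range hypothesis is read as 0 ≈ 0 and can be discharged on the spot.
    sound {As = As} (∀ᵣI {full} d) ρ h = D.∀I (D.⊃E (D.⊃I (sound d (liftS ρ) (cons-hyps (wk-hyps As ρ h)))) (axiom (D.≈-refl _)))
    sound {As = As} (∀ᵣI {std} d) ρ h = D.∀I (D.⊃I (sound d (liftS ρ) (cons-hyps (wk-hyps As ρ h))))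
    sound (∀ᵣE {full} {A = A} d t e) ρ h = conv (⟦[]⟧ A t ρ) (D.∀E (sound d ρ h) (⟦ t ⟧ ρ))
    sound (∀ᵣE {std} {A = A} d t e) ρ h = conv (⟦[]⟧ A t ρ) (D.⊃E (D.∀E (sound d ρ h) (⟦ t ⟧ ρ)) (sound e ρ h))
    sound (∃ᵣI {full} {A = A} t d e) ρ h = D.∃I (⟦ t ⟧ ρ) (conv (sym (⟦[]⟧ A t ρ)) (sound e ρ h))
    sound (∃ᵣI {std} {A = A} t d e) ρ h = D.∃I (⟦ t ⟧ ρ) (D.∧I (sound d ρ h) (conv (sym (⟦[]⟧ A t ρ)) (sound e ρ h)))
    sound {As = As} (∃ᵣE {full} {C = C} d e) ρ h = D.∃E (sound d ρ h)
      (conv (trans (⟦ren⟧ᶠ there (liftS ρ) C) (sym (ren⟦⟧ᶠ there ρ C))) (D.⊃E (D.⊃E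
        (D.⊃I (D.⊃I (sound e (liftS ρ) (cons-hyps (cons-hyps (there ∘ wk-hyps As ρ h))))))
        (axiom (D.≈-refl _))) (hyp (here refl))))
    -- The conjunction of `st v0` and the matrix is split into the two hypotheses that the calculus
    -- has. It stays in the list itself, whence the extra `there`.
    sound {As = As} (∃ᵣE {std} {C = C} d e) ρ h = D.∃E (sound d ρ h)
      (conv (trans (⟦ren⟧ᶠ there (liftS ρ) C) (sym (ren⟦⟧ᶠ there ρ C))) (D.⊃E (D.⊃E
        (D.⊃I (D.⊃I (sound e (liftS ρ) (cons-hyps (cons-hyps (there ∘ wk-hyps As ρ h))))))
        (D.∧E₁ (hyp (here refl)))) (D.∧E₂ (hyp (here refl)))))
    sound ∋-full ρ h = axiom (D.≈-refl _)
    sound {As = []} (drop d) ρ h = sound d ρ h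
    sound {As = _ ∷ _} (drop d) ρ h = sound d ρ (h ∘ there)
    sound (entail d ds) ρ h = cut (entails ds ρ h) (sound d ρ (λ a → ∈-++⁺ˡ (∈-map⁺ _ a)))
    sound (inst {As = As} {C} d s ds) ρ h = conv (sym (⟦sub⟧ᶠ s ρ C))
      (cut (sounds {As = As} {s} ds ρ h) (sound d (λ x → ⟦ s x ⟧ ρ) (λ a → ∈-++⁺ˡ (∈-map⁺ _ a))))
    sound ≐-refl ρ h       = A.≐-reflexive
    sound (≐-sym d) ρ h    = ≐sym (sound d ρ h)
    sound (≐-trans d e) ρ h = sound d ρ h ▸ sound e ρ h
    sound (·-cong d e) ρ h = app-cong (sound d ρ h) (sound e ρ h)
    sound (ap₁-cong f d) ρ h   = fn₁-cong f (sound d ρ h)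
    sound (ap₂-cong f d e) ρ h = fn₂-cong f (sound d ρ h) (sound e ρ h)
    sound {As = As} (≐-ext {s = s} {t} d) ρ h =
      D.∀I (conv (cong₂ (λ a b → a D.· D.v0 D.≐ b D.· D.v0) (wk-⟦⟧ ρ s) (wk-⟦⟧ ρ t)) (sound d (liftS ρ) (wk-hyps As ρ h)))
    sound (≐-app d u) ρ h  = A.≐-app (sound d ρ h) (⟦ u ⟧ ρ)
    sound (β {Δ = Θ} t s) ρ h = ≡→≐ (⟦apply⟧ Θ (comb Θ t) s ρ) ▸ β-ƛ* Θ (⟦ t ⟧ Tm.var) _ ▸
      ≡→≐ (trans (Hom.map-⟦⟧ (subHom _) Tm.var t) (sym (⟦subT⟧ s ρ t)))
    sound K-red ρ h        = axiom (D.K-ax _ _)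
    sound (suc≢zer d) ρ h  = D.⊃E (axiom (D.suc≢zer _)) (sound d ρ h)
    sound R₀-zer ρ h       = axiom (D.R₀-zer _ _)
    sound R₀-suc ρ h       = axiom (D.R₀-suc _ _ _)
    sound pred-zer ρ h     = A.pred-zer
    sound pred-suc ρ h     = A.pred-suc _
    sound plus-zer ρ h     = A.plus-zer _
    sound plus-suc ρ h     = A.plus-suc _ _
    sound times-zer ρ h    = A.times-zer _
    sound times-suc ρ h    = A.times-suc _ _
    sound monus-zer ρ h    = A.monus-zer _
    sound monus-suc ρ h    = A.monus-suc _ _
    sound pow-zer ρ h      = A.pow-zer
    sound pow-suc ρ h      = A.pow-suc _
    sound tri-zer ρ h      = A.tri-zer
    sound tri-suc ρ h      = A.tri-suc _
    sound root-zer ρ h     = A.root-zer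
    sound root-suc ρ h     = A.root-suc _
    sound π₁-def ρ h       = A.π₁-eq _
    sound π₂-def ρ h       = A.π₂-eq _
    sound pair-def ρ h     = A.pair-eq _ _
    sound pos-def ρ h      = A.≐-reflexive
    sound neg-def ρ h      = A.≐-reflexive
    sound den-def ρ h      = A.≐-reflexive
    sound abs-def ρ h      = A.≐-reflexive
    sound inv-def ρ h      = A.≐-reflexive
    sound +ℚ-def ρ h       = A.≐-reflexive
    sound -ℚ-def ρ h       = A.≐-reflexive
    sound (≤I d) ρ h       = sound d ρ h
    sound (≤E d) ρ h       = sound d ρ h
    sound (≤ℚI d) ρ h      = sound d ρ h
    sound (≤ℚE d) ρ h      = sound d ρ h
    sound (<ℚI d) ρ h      = sound d ρ h
    sound (<ℚE d) ρ h      = sound d ρ h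
    sound {As = As} (induction A q d e) ρ h = D.⊃E (axiom (D.QF-induction (⟦ A ⟧ᶠ (liftS ρ)) (⟦⟧-QF A (liftS ρ) q)))
      (D.∧I (conv (sym (⟦[]⟧ A O ρ)) (sound d ρ h))
        (D.∀I (D.⊃I (conv step (sound e (liftS ρ) (cons-hyps (wk-hyps As ρ h)))))))
      where
      step : ⟦ sub (S′ v0 ◂ (λ x → var (there x))) A ⟧ᶠ (liftS ρ) ≡
             D.sub (single (Tm.con suc D.· D.v0)) (D.ren (liftR there) (⟦ A ⟧ᶠ (liftS ρ)))
      step = trans (⟦sub⟧ᶠ _ _ A) (trans
        (⟦⟧ᶠ-cong (λ { (here refl) → refl ; (there x) → sym (trans (cong (D.subT _) (renT-liftR-wk there (ρ x)))
          (subT-single-wk _ (D.wk (ρ x)))) }) A)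
        (sym (trans (cong (D.sub _) (ren⟦⟧ᶠ (liftR there) (liftS ρ) A)) (sub⟦⟧ᶠ _ _ A))))
    sound (choice A q d) ρ h = conv
        (cong (D.Formula.∃′ 𝟐 ∘ D.Formula.∀′ 𝟏) step)
        (D.⊃E (axiom (D.QF-AC¹⁰ (⟦ A ⟧ᶠ (liftS (liftS ρ))) (⟦⟧-QF A _ q))) (sound d ρ h))
      where
      step : D.sub (single (D.v1 D.· D.v0)) (D.ren (liftR (liftR there)) (⟦ A ⟧ᶠ (liftS (liftS ρ)))) ≡
             ⟦ sub (v1 · v0 ◂ v0 ◂ (λ x → var (there (there x)))) A ⟧ᶠ (liftS (liftS ρ))
      step = trans (cong (D.sub _) (ren⟦⟧ᶠ _ _ A)) (trans (sub⟦⟧ᶠ _ _ A) (trans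
        (⟦⟧ᶠ-cong (λ { (here refl) → refl ; (there (here refl)) → refl
                     ; (there (there x)) → trans (cong (D.subT (single (D.v1 D.· D.v0))) (trans (renT-liftR-wk (liftR there) (D.wk (ρ x))) (cong D.wk (renT-liftR-wk there (ρ x)))))
                         (subT-single-wk (D.v1 D.· D.v0) (D.wk (D.wk (ρ x)))) }) A)
        (sym (⟦sub⟧ᶠ _ _ A))))
    sound (st-≐ d e) ρ h   = D.⊃E (ax (th-≐ _ _)) (D.∧I (sound e ρ h) (sound d ρ h))
    sound (st-tm {g = full} t s d) ρ h = axiom (D.≈-refl _)
    sound (st-tm {g = std} t s d) ρ h = conv (cong St (sym (⟦subT⟧ s ρ t))) (st⟦⟧ t (λ x → ⟦ s x ⟧ ρ) (λ x → sound (d x) ρ h))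
    sound (HAC-int A i d) ρ h = conv
        (cong (λ B → D.∃ˢᵗ (𝟏 ⟶ 𝟎 ⋆) (D.∀ˢᵗ 𝟏 (D.Formula.∃′ 𝟎 (D.v0 D.∈′ D.v2 D.· D.v1 D.∧ B)))) step)
        (D.⊃E (ax (th-HAC (⟦ A ⟧ᶠ (liftS (liftS ρ))) (⟦⟧-internal A _ i))) (sound d ρ h))
      where
      step : D.ren (liftR (liftR there)) (⟦ A ⟧ᶠ (liftS (liftS ρ))) ≡
             ⟦ sub (v0 ◂ v1 ◂ (λ x → var (there (there (there x))))) A ⟧ᶠ (liftS (liftS (liftS ρ)))
      step = trans (ren⟦⟧ᶠ _ _ A) (trans
        (⟦⟧ᶠ-cong (λ { (here refl) → refl ; (there (here refl)) → refl
                     ; (there (there x)) → trans (renT-liftR-wk _ _) (cong D.wk (renT-liftR-wk _ _)) }) A)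
        (sym (⟦sub⟧ᶠ _ _ A)))
    sound (PF-TP {τ = τ} A i d) ρ h = conv (cong (D.Formula.∀′ τ) step)
        (D.⊃E (ax (th-PF (⟦ A ⟧ᶠ Tm.var) (⟦⟧-internal A _ i)))
          (conv (cong (D.∀ˢᵗ τ) (sym step)) (sound d ρ h)))
      where
      step : (⟦ A ⟧ᶠ Tm.var) D.⟨ D.v0 ⟩ ≡ ⟦ sub (v0 ◂ ε) A ⟧ᶠ (liftS ρ)
      step = trans (sub⟦⟧ᶠ _ _ A) (trans (⟦⟧ᶠ-cong (λ { (here refl) → refl }) A) (sym (⟦sub⟧ᶠ _ _ A)))
    sound Ξ-ax ρ h         = th-Ξ ρ

-- Agreement of the formulas with the original statements, and the theorem.

module Statements where

  open D using (Ty; Signature; Specification; 𝟎; 𝟏; 𝟐; _⟶_; Theory; Tm; liftS; Ctx; Const)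
  open Substitution
  open Calculus
  open Formulas
  open Arithmetic using (h0)
  open Transfer using (∃²⇒TRANS; TRANS⇒∃²)
  open Constant using (IVT*⇒TRANS)
  open Grilliot using (UIVT⇒∃²)
  open Bisection using (∃²⇒UIVT; TRANS⇒IVT*)

  module Statements (Sg : Signature) (X : Poly Sg 𝟐) (ren-X : Closed X) where
    open Interpretation Sg X ren-X

    private variable
      g : Range

    -- Both versions of a notion are matched in one pass: a formula with range `g` corresponds to
    -- the original for `full` and to its relativisation for `std`. The equations are assembled
    -- connective by connective, which keeps the arithmetical terms folded.
    rel : Range → D.Formula Sg Γ → D.Formula Sg Γ
    rel full A = A
    rel std A  = A D.ˢᵗ

    rel-⊃ : ∀ g {P P′ B B′ : D.Formula Sg Γ} → P ≡ rel g B → P′ ≡ rel g B′ → (P D.⊃ P′) ≡ rel g (B D.⊃ B′)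
    rel-⊃ full refl refl = refl
    rel-⊃ std  refl refl = refl

    rel-∧ : ∀ g {P P′ B B′ : D.Formula Sg Γ} → P ≡ rel g B → P′ ≡ rel g B′ → (P D.∧ P′) ≡ rel g (B D.∧ B′)
    rel-∧ full refl refl = refl
    rel-∧ std  refl refl = refl

    rel-∀ : ∀ g {σ} {P B : D.Formula Sg (σ ∷ Γ)} → P ≡ rel g B → all g σ P ≡ rel g (D.Formula.∀′ σ B)
    rel-∀ full refl = refl
    rel-∀ std  refl = refl

    rel-∃ : ∀ g {σ} {P B : D.Formula Sg (σ ∷ Γ)} → P ≡ rel g B → some g σ P ≡ rel g (D.Formula.∃′ σ B)
    rel-∃ full refl = refl
    rel-∃ std  refl = refl

    module _ {ρ : D.Sub Sg Δ Γ} where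
      rel-≤ℚ : ∀ g {s t a b} → ⟦ s ⟧ ρ ≡ a → ⟦ t ⟧ ρ ≡ b → ⟦ s ≤ℚ t ⟧ᶠ ρ ≡ rel g (a D.≤ℚ b)
      rel-≤ℚ full refl refl = refl
      rel-≤ℚ std  refl refl = refl

      rel-<ℚ : ∀ g {s t a b} → ⟦ s ⟧ ρ ≡ a → ⟦ t ⟧ ρ ≡ b → ⟦ s <ℚ t ⟧ᶠ ρ ≡ rel g (a D.<ℚ b)
      rel-<ℚ full refl refl = refl
      rel-<ℚ std  refl refl = refl

      at-v0 : ∀ {s : Trm Δ 𝟏} {x} → ⟦ s ⟧ ρ ≡ x → ⟦ wk {τ = 𝟎} s · v0 ⟧ (liftS ρ) ≡ D.wk x D.· D.v0
      at-v0 {s} refl = cong (D._· D.v0) (wk-⟦⟧ ρ s)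

      on-v0 : ∀ {σ} {s : Trm Δ (σ ⟶ τ)} {x} → ⟦ s ⟧ ρ ≡ x → ⟦ wk {τ = σ} s · v0 ⟧ (liftS ρ) ≡ D.wk x D.· D.v0
      on-v0 {s = s} refl = cong (D._· D.v0) (wk-⟦⟧ ρ s)

    module _ {ρ : D.Sub Sg Δ Γ} where
      ≤ℝ-eq : ∀ g {s t x y} → ⟦ s ⟧ ρ ≡ x → ⟦ t ⟧ ρ ≡ y → ⟦ s ≤ℝ t [ g ] ⟧ᶠ ρ ≡ rel g (x D.≤ℝ y)
      ≤ℝ-eq g {s} {t} p q = rel-∀ g (rel-≤ℚ {ρ = liftS ρ} g {s = wk s · v0} {wk t · v0 +ℚ (2^- v0 +ℚ 2^- v0)} (at-v0 {s = s} p)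
        (cong (D._+ℚ (D.2^- D.v0 D.+ℚ D.2^- D.v0)) (at-v0 {s = t} q)))

      ≈ℝ-eq : ∀ g {s t x y} → ⟦ s ⟧ ρ ≡ x → ⟦ t ⟧ ρ ≡ y → ⟦ s ≈ℝ t [ g ] ⟧ᶠ ρ ≡ rel g (x D.≈ℝ y)
      ≈ℝ-eq g {s} {t} p q = rel-∀ g (rel-≤ℚ {ρ = liftS ρ} g {s = ∣ wk s · v0 -ℚ wk t · v0 ∣} {2^- v0}
        (cong₂ (λ a b → D.∣ a D.-ℚ b ∣ℚ) (at-v0 {s = s} p) (at-v0 {s = t} q)) refl)

      near-eq : ∀ g {s t k x y n} → ⟦ s ⟧ ρ ≡ x → ⟦ t ⟧ ρ ≡ y → ⟦ k ⟧ ρ ≡ n →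
                ⟦ near g s t k ⟧ᶠ ρ ≡ rel g (D.∣ x - y ∣<2^- n)
      near-eq g {s} {t} {k} p q refl = rel-∃ g (rel-<ℚ {ρ = liftS ρ} g {s = ∣ wk s · v0 -ℚ wk t · v0 ∣ +ℚ (2^- v0 +ℚ 2^- v0)} {2^- (wk k)}
        (cong₂ (λ a b → D.∣ a D.-ℚ b ∣ℚ D.+ℚ (D.2^- D.v0 D.+ℚ D.2^- D.v0)) (at-v0 {s = s} p) (at-v0 {s = t} q))
        (cong D.2^- (wk-⟦⟧ ρ k)))

    module _ {ρ : D.Sub Sg Δ Γ} where
      ∈ℝ-eq : ∀ g {s x} → ⟦ s ⟧ ρ ≡ x → ⟦ s ∈ℝ[ g ] ⟧ᶠ ρ ≡ rel g (x D.∈ℝ)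
      ∈ℝ-eq g {s} refl = rel-∀ g (rel-∀ g (rel-<ℚ {ρ = liftS (liftS ρ)} g
        {s = ∣ wk (wk s) · v1 -ℚ wk (wk s) · (v1 ⊕ v0) ∣} {2^- v1}
        (cong (λ a → D.∣ a D.· D.v1 D.-ℚ a D.· (D.v1 D.⊕ D.v0) ∣ℚ)
          (trans (wk-⟦⟧ (liftS ρ) (wk s)) (cong D.wk (wk-⟦⟧ ρ s)))) refl))

      𝕀-eq : ∀ g {s x} → ⟦ s ⟧ ρ ≡ x → ⟦ s ∈𝕀[ g ] ⟧ᶠ ρ ≡ rel g (x D.∈[0,1])
      𝕀-eq g {s} {x} p = rel-∧ g {B = x D.∈ℝ} {D.0ℝ D.≤ℝ x D.∧ x D.≤ℝ D.1ℝ} (∈ℝ-eq g {s = s} {x} p)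
        (rel-∧ g {B = D.0ℝ D.≤ℝ x} {x D.≤ℝ D.1ℝ} (≤ℝ-eq {ρ = ρ} g {s = con Const.K · 0ℚ} {s} {D.0ℝ} {x} refl p)
        (≤ℝ-eq {ρ = ρ} g {s = s} {con Const.K · 1ℚ} {x} {D.1ℝ} p refl))

    module _ {ρ : D.Sub Sg Δ Γ} where
      real→real-eq : ∀ g {f x} → ⟦ f ⟧ ρ ≡ x → ⟦ real→real g f ⟧ᶠ ρ ≡ rel g (x D.∈ℝ→ℝ)
      real→real-eq g {f} refl = rel-∧ g
        (rel-∀ g (rel-⊃ g (∈ℝ-eq {ρ = liftS ρ} g {s = v0} {D.v0} refl) (∈ℝ-eq {ρ = liftS ρ} g {s = wk f · v0} {D.wk (⟦ f ⟧ ρ) D.· D.v0} (on-v0 {s = f} refl))))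
        (rel-∀ g (rel-⊃ g (∈ℝ-eq {ρ = liftS ρ} g {s = v0} {D.v0} refl) (rel-∀ g (rel-⊃ g (∈ℝ-eq {ρ = liftS (liftS ρ)} g {s = v0} {D.v0} refl)
          (rel-⊃ g (≈ℝ-eq {ρ = liftS (liftS ρ)} g {s = v1} {v0} {D.v1} {D.v0} refl refl)
            (≈ℝ-eq {ρ = liftS (liftS ρ)} g {s = wk (wk f) · v1} {wk (wk f) · v0}
              {D.wk (D.wk (⟦ f ⟧ ρ)) D.· D.v1} {D.wk (D.wk (⟦ f ⟧ ρ)) D.· D.v0}
              (cong (D._· D.v1) (trans (wk-⟦⟧ (liftS ρ) (wk f)) (cong D.wk (wk-⟦⟧ ρ f))))
              (cong (D._· D.v0) (trans (wk-⟦⟧ (liftS ρ) (wk f)) (cong D.wk (wk-⟦⟧ ρ f))))))))))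

      continuous-eq : ∀ g {f x} → ⟦ f ⟧ ρ ≡ x → ⟦ continuous g f ⟧ᶠ ρ ≡ rel g
        (D.∀∈[0,1] (D.Formula.∀′ 𝟎 (D.Formula.∃′ 𝟎 (D.∀∈[0,1] (D.∣ D.wk D.v2 - D.v0 ∣<2^- D.v1 D.⊃
           D.∣ D.wk (D.wk (D.wk (D.wk x))) D.· D.wk D.v2 - D.wk (D.wk (D.wk (D.wk x))) D.· D.v0 ∣<2^- D.v2)))))
      continuous-eq g {f} refl = rel-∀ g (rel-⊃ g (𝕀-eq {ρ = liftS ρ} g {s = v0} {D.v0} refl) (rel-∀ g (rel-∃ g (rel-∀ g
        (rel-⊃ g (𝕀-eq {ρ = liftS (liftS (liftS (liftS ρ)))} g {s = v0} {D.v0} refl) (rel-⊃ g (near-eq {ρ = liftS (liftS (liftS (liftS ρ)))} g {s = v3} {v0} {v1} {D.wk D.v2} {D.v0} {D.v1} refl refl refl)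
          (near-eq {ρ = liftS (liftS (liftS (liftS ρ)))} g {s = wk (wk (wk (wk f))) · v3} {wk (wk (wk (wk f))) · v0} {v2}
            {D.wk (D.wk (D.wk (D.wk (⟦ f ⟧ ρ)))) D.· D.wk D.v2} {D.wk (D.wk (D.wk (D.wk (⟦ f ⟧ ρ)))) D.· D.v0} {D.v2}
            (cong (D._· D.wk D.v2) e) (cong (D._· D.v0) e) refl)))))))
        where
        e = trans (wk-⟦⟧ (liftS (liftS (liftS ρ))) (wk (wk (wk f)))) (cong D.wk
            (trans (wk-⟦⟧ (liftS (liftS ρ)) (wk (wk f))) (cong D.wk
            (trans (wk-⟦⟧ (liftS ρ) (wk f)) (cong D.wk (wk-⟦⟧ ρ f))))))

      C̄-eq : ∀ g {f x} → ⟦ f ⟧ ρ ≡ x → ⟦ f ∈C̄[ g ] ⟧ᶠ ρ ≡ rel g (x D.∈C̄[0,1])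
      C̄-eq g {f} {x} p = rel-∧ g (rel-∧ g (real→real-eq g {f = f} {x} p) (continuous-eq g {f = f} {x} p)) (rel-∧ g
        (≤ℝ-eq {ρ = ρ} g {s = con Const.K · 0ℚ} {f · (con Const.K · 0ℚ)} {D.0ℝ} {x D.· D.0ℝ} refl (cong (D._· D.0ℝ) p))
        (≤ℝ-eq {ρ = ρ} g {s = f · (con Const.K · 1ℚ)} {con Const.K · 0ℚ} {x D.· D.1ℝ} {D.0ℝ} (cong (D._· D.1ℝ) p) refl))

    private
      root-eq : {ρ : D.Sub Sg Δ Γ} (s t : Trm Δ 𝟏) {x y : D.Tm Sg Γ 𝟏} → ⟦ s ⟧ ρ ≡ x → ⟦ t ⟧ ρ ≡ y →
                ⟦ s ∈𝕀[ full ] ∧ t ≈ℝ con Const.K · 0ℚ [ full ] ⟧ᶠ ρ ≡ (x D.∈[0,1] D.∧ y D.≈ℝ D.0ℝ)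
      root-eq {ρ = ρ} s t {x} {y} p q = cong₂ D._∧_ (𝕀-eq {ρ = ρ} full {s} {x} p) (≈ℝ-eq {ρ = ρ} full {t} {con Const.K · 0ℚ} {y} {D.0ℝ} q refl)

    -- A record, since comparing the two sides of its field by unfolding is expensive.
    infix 4 _≋_
    record _≋_ (A : Fml []) (B : D.Formula Sg []) : Set where
      constructor reads-as
      field
        reading : ⟦ A ⟧ᶠ εᴰ ≡ B

    ⟦∃²⟧ : ∃² ≋ D.⟨∃²⟩
    ⟦∃²⟧ = reads-as refl

    ⟦TRANS⟧ : TRANS ≋ D.Π⁰₁-TRANS
    ⟦TRANS⟧ = reads-as refl

    ⟦IVT*⟧ : IVT* ≋ D.IVT*
    ⟦IVT*⟧ = reads-as $ cong₂ (λ A B → D.∀ˢᵗ (𝟏 ⟶ 𝟏) (A D.⊃ D.∃ˢᵗ 𝟏 B)) (C̄-eq {ρ = liftS εᴰ} std {v0} {D.v0} refl)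
      (root-eq {ρ = liftS (liftS εᴰ)} v0 (v1 · v0) {D.v0} {D.v1 D.· D.v0} refl refl)

    ⟦UIVT⟧ : UIVT ≋ D.UIVT
    ⟦UIVT⟧ = reads-as $ cong₂ (λ A B → D.Formula.∃′ ((𝟏 ⟶ 𝟏) ⟶ 𝟏) (D.Formula.∀′ (𝟏 ⟶ 𝟏) (A D.⊃ B)))
      (C̄-eq {ρ = liftS (liftS εᴰ)} full {v0} {D.v0} refl)
      (root-eq {ρ = liftS (liftS εᴰ)} (v1 · v0) (v0 · (v1 · v0)) {D.v1 D.· D.v0} {D.v0 D.· (D.v1 D.· D.v0)} refl refl)

  module Theorems {I : Set} (𝒟 : I → Specification) where
    private
      X : Poly (D.sig 𝒟) 𝟐
      X = Tm.ext nothing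

      ren-X : Closed X
      ren-X r = refl

    open Statements (D.sig 𝒟) X ren-X
    open Interpretation (D.sig 𝒟) X ren-X

    open Deductions (D.sig 𝒟) (D.RCA₀Ω 𝒟) D.base using (conv)

    -- Embedding, relativisation and instantiation of the specification all compute, so the axiom
    -- for Ξ₀ is literally the formula of `Ξ-ax`.
    spec-eq : {ρ : D.Sub (D.sig 𝒟) Δ Γ} → ⟦ ∀ˢᵗ 𝟐 (∀ˢᵗ 𝟏 ((∃ˢᵗ 𝟎 (v1 · v0 ≐ O) ⇔ v1 · v0 ≐ O) ∧ v1 · v0 ≤ one) ⊃ ∀ˢᵗ 𝟏 (Ξ · v0 ≐ v1 · v0)) ⟧ᶠ ρ ≡
      D.∀ˢᵗ 𝟐 ((D.embed D.∃²-formula D.ˢᵗ) D.⟨ D.v0 ⟩ D.⊃ (Tm.ext nothing D.≐ D.v0) D.ˢᵗ)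
    spec-eq = refl

    th-Ξ : ∀ {H : List (D.Formula (D.sig 𝒟) Γ)} (ρ : D.Sub (D.sig 𝒟) Δ Γ) → D.RCA₀Ω 𝒟 D.∣ H ⊢
      ⟦ ∀ˢᵗ 𝟐 (∀ˢᵗ 𝟏 ((∃ˢᵗ 𝟎 (v1 · v0 ≐ O) ⇔ v1 · v0 ≐ O) ∧ v1 · v0 ≤ one) ⊃ ∀ˢᵗ 𝟏 (Ξ · v0 ≐ v1 · v0)) ⟧ᶠ ρ
    th-Ξ ρ = conv (sym (spec-eq {ρ = ρ})) (D.∧E₂ (D.ax (D.Ξ₀ nothing)))

    open Soundness.Sound (D.sig 𝒟) (D.RCA₀Ω 𝒟) D.base X ren-X D.st-≐ D.st-closed D.st-app D.HAC-int D.PF-TP∀ (D.∧E₁ (D.ax (D.Ξ₀ nothing))) th-Ξ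

    equivalence : {A B : Fml []} {A′ B′ : D.Formula (D.sig 𝒟) []} → A ≋ A′ → B ≋ B′ →
                  A ∷ [] ⊩ B → B ∷ [] ⊩ A → D.RCA₀Ω 𝒟 D.⊢ A′ D.⇔ B′
    equivalence (reads-as e) (reads-as e′) d d′ = conv (cong₂ D._⇔_ e e′) (sound (∧I (⊃I d) (⊃I d′)) εᴰ (λ ()))

    ∃²⇔TRANS : D.RCA₀Ω 𝒟 D.⊢ D.⟨∃²⟩ D.⇔ D.Π⁰₁-TRANS
    ∃²⇔TRANS = equivalence ⟦∃²⟧ ⟦TRANS⟧ (∃²⇒TRANS h0) (TRANS⇒∃² h0)

    TRANS⇔IVT* : D.RCA₀Ω 𝒟 D.⊢ D.Π⁰₁-TRANS D.⇔ D.IVT*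
    TRANS⇔IVT* = equivalence ⟦TRANS⟧ ⟦IVT*⟧ (TRANS⇒IVT* h0) (IVT*⇒TRANS h0)

    IVT*⇔UIVT : D.RCA₀Ω 𝒟 D.⊢ D.IVT* D.⇔ D.UIVT
    IVT*⇔UIVT = equivalence ⟦IVT*⟧ ⟦UIVT⟧ (∃²⇒UIVT (TRANS⇒∃² (IVT*⇒TRANS h0)))
      (TRANS⇒IVT* (∃²⇒TRANS (UIVT⇒∃² h0)))

open import Defs

corollary3p11 : {I : Set} (𝒟 : I → Specification) →
    (RCA₀Ω 𝒟 ⊢ ⟨∃²⟩ ⇔ Π⁰₁-TRANS) ×
    (RCA₀Ω 𝒟 ⊢ Π⁰₁-TRANS ⇔ IVT*) ×
    (RCA₀Ω 𝒟 ⊢ IVT* ⇔ UIVT)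
corollary3p11 𝒟 = C.∃²⇔TRANS , C.TRANS⇔IVT* , C.IVT*⇔UIVT
  where module C = Statements.Theorems 𝒟
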